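{- Every finite tree $T$ satisfies $$|B(T)|\le\left\lceil \mathrm{DN}_{\mathrm{LLY}}(T)\right\rceil,$$ where $B(T):=\{v\in V(T): d_v\ge 3\}$ is the set of branch vertices of $T$.
   Context: Graphs are simple and undirected; $d_v$ is the degree of $v$. Let $d(\cdot,\cdot)$ be the combinatorial graph distance. For a positive edge weight $w:E\to(0,\infty)$ put $d_x^w:=\sum_{y\sim x}w_{xy}$. For $\alpha\in[0,1]$ let $\mu_x^{\alpha,w}$ be the probability measure with $\mu_x^{\alpha,w}(x)=\alpha$, $\mu_x^{\alpha,w}(z)=(1-\alpha)w_{xz}/d_x^w$ for $z\sim x$, and $0$ otherwise. Let $W_1$ be the $1$-Wasserstein distance with respect to $d$. For $x\sim y$ let $\kappa_\alpha^w(x,y):=1-W_1(\mu_x^{\alpha,w},\mu_y^{\alpha,w})$ and define the weighted Lin--Lu--Yau curvature $\kappa_{\mathrm{LLY}}^w(x,y):=\lim_{\alpha\to1^- }\kappa_\alpha^w(x,y)/(1-\alpha)$. For connected locally finite $G$ with $E\neq\varnothing$: $\mathrm{Dist}(w):=\sup_{e\in E}w_e/\inf_{e\in E}w_e$, with value $+\infty$ if the supremum is infinite or the infimum is $0$; a positive weight $w$ is admissible if $\kappa_{\mathrm{LLY}}^w(e)\ge0$ for every $e\in E$; and $\mathrm{DN}_{\mathrm{LLY}}(G):=\inf\{\mathrm{Dist}(w): w \text{ admissible}\}$, with value $+\infty$ if no admissible weight has finite distortion. By convention $\mathrm{DN}_{\mathrm{LLY}}(K_1)=1$. -}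

module Defs where

open import Level using (Level; _⊔_; 0ℓ)
open import Algebra.Bundles using (CommutativeMonoid)
open import Data.Empty using (⊥-elim)
open import Data.Fin.Base using (Fin; zero; suc)
open import Data.Fin.Properties using (any?) renaming (_≟_ to _≟ᶠ_)
open import Data.Integer.Base as ℤ using (ℤ; +_)
open import Data.List.Base using (List; _∷_; _∷ʳ_; length; filter; allFin)
open import Data.List.Relation.Unary.Linked using (Linked)
open import Data.List.Relation.Unary.Unique.Propositional using (Unique)
open import Data.Nat.Base as ℕ using (ℕ; zero; suc)
import Data.Nat.Properties as ℕ
open import Data.Product.Base using (∃; ∃-syntax; _×_; _,_; proj₁; proj₂)
open import Data.Rational.Base as ℚ using (ℚ; 0ℚ; 1ℚ; ½)
import Data.Rational.Properties as ℚ
open import Data.Vec.Functional using (Vector; foldr)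
open import Relation.Binary.Core using (Rel)
import Relation.Binary.Definitions as B
open import Relation.Binary.PropositionalEquality
  using (_≡_; refl; sym; trans; cong; cong₂; subst; subst₂; module ≡-Reasoning)
import Relation.Binary.Construct.Add.Supremum.NonStrict as AddSup
open import Relation.Nullary using (¬_; Dec; yes; no)
open import Relation.Nullary.Construct.Add.Supremum using (_⁺; [_]; ⊤⁺)
open import Relation.Nullary.Decidable using (_×-dec_)
open import Relation.Unary using (Pred; Decidable)

------------------------------------------------------------------------
-- Real numbers: Cauchy sequences of rationals, considered up to _≈_.

Cauchy : (ℕ → ℚ) → Set
Cauchy f = ∀ ε → 0ℚ ℚ.< ε →
  ∃[ N ] ∀ m n → N ℕ.≤ m → N ℕ.≤ n → ℚ.∣ f m ℚ.- f n ∣ ℚ.< ε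

record ℝ : Set where
  constructor mkℝ
  field
    seq    : ℕ → ℚ
    cauchy : Cauchy seq

open ℝ public

infix 4 _<_ _≤_ _≈_

_<_ : Rel ℝ 0ℓ
x < y = ∃[ ε ] 0ℚ ℚ.< ε × ∃[ N ] ∀ n → N ℕ.≤ n → seq x n ℚ.+ ε ℚ.≤ seq y n

_≤_ : Rel ℝ 0ℓ
x ≤ y = ¬ (y < x)

_≈_ : Rel ℝ 0ℓ
x ≈ y = ∀ ε → 0ℚ ℚ.< ε →
  ∃[ N ] ∀ n → N ℕ.≤ n → ℚ.∣ seq x n ℚ.- seq y n ∣ ℚ.< ε

private abstract
  +-minus-+ : ∀ a b c d → (a ℚ.+ b) ℚ.- (c ℚ.+ d) ≡ (a ℚ.- c) ℚ.+ (b ℚ.- d)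
  +-minus-+ a b c d =
    trans (cong (a ℚ.+ b ℚ.+_) (ℚ.neg-distrib-+ c d)) (interchange a b (ℚ.- c) (ℚ.- d))
    where open import Algebra.Properties.CommutativeSemigroup
                        (CommutativeMonoid.commutativeSemigroup ℚ.+-0-commutativeMonoid) using (interchange)

  minus-plus : ∀ a b → a ≡ (a ℚ.- b) ℚ.+ b
  minus-plus a b = sym (trans (ℚ.+-assoc a (ℚ.- b) b)
    (trans (cong (a ℚ.+_) (ℚ.+-inverseˡ b)) (ℚ.+-identityʳ a)))

  plus-minus : ∀ a b → (a ℚ.+ b) ℚ.- a ≡ 0ℚ ℚ.+ b
  plus-minus a b = trans (ℚ.+-comm (a ℚ.+ b) (ℚ.- a))
    (trans (sym (ℚ.+-assoc (ℚ.- a) a b)) (cong (ℚ._+ b) (ℚ.+-inverseˡ a)))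

  *-distribˡ-minus : ∀ a b c → a ℚ.* (b ℚ.- c) ≡ a ℚ.* b ℚ.- a ℚ.* c
  *-distribˡ-minus a b c = trans (ℚ.*-distribˡ-+ a b (ℚ.- c))
    (cong (a ℚ.* b ℚ.+_) (sym (ℚ.neg-distribʳ-* a c)))

  *-minus-* : ∀ a b c d →
    a ℚ.* b ℚ.- c ℚ.* d ≡ a ℚ.* (b ℚ.- d) ℚ.+ d ℚ.* (a ℚ.- c)
  *-minus-* a b c d = sym (begin
    a ℚ.* (b ℚ.- d) ℚ.+ d ℚ.* (a ℚ.- c)
      ≡⟨ cong₂ ℚ._+_ (*-distribˡ-minus a b d) (*-distribˡ-minus d a c) ⟩
    (a ℚ.* b ℚ.- a ℚ.* d) ℚ.+ (d ℚ.* a ℚ.- d ℚ.* c)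
      ≡⟨ cong₂ (λ u v → (a ℚ.* b ℚ.- a ℚ.* d) ℚ.+ (u ℚ.- v)) (ℚ.*-comm d a) (ℚ.*-comm d c) ⟩
    (a ℚ.* b ℚ.- a ℚ.* d) ℚ.+ (a ℚ.* d ℚ.- c ℚ.* d)
      ≡⟨ sym (ℚ.+-assoc (a ℚ.* b ℚ.- a ℚ.* d) (a ℚ.* d) (ℚ.- (c ℚ.* d))) ⟩
    ((a ℚ.* b ℚ.- a ℚ.* d) ℚ.+ a ℚ.* d) ℚ.- c ℚ.* d
      ≡⟨ cong (ℚ._- c ℚ.* d) (sym (minus-plus (a ℚ.* b) (a ℚ.* d))) ⟩
    a ℚ.* b ℚ.- c ℚ.* d ∎)
    where open ≡-Reasoning

  minus-*-* : ∀ a c r s →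
    (r ℚ.- s) ℚ.* (a ℚ.* c) ≡ (a ℚ.* r) ℚ.* c ℚ.- (c ℚ.* s) ℚ.* a
  minus-*-* a c r s = begin
    (r ℚ.- s) ℚ.* (a ℚ.* c)
      ≡⟨ ℚ.*-comm (r ℚ.- s) (a ℚ.* c) ⟩
    (a ℚ.* c) ℚ.* (r ℚ.- s)
      ≡⟨ *-distribˡ-minus (a ℚ.* c) r s ⟩
    (a ℚ.* c) ℚ.* r ℚ.- (a ℚ.* c) ℚ.* s
      ≡⟨ cong₂ ℚ._-_ (xy∙z≈xz∙y a c r) (xy∙z≈yz∙x a c s) ⟩
    (a ℚ.* r) ℚ.* c ℚ.- (c ℚ.* s) ℚ.* a ∎
    where open ≡-Reasoning
          open import Algebra.Properties.CommutativeSemigroup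
                        (CommutativeMonoid.commutativeSemigroup ℚ.*-1-commutativeMonoid) using (xy∙z≈xz∙y; xy∙z≈yz∙x)

  ½ε>0 : ∀ {ε} → 0ℚ ℚ.< ε → 0ℚ ℚ.< ½ ℚ.* ε
  ½ε>0 {ε} ε>0 = subst (ℚ._< ½ ℚ.* ε) (ℚ.*-zeroʳ ½) (ℚ.*-monoʳ-<-pos ½ ε>0)

  halves : ∀ ε → ½ ℚ.* ε ℚ.+ ½ ℚ.* ε ≡ ε
  halves ε = trans (sym (ℚ.*-distribʳ-+ ε ½ ½)) (ℚ.*-identityˡ ε)

  *>0 : ∀ {p q} → 0ℚ ℚ.< p → 0ℚ ℚ.< q → 0ℚ ℚ.< p ℚ.* q
  *>0 {p} {q} p>0 q>0 =
    ℚ.positive⁻¹ (p ℚ.* q)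
      {{ℚ.pos*pos⇒pos p {{ℚ.positive p>0}} q {{ℚ.positive q>0}}}}

  const-cauchy : ∀ q → Cauchy (λ _ → q)
  const-cauchy q ε ε>0 = 0 , λ _ _ _ _ →
    subst (ℚ._< ε) (cong ℚ.∣_∣ (sym (ℚ.+-inverseʳ q))) ε>0

  +-cauchy : ∀ f g → Cauchy f → Cauchy g → Cauchy (λ n → f n ℚ.+ g n)
  +-cauchy f g cf cg ε ε>0 with cf (½ ℚ.* ε) (½ε>0 ε>0) | cg (½ ℚ.* ε) (½ε>0 ε>0)
  ... | M , hM | N , hN = M ℕ.⊔ N , λ m n p q → begin-strict
      ℚ.∣ (f m ℚ.+ g m) ℚ.- (f n ℚ.+ g n) ∣
        ≡⟨ cong ℚ.∣_∣ (+-minus-+ (f m) (g m) (f n) (g n)) ⟩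
      ℚ.∣ (f m ℚ.- f n) ℚ.+ (g m ℚ.- g n) ∣
        ≤⟨ ℚ.∣p+q∣≤∣p∣+∣q∣ (f m ℚ.- f n) (g m ℚ.- g n) ⟩
      ℚ.∣ f m ℚ.- f n ∣ ℚ.+ ℚ.∣ g m ℚ.- g n ∣
        <⟨ ℚ.+-mono-< (hM m n (ℕ.m⊔n≤o⇒m≤o M N p) (ℕ.m⊔n≤o⇒m≤o M N q))
                      (hN m n (ℕ.m⊔n≤o⇒n≤o M N p) (ℕ.m⊔n≤o⇒n≤o M N q)) ⟩
      ½ ℚ.* ε ℚ.+ ½ ℚ.* ε
        ≡⟨ halves ε ⟩
      ε ∎
    where open ℚ.≤-Reasoning

  neg-cauchy : ∀ f → Cauchy f → Cauchy (λ n → ℚ.- f n)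
  neg-cauchy f cf ε ε>0 with cf ε ε>0
  ... | N , hN = N , λ m n p q → begin-strict
      ℚ.∣ ℚ.- f m ℚ.- ℚ.- f n ∣
        ≡⟨ cong ℚ.∣_∣ (sym (ℚ.neg-distrib-+ (f m) (ℚ.- f n))) ⟩
      ℚ.∣ ℚ.- (f m ℚ.- f n) ∣
        ≡⟨ ℚ.∣-p∣≡∣p∣ (f m ℚ.- f n) ⟩
      ℚ.∣ f m ℚ.- f n ∣
        <⟨ hN m n p q ⟩
      ε ∎
    where open ℚ.≤-Reasoning

  bounded : ∀ f → Cauchy f →
    ∃[ K ] 0ℚ ℚ.< K × ∃[ N ] ∀ n → N ℕ.≤ n → ℚ.∣ f n ∣ ℚ.≤ K
  bounded f cf with cf 1ℚ (ℚ.positive⁻¹ 1ℚ)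
  ... | N , hN =
    1ℚ ℚ.+ ℚ.∣ f N ∣ ,
    ℚ.<-≤-trans (ℚ.positive⁻¹ 1ℚ)
      (subst (ℚ._≤ 1ℚ ℚ.+ ℚ.∣ f N ∣) (ℚ.+-identityʳ 1ℚ) (ℚ.+-monoʳ-≤ 1ℚ (ℚ.0≤∣p∣ (f N)))) ,
    N , λ n p → begin
      ℚ.∣ f n ∣
        ≡⟨ cong ℚ.∣_∣ (minus-plus (f n) (f N)) ⟩
      ℚ.∣ (f n ℚ.- f N) ℚ.+ f N ∣
        ≤⟨ ℚ.∣p+q∣≤∣p∣+∣q∣ (f n ℚ.- f N) (f N) ⟩
      ℚ.∣ f n ℚ.- f N ∣ ℚ.+ ℚ.∣ f N ∣
        ≤⟨ ℚ.+-monoˡ-≤ ℚ.∣ f N ∣ (ℚ.<⇒≤ (hN n N p ℕ.≤-refl)) ⟩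
      1ℚ ℚ.+ ℚ.∣ f N ∣ ∎
    where open ℚ.≤-Reasoning

  rescale : ∀ {K ε} → 0ℚ ℚ.< K → 0ℚ ℚ.< ε → ∃[ η ] 0ℚ ℚ.< η × K ℚ.* η ≡ ε
  rescale {K} {ε} K>0 ε>0 =
    1/K ℚ.* ε , *>0 (ℚ.positive⁻¹ 1/K {{ℚ.1/pos⇒pos K}}) ε>0 ,
    trans (sym (ℚ.*-assoc K 1/K ε))
      (trans (cong (ℚ._* ε) (ℚ.*-inverseʳ K)) (ℚ.*-identityˡ ε))
    where
    instance
      K⁺ : ℚ.Positive K
      K⁺ = ℚ.positive K>0
      K≢0 : ℚ.NonZero K
      K≢0 = ℚ.pos⇒nonZero K
    1/K : ℚ
    1/K = ℚ.1/ K

  *-cauchy : ∀ f g → Cauchy f → Cauchy g → Cauchy (λ n → f n ℚ.* g n)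
  *-cauchy f g cf cg ε ε>0
    with bounded f cf | bounded g cg
  ... | K , K>0 , N₁ , hK | L , L>0 , N₂ , hL
    with rescale K>0 (½ε>0 ε>0) | rescale L>0 (½ε>0 ε>0)
  ... | η , η>0 , Kη≡ | θ , θ>0 , Lθ≡
    with cf θ θ>0 | cg η η>0
  ... | N₃ , h₃ | N₄ , h₄ = N , bound
    where
    open ℚ.≤-Reasoning
    N : ℕ
    N = (N₁ ℕ.⊔ N₂) ℕ.⊔ (N₃ ℕ.⊔ N₄)
    instance
      K⁺ : ℚ.Positive K
      K⁺ = ℚ.positive K>0
      L⁺ : ℚ.Positive L
      L⁺ = ℚ.positive L>0
    bound : ∀ m n → N ℕ.≤ m → N ℕ.≤ n → ℚ.∣ f m ℚ.* g m ℚ.- f n ℚ.* g n ∣ ℚ.< ε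
    bound m n p q = begin-strict
      ℚ.∣ f m ℚ.* g m ℚ.- f n ℚ.* g n ∣
        ≡⟨ cong ℚ.∣_∣ (*-minus-* (f m) (g m) (f n) (g n)) ⟩
      ℚ.∣ f m ℚ.* (g m ℚ.- g n) ℚ.+ g n ℚ.* (f m ℚ.- f n) ∣
        ≤⟨ ℚ.∣p+q∣≤∣p∣+∣q∣ (f m ℚ.* (g m ℚ.- g n)) (g n ℚ.* (f m ℚ.- f n)) ⟩
      ℚ.∣ f m ℚ.* (g m ℚ.- g n) ∣ ℚ.+ ℚ.∣ g n ℚ.* (f m ℚ.- f n) ∣
        ≡⟨ cong₂ ℚ._+_ (ℚ.∣p*q∣≡∣p∣*∣q∣ (f m) (g m ℚ.- g n))
                          (ℚ.∣p*q∣≡∣p∣*∣q∣ (g n) (f m ℚ.- f n)) ⟩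
      ℚ.∣ f m ∣ ℚ.* ℚ.∣ g m ℚ.- g n ∣ ℚ.+ ℚ.∣ g n ∣ ℚ.* ℚ.∣ f m ℚ.- f n ∣
        ≤⟨ ℚ.+-mono-≤
             (ℚ.*-monoʳ-≤-nonNeg ℚ.∣ g m ℚ.- g n ∣ {{ℚ.∣-∣-nonNeg (g m ℚ.- g n)}} (hK m N₁≤m))
             (ℚ.*-monoʳ-≤-nonNeg ℚ.∣ f m ℚ.- f n ∣ {{ℚ.∣-∣-nonNeg (f m ℚ.- f n)}} (hL n N₂≤n)) ⟩
      K ℚ.* ℚ.∣ g m ℚ.- g n ∣ ℚ.+ L ℚ.* ℚ.∣ f m ℚ.- f n ∣
        <⟨ ℚ.+-mono-< (ℚ.*-monoʳ-<-pos K (h₄ m n (N₄≤ p) (N₄≤ q)))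
                      (ℚ.*-monoʳ-<-pos L (h₃ m n (N₃≤ p) (N₃≤ q))) ⟩
      K ℚ.* η ℚ.+ L ℚ.* θ
        ≡⟨ cong₂ ℚ._+_ Kη≡ Lθ≡ ⟩
      ½ ℚ.* ε ℚ.+ ½ ℚ.* ε
        ≡⟨ halves ε ⟩
      ε ∎
      where
      N₁≤m : N₁ ℕ.≤ m
      N₁≤m = ℕ.m⊔n≤o⇒m≤o N₁ N₂ (ℕ.m⊔n≤o⇒m≤o (N₁ ℕ.⊔ N₂) (N₃ ℕ.⊔ N₄) p)
      N₂≤n : N₂ ℕ.≤ n
      N₂≤n = ℕ.m⊔n≤o⇒n≤o N₁ N₂ (ℕ.m⊔n≤o⇒m≤o (N₁ ℕ.⊔ N₂) (N₃ ℕ.⊔ N₄) q)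
      N₃≤ : ∀ {k} → N ℕ.≤ k → N₃ ℕ.≤ k
      N₃≤ r = ℕ.m⊔n≤o⇒m≤o N₃ N₄ (ℕ.m⊔n≤o⇒n≤o (N₁ ℕ.⊔ N₂) (N₃ ℕ.⊔ N₄) r)
      N₄≤ : ∀ {k} → N ℕ.≤ k → N₄ ℕ.≤ k
      N₄≤ r = ℕ.m⊔n≤o⇒n≤o N₃ N₄ (ℕ.m⊔n≤o⇒n≤o (N₁ ℕ.⊔ N₂) (N₃ ℕ.⊔ N₄) r)

-- Total reciprocal with recip 0 = 0; a sequence bounded away from 0
-- meets the junk value only finitely often.
recip : ℚ → ℚ
recip p with p ℚ.≟ 0ℚ
... | yes _  = 0ℚ
... | no p≢0 = ℚ.1/_ p {{ℚ.≢-nonZero p≢0}}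

*-recip : ∀ p → 0ℚ ℚ.< p → p ℚ.* recip p ≡ 1ℚ
*-recip p p>0 with p ℚ.≟ 0ℚ
... | yes p≡0 = ⊥-elim (ℚ.<-irrefl (sym p≡0) p>0)
... | no p≢0  = ℚ.*-inverseʳ p {{ℚ.≢-nonZero p≢0}}

private abstract
  recip-cauchy : ∀ f {δ} → Cauchy f → 0ℚ ℚ.< δ →
    (∃[ N ] ∀ n → N ℕ.≤ n → 0ℚ ℚ.+ δ ℚ.≤ f n) → Cauchy (λ n → recip (f n))
  recip-cauchy f {δ} cf δ>0 (M , hM) ε ε>0
    with cf (ε ℚ.* (δ ℚ.* δ)) (*>0 ε>0 (*>0 δ>0 δ>0))
  ... | N , hN = M ℕ.⊔ N , λ m n p q →
      bound m n (hM m (ℕ.m⊔n≤o⇒m≤o M N p)) (hM n (ℕ.m⊔n≤o⇒m≤o M N q))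
        (hN n m (ℕ.m⊔n≤o⇒n≤o M N q) (ℕ.m⊔n≤o⇒n≤o M N p))
    where
    open ℚ.≤-Reasoning
    instance
      δ⁺ : ℚ.NonNegative δ
      δ⁺ = ℚ.nonNegative (ℚ.<⇒≤ δ>0)
      δδ⁺ : ℚ.NonNegative (δ ℚ.* δ)
      δδ⁺ = ℚ.nonNeg*nonNeg⇒nonNeg δ δ
    bound : ∀ m n → 0ℚ ℚ.+ δ ℚ.≤ f m → 0ℚ ℚ.+ δ ℚ.≤ f n →
      ℚ.∣ f n ℚ.- f m ∣ ℚ.< ε ℚ.* (δ ℚ.* δ) →
      ℚ.∣ recip (f m) ℚ.- recip (f n) ∣ ℚ.< ε
    bound m n δ≤a′ δ≤c′ close = ℚ.*-cancelʳ-<-nonNeg (δ ℚ.* δ) (begin-strict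
      ℚ.∣ ra ℚ.- rc ∣ ℚ.* (δ ℚ.* δ)
        ≤⟨ ℚ.*-monoˡ-≤-nonNeg ℚ.∣ ra ℚ.- rc ∣ {{ℚ.∣-∣-nonNeg (ra ℚ.- rc)}}
             (ℚ.≤-trans (ℚ.*-monoˡ-≤-nonNeg δ δ≤c)
                        (ℚ.*-monoʳ-≤-nonNeg c {{ℚ.nonNegative (ℚ.<⇒≤ c>0)}} δ≤a)) ⟩
      ℚ.∣ ra ℚ.- rc ∣ ℚ.* (a ℚ.* c)
        ≡⟨ cong (ℚ.∣ ra ℚ.- rc ∣ ℚ.*_) (sym (ℚ.0≤p⇒∣p∣≡p (ℚ.<⇒≤ (*>0 a>0 c>0)))) ⟩
      ℚ.∣ ra ℚ.- rc ∣ ℚ.* ℚ.∣ a ℚ.* c ∣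
        ≡⟨ sym (ℚ.∣p*q∣≡∣p∣*∣q∣ (ra ℚ.- rc) (a ℚ.* c)) ⟩
      ℚ.∣ (ra ℚ.- rc) ℚ.* (a ℚ.* c) ∣
        ≡⟨ cong ℚ.∣_∣ (minus-*-* a c ra rc) ⟩
      ℚ.∣ (a ℚ.* ra) ℚ.* c ℚ.- (c ℚ.* rc) ℚ.* a ∣
        ≡⟨ cong₂ (λ u v → ℚ.∣ u ℚ.* c ℚ.- v ℚ.* a ∣) (*-recip a a>0) (*-recip c c>0) ⟩
      ℚ.∣ 1ℚ ℚ.* c ℚ.- 1ℚ ℚ.* a ∣
        ≡⟨ cong₂ (λ u v → ℚ.∣ u ℚ.- v ∣) (ℚ.*-identityˡ c) (ℚ.*-identityˡ a) ⟩
      ℚ.∣ c ℚ.- a ∣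
        <⟨ close ⟩
      ε ℚ.* (δ ℚ.* δ) ∎)
      where
      a c ra rc : ℚ
      a = f m
      c = f n
      ra = recip a
      rc = recip c
      δ≤a : δ ℚ.≤ a
      δ≤a = subst (ℚ._≤ a) (ℚ.+-identityˡ δ) δ≤a′
      δ≤c : δ ℚ.≤ c
      δ≤c = subst (ℚ._≤ c) (ℚ.+-identityˡ δ) δ≤c′
      a>0 : 0ℚ ℚ.< a
      a>0 = ℚ.<-≤-trans δ>0 δ≤a
      c>0 : 0ℚ ℚ.< c
      c>0 = ℚ.<-≤-trans δ>0 δ≤c

fromℚ : ℚ → ℝ
fromℚ q = mkℝ (λ _ → q) (const-cauchy q)

fromℤ : ℤ → ℝ
fromℤ i = fromℚ (i ℚ./ 1)

fromℕ : ℕ → ℝ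
fromℕ n = fromℤ (+ n)

0ℝ 1ℝ : ℝ
0ℝ = fromℚ 0ℚ
1ℝ = fromℚ 1ℚ

infixl 6 _+_ _-_
infixl 7 _*_ _÷_
infix  8 -_

_+_ : ℝ → ℝ → ℝ
x + y = mkℝ (λ n → seq x n ℚ.+ seq y n) (+-cauchy (seq x) (seq y) (cauchy x) (cauchy y))

-_ : ℝ → ℝ
- x = mkℝ (λ n → ℚ.- seq x n) (neg-cauchy (seq x) (cauchy x))

_-_ : ℝ → ℝ → ℝ
x - y = x + - y

_*_ : ℝ → ℝ → ℝ
x * y = mkℝ (λ n → seq x n ℚ.* seq y n) (*-cauchy (seq x) (seq y) (cauchy x) (cauchy y))

inverse : (x : ℝ) → 0ℝ < x → ℝ
inverse x (δ , δ>0 , x≥δ) =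
  mkℝ (λ n → recip (seq x n)) (recip-cauchy (seq x) (cauchy x) δ>0 x≥δ)

_÷_ : (x y : ℝ) → 0ℝ < y → ℝ
(x ÷ y) y>0 = x * inverse y y>0

∑ : ∀ {n} → Vector ℝ n → ℝ
∑ = foldr _+_ 0ℝ

abstract
  x<y⇒0<y-x : ∀ x y → x < y → 0ℝ < y - x
  x<y⇒0<y-x x y (ε , ε>0 , N , h) = ε , ε>0 , N , λ n p →
    subst₂ ℚ._≤_
      (plus-minus (seq x n) ε) refl
      (ℚ.+-monoˡ-≤ (ℚ.- seq x n) (h n p))

private
  EventuallyNonNeg : ℝ → Set
  EventuallyNonNeg x = ∃[ N ] ∀ n → N ℕ.≤ n → 0ℚ ℚ.≤ seq x n

  abstract
    0<⇒nonNeg : ∀ x → 0ℝ < x → EventuallyNonNeg x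
    0<⇒nonNeg x (ε , ε>0 , N , h) = N , λ n p →
      ℚ.≤-trans (ℚ.<⇒≤ ε>0) (subst (ℚ._≤ seq x n) (ℚ.+-identityˡ ε) (h n p))

    nonNeg-+ : ∀ x y → EventuallyNonNeg x → EventuallyNonNeg y → EventuallyNonNeg (x + y)
    nonNeg-+ x y (M , hM) (N , hN) = M ℕ.⊔ N , λ n p →
      ℚ.+-mono-≤ (hM n (ℕ.m⊔n≤o⇒m≤o M N p)) (hN n (ℕ.m⊔n≤o⇒n≤o M N p))

    0<-+ˡ : ∀ x y → 0ℝ < x → EventuallyNonNeg y → 0ℝ < x + y
    0<-+ˡ x y (ε , ε>0 , M , hM) (N , hN) = ε , ε>0 , M ℕ.⊔ N , λ n p →
      subst (ℚ._≤ seq x n ℚ.+ seq y n) (ℚ.+-identityʳ (0ℚ ℚ.+ ε))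
        (ℚ.+-mono-≤ (hM n (ℕ.m⊔n≤o⇒m≤o M N p)) (hN n (ℕ.m⊔n≤o⇒n≤o M N p)))

    0<-+ʳ : ∀ x y → EventuallyNonNeg x → 0ℝ < y → 0ℝ < x + y
    0<-+ʳ x y (M , hM) (ε , ε>0 , N , hN) = ε , ε>0 , M ℕ.⊔ N , λ n p →
      subst (ℚ._≤ seq x n ℚ.+ seq y n) (ℚ.+-identityˡ (0ℚ ℚ.+ ε))
        (ℚ.+-mono-≤ (hM n (ℕ.m⊔n≤o⇒m≤o M N p)) (hN n (ℕ.m⊔n≤o⇒n≤o M N p)))

    ∑-nonNeg : ∀ {n} (f : Vector ℝ n) → (∀ i → EventuallyNonNeg (f i)) → EventuallyNonNeg (∑ f)
    ∑-nonNeg {zero}  f h = 0 , λ _ _ → ℚ.≤-refl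
    ∑-nonNeg {suc n} f h =
      nonNeg-+ (f zero) (∑ (λ i → f (suc i))) (h zero) (∑-nonNeg (λ i → f (suc i)) (λ i → h (suc i)))

    ∑-pos : ∀ {n} (f : Vector ℝ n) → (∀ i → EventuallyNonNeg (f i)) → ∀ i → 0ℝ < f i → 0ℝ < ∑ f
    ∑-pos f h zero    p = 0<-+ˡ (f zero) (∑ (λ i → f (suc i))) p (∑-nonNeg (λ i → f (suc i)) (λ i → h (suc i)))
    ∑-pos f h (suc i) p = 0<-+ʳ (f zero) (∑ (λ i → f (suc i))) (h zero) (∑-pos (λ i → f (suc i)) (λ i → h (suc i)) i p)

------------------------------------------------------------------------
-- Suprema, infima, and the extended half-line.  A supremum, limit or
-- ceiling of reals is not a computable function of its data, so each such
-- quantity is given by the relation saying that a value is that quantity.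

module _ {a ℓ p : Level} {A : Set a} (_≼_ : Rel A ℓ) (P : Pred A p) where

  IsSupremum : A → Set (a ⊔ ℓ ⊔ p)
  IsSupremum s = (∀ x → P x → x ≼ s) × (∀ u → (∀ x → P x → x ≼ u) → s ≼ u)

  IsInfimum : A → Set (a ⊔ ℓ ⊔ p)
  IsInfimum i = (∀ x → P x → i ≼ x) × (∀ l → (∀ x → P x → l ≼ x) → l ≼ i)

module ℝ⁺ = AddSup _≤_
module ℤ⁺ = AddSup ℤ._≤_

-- ⌈ r ⌉ is the least integer that is at least r, and ⌈ +∞ ⌉ = +∞.
data IsCeiling : ℝ ⁺ → ℤ ⁺ → Set where
  finite   : ∀ {r m} → r ≤ fromℤ m → (∀ k → r ≤ fromℤ k → m ℤ.≤ k) →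
             IsCeiling [ r ] [ m ]
  infinite : IsCeiling ⊤⁺ ⊤⁺

------------------------------------------------------------------------
-- Finite simple graphs

record Graph (n : ℕ) : Set₁ where
  infix 4 _∼_ _∼?_
  field
    _∼_      : Rel (Fin n) 0ℓ
    _∼?_     : B.Decidable _∼_
    ∼-sym    : B.Symmetric _∼_
    ∼-irrefl : ∀ x → ¬ (x ∼ x)

  degree : Fin n → ℕ
  degree x = length (filter (x ∼?_) (allFin n))

  Walk : ℕ → Fin n → Fin n → Set
  Walk zero    x y = x ≡ y
  Walk (suc k) x y = ∃[ z ] x ∼ z × Walk k z y

  walk? : ∀ k x y → Dec (Walk k x y)
  walk? zero    x y = x ≟ᶠ y
  walk? (suc k) x y = any? (λ z → (x ∼? z) ×-dec walk? k z y)

  record Cycle : Set where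
    field
      start    : Fin n
      rest     : List (Fin n)
      distinct : Unique (start ∷ rest)
      linked   : Linked _∼_ (start ∷ rest ∷ʳ start)
      length≥3 : 3 ℕ.≤ length (start ∷ rest)

least : ∀ {P : Pred ℕ 0ℓ} → Decidable P → ∀ k → P k →
  ∃[ m ] P m × (∀ j → P j → m ℕ.≤ j)
least P? k Pk with P? 0
least P? k       Pk | yes P0 = 0 , P0 , λ _ _ → ℕ.z≤n
least P? zero    Pk | no ¬P0 = ⊥-elim (¬P0 Pk)
least P? (suc k) Pk | no ¬P0 with least (λ j → P? (suc j)) k Pk
... | m , Pm , min = suc m , Pm , λ
  { zero    P0 → ⊥-elim (¬P0 P0)
  ; (suc j) Pj → ℕ.s≤s (min j Pj) }

record ConnectedGraph (n : ℕ) : Set₁ where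
  field
    graph     : Graph n
  open Graph graph public
  field
    nonEmpty  : ℕ.NonZero n
    connected : ∀ x y → ∃[ k ] Walk k x y

  dist : Fin n → Fin n → ℕ
  dist x y = proj₁ (least (λ k → walk? k x y) (proj₁ (connected x y)) (proj₂ (connected x y)))

record Tree (n : ℕ) : Set₁ where
  field
    connectedGraph : ConnectedGraph n
  open ConnectedGraph connectedGraph public
  field
    acyclic : ¬ Cycle

  branchVertices : List (Fin n)
  branchVertices = filter (λ v → 3 ℕ.≤? degree v) (allFin n)

------------------------------------------------------------------------
-- Weighted Lin–Lu–Yau curvature and distortion

module _ {n : ℕ} (G : ConnectedGraph n) where
  open ConnectedGraph G

  -- An edge weight is a function on ordered pairs of vertices; its values
  -- at non-adjacent pairs are arbitrary and never used.
  record Weight : Set where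
    field
      w     : Fin n → Fin n → ℝ
      w-sym : ∀ {x y} → x ∼ y → w x y ≈ w y x
      w-pos : ∀ {x y} → x ∼ y → 0ℝ < w x y

  record IsCoupling (μ ν : Fin n → ℝ) (π : Fin n → Fin n → ℝ) : Set where
    field
      nonNeg    : ∀ x y → 0ℝ ≤ π x y
      marginalˡ : ∀ x → ∑ (λ y → π x y) ≈ μ x
      marginalʳ : ∀ y → ∑ (λ x → π x y) ≈ ν y

  cost : (Fin n → Fin n → ℝ) → ℝ
  cost π = ∑ λ x → ∑ λ y → π x y * fromℕ (dist x y)

  IsW₁ : (μ ν : Fin n → ℝ) → ℝ → Set
  IsW₁ μ ν = IsInfimum _≤_ (λ c → ∃[ π ] IsCoupling μ ν π × c ≈ cost π)

  module _ (W : Weight) where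
    open Weight W

    incident : Fin n → Fin n → ℝ
    incident x y with x ∼? y
    ... | yes _ = w x y
    ... | no  _ = 0ℝ

    weightedDegree : Fin n → ℝ
    weightedDegree x = ∑ (incident x)

    private
      incident-nonNeg : ∀ x y → EventuallyNonNeg (incident x y)
      incident-nonNeg x y with x ∼? y
      ... | yes x∼y = 0<⇒nonNeg (w x y) (w-pos x∼y)
      ... | no  _   = 0 , λ _ _ → ℚ.≤-refl

      incident-pos : ∀ x y → x ∼ y → 0ℝ < incident x y
      incident-pos x y x∼y with x ∼? y
      ... | yes _   = w-pos x∼y
      ... | no  x≁y = ⊥-elim (x≁y x∼y)

    weightedDegree-pos : ∀ {x y} → x ∼ y → 0ℝ < weightedDegree x
    weightedDegree-pos {x} {y} x∼y =
      ∑-pos (incident x) (incident-nonNeg x) y (incident-pos x y x∼y)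

    measure : ℝ → Fin n → Fin n → ℝ
    measure α x z with x ≟ᶠ z | x ∼? z
    ... | yes _ | _       = α
    ... | no  _ | yes x∼z = (((1ℝ - α) * w x z) ÷ weightedDegree x) (weightedDegree-pos x∼z)
    ... | no  _ | no  _   = 0ℝ

    IsCurvature : ℝ → Fin n → Fin n → ℝ → Set
    IsCurvature α x y κ = ∃[ v ] IsW₁ (measure α x) (measure α y) v × κ ≈ 1ℝ - v

    -- The limit of κ_α / (1 - α) as α → 1⁻, where α ranges over [0, 1).
    IsLLYCurvature : Fin n → Fin n → ℝ → Set
    IsLLYCurvature x y L =
      ∀ ε → 0ℝ < ε → ∃[ δ ] 0ℝ < δ ×
      (∀ α → 0ℝ ≤ α → (α<1 : α < 1ℝ) → 1ℝ - δ < α →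
       ∃[ κ ] IsCurvature α x y κ ×
         let q = (κ ÷ (1ℝ - α)) (x<y⇒0<y-x α 1ℝ α<1) in
         L - ε < q × q < L + ε)

    Admissible : Set
    Admissible = ∀ x y → x ∼ y → ∃[ κ ] IsLLYCurvature x y κ × 0ℝ ≤ κ

    EdgeValue : Pred ℝ 0ℓ
    EdgeValue r = ∃[ x ] ∃[ y ] x ∼ y × r ≈ w x y

    data IsDistortion : ℝ ⁺ → Set where
      finite    : ∀ {s i r} → IsSupremum _≤_ EdgeValue s → IsInfimum _≤_ EdgeValue i →
                  (i>0 : 0ℝ < i) → r ≈ (s ÷ i) i>0 → IsDistortion [ r ]
      unbounded : (∀ M → ∃[ r ] EdgeValue r × M < r) → IsDistortion ⊤⁺
      vanishing : IsInfimum _≤_ EdgeValue 0ℝ → IsDistortion ⊤⁺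

  -- In the order of ℝ ⁺ the infimum of a set with no finite element is +∞.
  data IsDN : ℝ ⁺ → Set where
    K₁      : ∀ {r} → n ≡ 1 → r ≈ 1ℝ → IsDN [ r ]
    hasEdge : ∀ {δ} → (∃[ x ] ∃[ y ] x ∼ y) →
              IsInfimum ℝ⁺._≤⁺_ (λ d → ∃[ W ] Admissible W × IsDistortion W d) δ → IsDN δ

{-# OPTIONS --safe #-}

-- Testing couplings against a 1-Lipschitz function that is locally the signed distance
-- across the edge xy shows that the curvature of xy is at most 2 (w/dₓ + w/d_y - 1).  So it
-- is non-negative only if sₓ s_y ≤ w², where sₓ = dₓ - w.  Scale the weight so that w ≥ 1.
-- If sₓ ≤ w, then the same holds for all edges behind x as seen from y, and induction gives
-- 2N ≤ sₓ, where N is the number of branch vertices behind x.  Let xy be the heaviest edge,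
-- of weight M.  If sₓ, s_y ≤ M, the two halves of the tree yield 2|B| ≤ 2M.  If s_y > M, then
-- every edge at y weighs at most half of d_y, and adding up the inequalities at the (at least
-- three) edges at y yields |B| - 1 < M.  The margin is at least 1/(2n²), independently of the
-- weight, so the infimum of the distortions exceeds |B| - 1 as well.

module Submission where

open import Level using (0ℓ)
open import Algebra.Bundles using (CommutativeRing)
import Algebra.Solver.Ring as RingSolver
open import Algebra.Solver.Ring.AlmostCommutativeRing using (fromCommutativeRing; _-Raw-AlmostCommutative⟶_)
open import Data.Bool.Base using (true; false; if_then_else_)
open import Data.Empty using (⊥-elim)
open import Data.Fin.Base using (Fin; zero; suc)
open import Data.Fin.Properties using () renaming (_≟_ to _≟ᶠ_)
open import Data.Integer.Base as ℤ using (ℤ; +_)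
import Data.Integer.Properties as ℤ
open import Data.List.Base using ([]; _∷_; _∷ʳ_; _++_; List; allFin; cartesianProduct; filter; length; tabulate)
open import Data.List.Membership.Propositional using (_∈_)
open import Data.List.Membership.Propositional.Properties using (∈-allFin; ∈-cartesianProduct⁺)
open import Data.List.Properties using (++-assoc; length-++; length-filter; length-tabulate)
open import Data.List.Relation.Unary.All as All using (All; []; _∷_)
import Data.List.Relation.Unary.All.Properties as All
open import Data.List.Relation.Unary.AllPairs using ([]; _∷_)
import Data.List.Relation.Unary.AllPairs.Properties as AllPairs
open import Data.List.Relation.Unary.Any using (here; there)
open import Data.List.Relation.Unary.Linked using (Linked; [-]; _∷_)
open import Data.List.Relation.Unary.Unique.Propositional using (Unique)
open import Data.Maybe.Base as Maybe using (Maybe)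
open import Data.Nat.Base as ℕ using (ℕ; zero; suc; z≤n; s≤s)
import Data.Nat.Coprimality as Coprimality
import Data.Nat.Properties as ℕ
open import Data.Nat.Solver using () renaming (module +-*-Solver to ℕ-Solver)
open import Data.Product.Base using (∃-syntax; _×_; _,_; proj₁; proj₂; uncurry)
open import Data.Rational.Base as ℚ using (ℚ; 0ℚ; 1ℚ; ½)
import Data.Rational.Properties as ℚ
open import Data.Sum.Base using (_⊎_; inj₁; inj₂; [_,_]′)
open import Data.Vec.Functional using (Vector)
open import Defs using (Graph; ConnectedGraph; Tree; least)
open import Function.Base using (_∘_; case_of_; id)
open import Relation.Binary.PropositionalEquality as ≡ using (_≡_; _≢_; subst)
open import Relation.Nullary using (¬_; Dec; yes; no; does)
open import Relation.Nullary.Construct.Add.Supremum using (_⁺; [_])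
open import Relation.Nullary.Decidable using (_×-dec_; ¬?; dec⇒maybe)
open import Relation.Unary using (Pred; Decidable)

open import Algebra.Properties.Semiring.Sum ℕ.+-*-semiring using ()
  renaming (sum to ∑ℕ; sum-cong-≗ to ∑ℕ-cong; ∑-distrib-+ to ∑ℕ-distrib-+; ∑-comm to ∑ℕ-comm; *-distribˡ-sum to *-distribˡ-∑ℕ)

-- Ordered rings

-- The ceiling is taken of an infimum, so an excess over |B| - 1 for each single weight would not
-- do: it has to be uniform. The inequalities at a root y give the excess 1/(2 d_y), which a heavy
-- root could make arbitrarily small. But if M ≥ |B|, there is nothing left to show; otherwise M <
-- |B| ≤ n, and d_y is at most M times the degree of y, hence at most n².
--
-- Acyclicity enters through the test function, which is 1-Lipschitz because xy is the only edge
-- between the vertices nearer to x and those nearer to y. The branch vertices are counted along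
-- walks that do not backtrack. Such walks reach every vertex of a connected graph, so the count
-- needs no explicit subtrees.
--
-- The easy half of Kantorovich duality bounds κ_α/(1 - α) by a number that does not depend on α.
-- One α close to 1 therefore settles the limit.

-- ℝ is not computably ordered, but its order is stable under double negation,
-- and that suffices for proving inequalities by classical case distinctions.
record StablyOrderedRing : Set₁ where
  field
    commutativeRing : CommutativeRing 0ℓ 0ℓ
  open CommutativeRing commutativeRing public hiding (zero)
  infix 4 _≼_
  field
    _≼_       : Carrier → Carrier → Set
    ≼-stable  : ∀ {x y} → ¬ ¬ x ≼ y → x ≼ y
    ≼-total   : ∀ x y → ¬ x ≼ y → y ≼ x
    0≼-resp-≈ : ∀ {x y} → x ≈ y → 0# ≼ x → 0# ≼ y
    x≼y⇒0≼y-x : ∀ {x y} → x ≼ y → 0# ≼ y - x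
    0≼y-x⇒x≼y : ∀ {x y} → 0# ≼ y - x → x ≼ y
    0≼-+      : ∀ {x y} → 0# ≼ x → 0# ≼ y → 0# ≼ x + y
    0≼-*      : ∀ {x y} → 0# ≼ x → 0# ≼ y → 0# ≼ x * y
    -- The signature has no strict order, so cancellation is by factors that are at least 1. Once
    -- the weights are scaled to be at least 1, every divisor that occurs is of this kind.
    0≼-cancel : ∀ {x p} → 1# ≼ p → 0# ≼ x * p → 0# ≼ x
    0≼1       : 0# ≼ 1#
    integer   : ℤ → Carrier
    integer-+ : ∀ i j → integer (i ℤ.+ j) ≈ integer i + integer j
    integer-* : ∀ i j → integer (i ℤ.* j) ≈ integer i * integer j
    integer-neg : ∀ i → integer (ℤ.- i) ≈ - integer i
    integer-0 : integer (+ 0) ≈ 0#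
    integer-1 : integer (+ 1) ≈ 1#

module OrderedRingProperties (F : StablyOrderedRing) where
  open StablyOrderedRing F
  open import Algebra.Properties.Semiring.Sum semiring public
    using (sum; sum-cong-≋; ∑-distrib-+; ∑-comm; *-distribˡ-sum; *-distribʳ-sum; sum-replicate-zero)

  integer-morphism : CommutativeRing.rawRing ℤ.+-*-commutativeRing -Raw-AlmostCommutative⟶ fromCommutativeRing commutativeRing
  integer-morphism = record
    { ⟦_⟧    = integer
    ; +-homo = integer-+
    ; *-homo = integer-*
    ; -‿homo = integer-neg
    ; 0-homo = integer-0
    ; 1-homo = integer-1
    }

  integer-≟ : ∀ i j → Maybe (integer i ≈ integer j)
  integer-≟ i j = Maybe.map (reflexive ∘ ≡.cong integer) (dec⇒maybe (i ℤ.≟ j))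

  module Solver = RingSolver (CommutativeRing.rawRing ℤ.+-*-commutativeRing)
    (fromCommutativeRing commutativeRing) integer-morphism integer-≟

  natural : ℕ → Carrier
  natural n = integer (+ n)

  -- The pattern of the polynomial inequalities below: `z` is a visibly non-negative combination of
  -- hypotheses, and the ring solver identifies it with `y - x`.
  x≼y⇐y-x≈z : ∀ {x y} z → 0# ≼ z → z ≈ y - x → x ≼ y
  x≼y⇐y-x≈z z 0≼z z≈y-x = 0≼y-x⇒x≼y (0≼-resp-≈ z≈y-x 0≼z)

  Δ : ∀ {x y} → x ≼ y → 0# ≼ y - x
  Δ = x≼y⇒0≼y-x

  ≼-refl : ∀ {x} → x ≼ x
  ≼-refl {x} = ≼-stable λ x⋠x → x⋠x (≼-total x x x⋠x)

  ≼-reflexive : ∀ {x y} → x ≈ y → x ≼ y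
  ≼-reflexive {x} {y} x≈y = x≼y⇐y-x≈z 0# ≼-refl
    (trans (sym (-‿inverseʳ x)) (+-congʳ x≈y))

  ≼-trans : ∀ {x y z} → x ≼ y → y ≼ z → x ≼ z
  ≼-trans {x} {y} {z} x≼y y≼z = x≼y⇐y-x≈z _ (0≼-+ (Δ x≼y) (Δ y≼z))
    (solve 3 (λ x y z → (y :- x) :+ (z :- y) := z :- x) refl x y z)
    where open Solver

  ≼-respˡ : ∀ {x y z} → x ≈ y → x ≼ z → y ≼ z
  ≼-respˡ x≈y = ≼-trans (≼-reflexive (sym x≈y))

  ≼-respʳ : ∀ {x y z} → x ≈ y → z ≼ x → z ≼ y
  ≼-respʳ x≈y z≼x = ≼-trans z≼x (≼-reflexive x≈y)

  +-mono-≼ : ∀ {x y z w} → x ≼ y → z ≼ w → x + z ≼ y + w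
  +-mono-≼ {x} {y} {z} {w} x≼y z≼w = x≼y⇐y-x≈z _ (0≼-+ (Δ x≼y) (Δ z≼w))
    (solve 4 (λ x y z w → (y :- x) :+ (w :- z) := (y :+ w) :- (x :+ z)) refl x y z w)
    where open Solver

  natural-+ : ∀ m n → natural (m ℕ.+ n) ≈ natural m + natural n
  natural-+ m n = integer-+ (+ m) (+ n)

  natural-* : ∀ m n → natural (m ℕ.* n) ≈ natural m * natural n
  natural-* m n = trans (reflexive (≡.cong integer (ℤ.pos-* m n))) (integer-* (+ m) (+ n))

  0≼natural : ∀ n → 0# ≼ natural n
  0≼natural zero    = ≼-reflexive (sym integer-0)
  0≼natural (suc n) = 0≼-resp-≈ (trans (+-congʳ (sym integer-1)) (sym (natural-+ 1 n))) (0≼-+ 0≼1 (0≼natural n))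

  natural-mono : ∀ {m n} → m ℕ.≤ n → natural m ≼ natural n
  natural-mono {m} {n} m≤n = x≼y⇐y-x≈z (natural (n ℕ.∸ m)) (0≼natural (n ℕ.∸ m))
    (begin
      natural (n ℕ.∸ m)
        ≈⟨ solve 2 (λ m d → d := (m :+ d) :- m) refl (natural m) (natural (n ℕ.∸ m)) ⟩
      (natural m + natural (n ℕ.∸ m)) - natural m
        ≈⟨ +-congʳ (natural-+ m (n ℕ.∸ m)) ⟨
      natural (m ℕ.+ (n ℕ.∸ m)) - natural m
        ≡⟨ ≡.cong (λ k → natural k - natural m) (ℕ.m+[n∸m]≡n m≤n) ⟩
      natural n - natural m ∎)
    where
    open Solver
    open import Relation.Binary.Reasoning.Setoid setoid

  *-cancelʳ-≼ : ∀ {x y p} → natural 1 ≼ p → x * p ≼ y * p → x ≼ y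
  *-cancelʳ-≼ {x} {y} {p} 1≼p xp≼yp = 0≼y-x⇒x≼y (0≼-cancel (≼-respˡ integer-1 1≼p)
    (0≼-resp-≈ (solve 3 (λ x y p → y :* p :- x :* p := (y :- x) :* p) refl x y p) (Δ xp≼yp)))
    where open Solver

  sum-mono : ∀ {n} {f g : Vector Carrier n} → (∀ i → f i ≼ g i) → sum f ≼ sum g
  sum-mono {zero}  f≼g = ≼-refl
  sum-mono {suc n} f≼g = +-mono-≼ (f≼g zero) (sum-mono (f≼g ∘ suc))

  -- All terms of `sum g - sum f` are non-negative. This takes a single edge out of a sum over all
  -- vertices without splitting the index set.
  sum-gap : ∀ {n} {f g : Vector Carrier n} → (∀ i → f i ≼ g i) →
    ∀ i → g i - f i ≼ sum g - sum f
  sum-gap {suc n} {f} {g} f≼g zero = x≼y⇐y-x≈z _ (Δ (sum-mono (f≼g ∘ suc)))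
    (solve 4 (λ f₀ g₀ f g → g :- f := (g₀ :+ g :- (f₀ :+ f)) :- (g₀ :- f₀)) refl
      (f zero) (g zero) (sum (f ∘ suc)) (sum (g ∘ suc)))
    where open Solver
  sum-gap {suc n} {f} {g} f≼g (suc i) =
    x≼y⇐y-x≈z _ (0≼-+ (Δ (f≼g zero)) (Δ (sum-gap (f≼g ∘ suc) i)))
    (solve 5 (λ f₀ g₀ f g d → (g₀ :- f₀) :+ (g :- f :- d) := (g₀ :+ g :- (f₀ :+ f)) :- d) refl
      (f zero) (g zero) (sum (f ∘ suc)) (sum (g ∘ suc)) (g (suc i) - f (suc i)))
    where open Solver

  sum-gap₂ : ∀ {n} {f g : Vector Carrier n} → (∀ i → f i ≼ g i) →
    ∀ {i j} → ¬ i ≡ j → (g i - f i) + (g j - f j) ≼ sum g - sum f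
  sum-gap₂ {suc n} f≼g {zero}  {zero}  i≢j = ⊥-elim (i≢j ≡.refl)
  sum-gap₂ {suc n} {f} {g} f≼g {zero}  {suc j} i≢j =
    x≼y⇐y-x≈z _ (Δ (sum-gap (f≼g ∘ suc) j))
    (solve 5 (λ f₀ g₀ f g d → (g :- f :- d) := (g₀ :+ g :- (f₀ :+ f)) :- (g₀ :- f₀ :+ d)) refl
      (f zero) (g zero) (sum (f ∘ suc)) (sum (g ∘ suc)) (g (suc j) - f (suc j)))
    where open Solver
  sum-gap₂ {suc n} f≼g {suc i} {zero}  i≢j = ≼-respˡ (+-comm _ _) (sum-gap₂ f≼g (i≢j ∘ ≡.sym))
  sum-gap₂ {suc n} {f} {g} f≼g {suc i} {suc j} i≢j =
    x≼y⇐y-x≈z _ (0≼-+ (Δ (f≼g zero)) (Δ (sum-gap₂ (f≼g ∘ suc) (i≢j ∘ ≡.cong suc))))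
    (solve 5 (λ f₀ g₀ f g d → (g₀ :- f₀) :+ (g :- f :- d) := (g₀ :+ g :- (f₀ :+ f)) :- d) refl
      (f zero) (g zero) (sum (f ∘ suc)) (sum (g ∘ suc)) ((g (suc i) - f (suc i)) + (g (suc j) - f (suc j))))
    where open Solver

  sum-linear : ∀ {n} p q (f g : Vector Carrier n) →
    sum (λ i → p * f i + q * g i) ≈ p * sum f + q * sum g
  sum-linear p q f g = trans (∑-distrib-+ (λ i → p * f i) (λ i → q * g i))
    (+-cong (sym (*-distribˡ-sum p f)) (sym (*-distribˡ-sum q g)))

  sum-natural : ∀ {n} (f : Vector ℕ n) → sum (natural ∘ f) ≈ natural (∑ℕ f)
  sum-natural {zero}  f = sym integer-0
  sum-natural {suc n} f = trans (+-congˡ (sum-natural (f ∘ suc))) (sym (natural-+ (f zero) (∑ℕ (f ∘ suc))))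

  x≼x+y : ∀ {x y} → 0# ≼ y → x ≼ x + y
  x≼x+y {x} {y} 0≼y = x≼y⇐y-x≈z y 0≼y (solve 2 (λ x y → y := (x :+ y) :- x) refl x y)
    where open Solver

  0≼sum : ∀ {n} (f : Vector Carrier n) → (∀ i → 0# ≼ f i) → 0# ≼ sum f
  0≼sum {zero}  f 0≼f = ≼-refl
  0≼sum {suc n} f 0≼f = 0≼-+ (0≼f zero) (0≼sum (f ∘ suc) (0≼f ∘ suc))

  term≼sum : ∀ {n} (f : Vector Carrier n) → (∀ i → 0# ≼ f i) → ∀ i → f i ≼ sum f
  term≼sum f 0≼f zero    = x≼x+y (0≼sum (f ∘ suc) (0≼f ∘ suc))
  term≼sum f 0≼f (suc i) = ≼-respʳ (+-comm _ _)
    (≼-trans (term≼sum (f ∘ suc) (0≼f ∘ suc) i) (x≼x+y (0≼f zero)))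

  -- Comparisons are undecidable, so a maximiser is found only under a double negation; the
  -- inequality it serves is stable.
  ¬¬-maximum : ∀ {A : Set} (f : A → Carrier) a as →
    ¬ ¬ (∃[ m ] m ∈ (a ∷ as) × (∀ {b} → b ∈ (a ∷ as) → f b ≼ f m))
  ¬¬-maximum f a []       k = k (a , here ≡.refl , λ { (here ≡.refl) → ≼-refl })
  ¬¬-maximum f a (b ∷ as) k = ¬¬-maximum f b as λ (m , m∈ , max) →
    k (m , there m∈ , λ
      { (here ≡.refl) → ≼-stable λ fa⋠fm → k (a , here ≡.refl , λ
          { (here ≡.refl) → ≼-refl
          ; (there c∈)    → ≼-trans (max c∈) (≼-total _ _ fa⋠fm) })
      ; (there c∈)    → max c∈ })

  integer-mono : ∀ {i j} → i ℤ.≤ j → integer i ≼ integer j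
  integer-mono {i} {j} i≤j = x≼y⇐y-x≈z _ (0≼natural ℤ.∣ j ℤ.- i ∣)
    (trans (reflexive (≡.cong integer (ℤ.0≤i⇒+∣i∣≡i (ℤ.i≤j⇒0≤j-i i≤j))))
      (trans (integer-+ j (ℤ.- i)) (+-congˡ (integer-neg i))))

  *-monoʳ-≼ : ∀ {x y z} → 0# ≼ z → x ≼ y → x * z ≼ y * z
  *-monoʳ-≼ {x} {y} {z} 0≼z x≼y = x≼y⇐y-x≈z _ (0≼-* (Δ x≼y) 0≼z)
    (solve 3 (λ x y z → (y :- x) :* z := y :* z :- x :* z) refl x y z)
    where open Solver

-- Counting branch vertices

indicator : ∀ {p} {P : Set p} → Dec P → ℕ
indicator P? = if does P? then 1 else 0

indicator-yes : ∀ {p} {P : Set p} (P? : Dec P) → P → indicator P? ≡ 1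
indicator-yes (yes _) p = ≡.refl
indicator-yes (no ¬p) p = ⊥-elim (¬p p)

indicator-no : ∀ {p} {P : Set p} (P? : Dec P) → ¬ P → indicator P? ≡ 0
indicator-no (yes p) ¬p = ⊥-elim (¬p p)
indicator-no (no _)  ¬p = ≡.refl

indicator≤1 : ∀ {p} {P : Set p} (P? : Dec P) → indicator P? ℕ.≤ 1
indicator≤1 (yes _) = ℕ.≤-refl
indicator≤1 (no _)  = z≤n

indicator-*-mono : ∀ {p} {P : Set p} (P? : Dec P) {a b} → (P → a ℕ.≤ b) → indicator P? ℕ.* a ℕ.≤ indicator P? ℕ.* b
indicator-*-mono (yes p) a≤b = ℕ.*-monoʳ-≤ 1 (a≤b p)
indicator-*-mono (no _)  a≤b = z≤n

length-filter-tabulate : ∀ {p n} {A : Set} {P : Pred A p} (P? : Decidable P) (f : Fin n → A) →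
  length (filter P? (tabulate f)) ≡ ∑ℕ (λ i → indicator (P? (f i)))
length-filter-tabulate {n = zero}  P? f = ≡.refl
length-filter-tabulate {n = suc n} P? f with does (P? (f zero))
... | true  = ≡.cong suc (length-filter-tabulate P? (f ∘ suc))
... | false = length-filter-tabulate P? (f ∘ suc)

∑ℕ-mono : ∀ {n} {f g : Vector ℕ n} → (∀ i → f i ℕ.≤ g i) → ∑ℕ f ℕ.≤ ∑ℕ g
∑ℕ-mono {zero}  f≤g = z≤n
∑ℕ-mono {suc n} f≤g = ℕ.+-mono-≤ (f≤g zero) (∑ℕ-mono (f≤g ∘ suc))

term≤∑ℕ : ∀ {n} (f : Vector ℕ n) i → f i ℕ.≤ ∑ℕ f
term≤∑ℕ f zero    = ℕ.m≤m+n (f zero) (∑ℕ (f ∘ suc))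
term≤∑ℕ f (suc i) = ℕ.≤-trans (term≤∑ℕ (f ∘ suc) i) (ℕ.m≤n+m (∑ℕ (f ∘ suc)) (f zero))

∑ℕ-zero : ∀ n → ∑ℕ {n} (λ _ → 0) ≡ 0
∑ℕ-zero zero    = ≡.refl
∑ℕ-zero (suc n) = ∑ℕ-zero n

∑ℕ-point : ∀ {n} (f : Vector ℕ n) i → ∑ℕ (λ j → f j ℕ.* indicator (i ≟ᶠ j)) ≡ f i
∑ℕ-point {suc n} f zero = ≡.trans (≡.cong₂ ℕ._+_ (ℕ.*-identityʳ (f zero))
  (≡.trans (∑ℕ-cong (λ j → ℕ.*-zeroʳ (f (suc j)))) (∑ℕ-zero n))) (ℕ.+-identityʳ (f zero))
∑ℕ-point {suc n} f (suc i) = ≡.trans (≡.cong (ℕ._+ ∑ℕ (λ j → f (suc j) ℕ.* indicator (suc i ≟ᶠ suc j))) (ℕ.*-zeroʳ (f zero)))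
  (∑ℕ-point (f ∘ suc) i)

module Branches {n} (G : Graph n) where
  open Graph G

  branch? : Fin n → ℕ
  branch? v = indicator (3 ℕ.≤? degree v)

  degree-sum : ∀ x → degree x ≡ ∑ℕ (λ z → indicator (x ∼? z))
  degree-sum x = length-filter-tabulate (x ∼?_) id

  child : Fin n → Fin n → Fin n → ℕ
  child x y z = indicator ((x ∼? z) ×-dec ¬? (z ≟ᶠ y))

  -- In a tree, this is the number of branch vertices that lie at distance less
  -- than k from x and are separated from y by x.
  behind : ℕ → Fin n → Fin n → ℕ
  behind zero    x y = 0
  behind (suc k) x y = branch? x ℕ.+ ∑ℕ (λ z → child x y z ℕ.* behind k z x)

  -- The number of walks from `x` to `v` with fewer than `k` edges that never step back to the
  -- vertex just left, `y` counting as the vertex before `x`. Counting walks instead of sets of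
  -- vertices turns the recursion of `behind` into an identity.
  paths : ℕ → Fin n → Fin n → Fin n → ℕ
  paths zero    x y v = 0
  paths (suc k) x y v = indicator (x ≟ᶠ v) ℕ.+ ∑ℕ (λ z → child x y z ℕ.* paths k z x v)

  behind≡∑paths : ∀ k x y → behind k x y ≡ ∑ℕ (λ v → branch? v ℕ.* paths k x y v)
  behind≡∑paths zero    x y = ≡.sym (≡.trans (∑ℕ-cong (λ v → ℕ.*-zeroʳ (branch? v))) (∑ℕ-zero n))
  behind≡∑paths (suc k) x y = ≡.sym (begin
    ∑ℕ (λ v → branch? v ℕ.* (indicator (x ≟ᶠ v) ℕ.+ ∑ℕ (λ z → child x y z ℕ.* paths k z x v)))
      ≡⟨ ∑ℕ-cong (λ v → ℕ.*-distribˡ-+ (branch? v) _ _) ⟩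
    ∑ℕ (λ v → branch? v ℕ.* indicator (x ≟ᶠ v) ℕ.+ branch? v ℕ.* ∑ℕ (λ z → child x y z ℕ.* paths k z x v))
      ≡⟨ ∑ℕ-distrib-+ (λ v → branch? v ℕ.* indicator (x ≟ᶠ v)) _ ⟩
    ∑ℕ (λ v → branch? v ℕ.* indicator (x ≟ᶠ v)) ℕ.+ ∑ℕ (λ v → branch? v ℕ.* ∑ℕ (λ z → child x y z ℕ.* paths k z x v))
      ≡⟨ ≡.cong₂ ℕ._+_ (∑ℕ-point branch? x) (∑ℕ-cong (λ v → *-distribˡ-∑ℕ (branch? v) (λ z → child x y z ℕ.* paths k z x v))) ⟩
    branch? x ℕ.+ ∑ℕ (λ v → ∑ℕ (λ z → branch? v ℕ.* (child x y z ℕ.* paths k z x v)))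
      ≡⟨ ≡.cong (branch? x ℕ.+_) (∑ℕ-comm (λ v z → branch? v ℕ.* (child x y z ℕ.* paths k z x v))) ⟩
    branch? x ℕ.+ ∑ℕ (λ z → ∑ℕ (λ v → branch? v ℕ.* (child x y z ℕ.* paths k z x v)))
      ≡⟨ ≡.cong (branch? x ℕ.+_) (∑ℕ-cong (λ z → ∑ℕ-cong (λ v → swap (branch? v) (child x y z) (paths k z x v)))) ⟩
    branch? x ℕ.+ ∑ℕ (λ z → ∑ℕ (λ v → child x y z ℕ.* (branch? v ℕ.* paths k z x v)))
      ≡⟨ ≡.cong (branch? x ℕ.+_) (∑ℕ-cong (λ z → ≡.sym (*-distribˡ-∑ℕ (child x y z) (λ v → branch? v ℕ.* paths k z x v)))) ⟩
    branch? x ℕ.+ ∑ℕ (λ z → child x y z ℕ.* ∑ℕ (λ v → branch? v ℕ.* paths k z x v))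
      ≡⟨ ≡.cong (branch? x ℕ.+_) (∑ℕ-cong (λ z → ≡.cong (child x y z ℕ.*_) (≡.sym (behind≡∑paths k z x)))) ⟩
    branch? x ℕ.+ ∑ℕ (λ z → child x y z ℕ.* behind k z x) ∎)
    where
    open ≡.≡-Reasoning
    swap : ∀ a b c → a ℕ.* (b ℕ.* c) ≡ b ℕ.* (a ℕ.* c)
    swap = solve 3 (λ a b c → a :* (b :* c) := b :* (a :* c)) ≡.refl
      where open ℕ-Solver

-- Distances and walks in a connected graph

module Distance {n} (G : ConnectedGraph n) where
  open ConnectedGraph G
  open Branches graph

  dist-walk : ∀ x y → Walk (dist x y) x y
  dist-walk x y = proj₁ (proj₂ (least (λ k → walk? k x y) (proj₁ (connected x y)) (proj₂ (connected x y))))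

  dist-minimal : ∀ {k} x y → Walk k x y → dist x y ℕ.≤ k
  dist-minimal x y = proj₂ (proj₂ (least (λ k → walk? k x y) (proj₁ (connected x y)) (proj₂ (connected x y)))) _

  dist≡0⇒≡ : ∀ {x y} → dist x y ≡ 0 → x ≡ y
  dist≡0⇒≡ {x} {y} eq = subst (λ k → Walk k x y) eq (dist-walk x y)

  dist-refl : ∀ x → dist x x ≡ 0
  dist-refl x = ℕ.n≤0⇒n≡0 (dist-minimal x x ≡.refl)

  dist-step : ∀ {x y} v → x ∼ y → dist x v ℕ.≤ suc (dist y v)
  dist-step {x} {y} v x∼y = dist-minimal x v (y , x∼y , dist-walk y v)

  closer : ∀ {x v m} → dist x v ≡ suc m → ∃[ z ] x ∼ z × dist z v ≡ m
  closer {x} {v} {m} eq with subst (λ k → Walk k x v) eq (dist-walk x v)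
  ... | z , x∼z , walk = z , x∼z , ℕ.≤-antisym (dist-minimal z v walk)
    (ℕ.≤-pred (subst (ℕ._≤ suc (dist z v)) eq (dist-step v x∼z)))

  -- A shortest walk from `x` to `v` does not backtrack. The comparison with `y` excludes `y` as its
  -- next vertex, and it passes on to that vertex, which is closer to `v` than `x` is.
  paths-positive : ∀ k x y v → dist x v ℕ.< k → dist x v ℕ.≤ dist y v → 1 ℕ.≤ paths k x y v
  paths-positive (suc k) x y v (s≤s dx≤k) dx≤dy = go (dist x v) ≡.refl
    where
    descend = λ z → child x y z ℕ.* paths k z x v
    go : ∀ m → dist x v ≡ m → 1 ℕ.≤ indicator (x ≟ᶠ v) ℕ.+ ∑ℕ descend
    go zero    eq = subst (λ i → 1 ℕ.≤ i ℕ.+ ∑ℕ descend) (≡.sym (indicator-yes (x ≟ᶠ v) (dist≡0⇒≡ eq))) (s≤s z≤n)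
    go (suc m) eq with closer eq
    ... | z , x∼z , dz≡m = ℕ.≤-trans
      (ℕ.≤-trans (paths-positive k z x v (ℕ.<-≤-trans dz<dx dx≤k) (ℕ.<⇒≤ dz<dx))
        (ℕ.≤-reflexive (≡.sym (≡.trans (≡.cong (ℕ._* paths k z x v) (indicator-yes ((x ∼? z) ×-dec ¬? (z ≟ᶠ y)) (x∼z , z≢y)))
          (ℕ.*-identityˡ _)))))
      (ℕ.≤-trans (term≤∑ℕ descend z) (ℕ.m≤n+m (∑ℕ descend) _))
      where
      dz<dx : dist z v ℕ.< dist x v
      dz<dx = ℕ.≤-reflexive (≡.trans (≡.cong suc dz≡m) (≡.sym eq))
      z≢y : ¬ z ≡ y
      z≢y ≡.refl = ℕ.<⇒≱ dz<dx dx≤dy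

  radius : ℕ
  radius = suc (∑ℕ (λ x → ∑ℕ (λ v → dist x v)))

  dist<radius : ∀ x v → dist x v ℕ.< radius
  dist<radius x v = s≤s (ℕ.≤-trans (term≤∑ℕ (dist x) v) (term≤∑ℕ (λ x → ∑ℕ (dist x)) x))

  branchCount : ℕ
  branchCount = ∑ℕ branch?

  -- A vertex is not its own neighbour, so with `y` as its own predecessor `behind` excludes no edge
  -- at `y`. The extra unit of fuel leaves `radius` for the subtrees.
  branchCount≤rooted : ∀ y → branchCount ℕ.≤ behind (suc radius) y y
  branchCount≤rooted y = subst (branchCount ℕ.≤_) (≡.sym (behind≡∑paths (suc radius) y y))
    (∑ℕ-mono (λ v → subst (ℕ._≤ branch? v ℕ.* paths (suc radius) y y v) (ℕ.*-identityʳ (branch? v))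
      (ℕ.*-monoʳ-≤ (branch? v) (paths-positive (suc radius) y y v (ℕ.m<n⇒m<1+n (dist<radius y v)) ℕ.≤-refl))))

  -- A shortest walk to `v` from whichever of `x` and `y` is nearer does not step to the other one,
  -- so each branch vertex is counted on at least one side.
  branchCount≤edge : ∀ x y → branchCount ℕ.≤ behind radius x y ℕ.+ behind radius y x
  branchCount≤edge x y = subst (branchCount ℕ.≤_)
    (≡.trans (∑ℕ-distrib-+ (λ v → branch? v ℕ.* paths radius x y v) _)
      (≡.sym (≡.cong₂ ℕ._+_ (behind≡∑paths radius x y) (behind≡∑paths radius y x))))
    (∑ℕ-mono bound)
    where
    bound : ∀ v → branch? v ℕ.≤ branch? v ℕ.* paths radius x y v ℕ.+ branch? v ℕ.* paths radius y x v
    bound v with ℕ.≤-total (dist x v) (dist y v)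
    ... | inj₁ dx≤dy = ℕ.≤-trans (subst (ℕ._≤ branch? v ℕ.* paths radius x y v) (ℕ.*-identityʳ (branch? v))
      (ℕ.*-monoʳ-≤ (branch? v) (paths-positive radius x y v (dist<radius x v) dx≤dy))) (ℕ.m≤m+n _ _)
    ... | inj₂ dy≤dx = ℕ.≤-trans (subst (ℕ._≤ branch? v ℕ.* paths radius y x v) (ℕ.*-identityʳ (branch? v))
      (ℕ.*-monoʳ-≤ (branch? v) (paths-positive radius y x v (dist<radius y v) dy≤dx))) (ℕ.m≤n+m _ _)

-- Non-negatively curved weights

module EdgeInequalities (F : StablyOrderedRing) where
  open StablyOrderedRing F
  open OrderedRingProperties F

  private
    0≼2 : 0# ≼ natural 2
    0≼2 = 0≼natural 2

  1≼⇒0≼ : ∀ {x} → natural 1 ≼ x → 0# ≼ x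
  1≼⇒0≼ = ≼-trans (0≼natural 1)

  -- In below-edge and below-branch-edge, b is the weight of an edge xz, s is d z - b and
  -- c is the total weight at x outside xz and the edge towards the root; the latter edge
  -- weighs at least b + c, so that d x - b is at least b + 2c.
  below-edge : ∀ {b c s} → natural 1 ≼ b → 0# ≼ c → 0# ≼ s →
    s * (b + natural 2 * c) ≼ b * b → s ≼ b
  below-edge {b} {c} {s} 1≼b 0≼c 0≼s h = *-cancelʳ-≼ 1≼b (x≼y⇐y-x≈z _
    (0≼-+ (Δ h) (0≼-* 0≼2 (0≼-* 0≼s 0≼c)))
    (solve 3 (λ b c s → (b :* b :- s :* (b :+ con (+ 2) :* c)) :+ con (+ 2) :* (s :* c) := b :* b :- s :* b)
      refl b c s))
    where open Solver

  below-branch-edge : ∀ {b c s t} → natural 2 ≼ b → natural 1 ≼ c → t ≼ s →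
    s * (b + natural 2 * c) ≼ b * b → t + natural 1 ≼ b
  below-branch-edge {b} {c} {s} {t} 2≼b 1≼c t≼s h = *-cancelʳ-≼ 1≼b+2c (x≼y⇐y-x≈z _
    -- As s(b + 2c) ≤ b², it suffices that b² ≤ (b - 1)(b + 2c), that is, 0 ≤ b(c - 1) + c(b - 2).
    (0≼-+ (Δ h) (0≼-+ (0≼-* (Δ t≼s) (1≼⇒0≼ 1≼b+2c)) (0≼-+ (0≼-* 0≼b (Δ 1≼c)) (0≼-* (1≼⇒0≼ 1≼c) (Δ 2≼b)))))
    (solve 4 (λ b c s t → let p = b :+ con (+ 2) :* c in
       (b :* b :- s :* p) :+ ((s :- t) :* p :+ (b :* (c :- con (+ 1)) :+ c :* (b :- con (+ 2))))
         := b :* p :- (t :+ con (+ 1)) :* p)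
      refl b c s t))
    where
    open Solver
    0≼b : 0# ≼ b
    0≼b = ≼-trans 0≼2 2≼b
    1≼b+2c : natural 1 ≼ b + natural 2 * c
    1≼b+2c = x≼y⇐y-x≈z _ (0≼-+ (Δ 2≼b) (0≼-+ (0≼natural 1) (0≼-* 0≼2 (1≼⇒0≼ 1≼c))))
      (solve 2 (λ b c → (b :- con (+ 2)) :+ (con (+ 1) :+ con (+ 2) :* c) := b :+ con (+ 2) :* c :- con (+ 1)) refl b c)

  -- Here A = d y and a = u y z for a root y of the tree, and s is d z - a.
  below-root-edge : ∀ {a A s} → natural 1 ≼ a → 0# ≼ s → natural 2 * a ≼ A →
    (A - a) * s ≼ a * a → s ≼ a
  below-root-edge {a} {A} {s} 1≼a 0≼s 2a≼A h = *-cancelʳ-≼ 1≼a (x≼y⇐y-x≈z _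
    (0≼-+ (Δ h) (0≼-* (Δ 2a≼A) 0≼s))
    (solve 3 (λ a A s → (a :* a :- (A :- a) :* s) :+ (A :- con (+ 2) :* a) :* s := a :* a :- s :* a) refl a A s))
    where open Solver

  -- From (A - a)t ≤ a² and t ≤ a follows A²t ≤ Aa² + 2a³. Then (a² - 1)(A - 2a) ≥ 0 replaces 2a³ +
  -- A by Aa² + 2a, and one factor a becomes M. The right side is linear in a, so over all edges at
  -- the root it sums to a multiple of A.
  root-edge : ∀ {a A s t M} → natural 1 ≼ a → natural 2 * a ≼ A → t ≼ s → s ≼ a → a ≼ M →
    (A - a) * s ≼ a * a →
    (A * A) * t + A * natural 1 ≼ (natural 2 * (A * M) + natural 2) * a
  root-edge {a} {A} {s} {t} {M} 1≼a 2a≼A t≼s s≼a a≼M h = x≼y⇐y-x≈z _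
    (0≼-+ (0≼-+ (0≼-* 0≼A 0≼X) (0≼-* 0≼a (0≼-+ 0≼X (0≼-* 0≼a (Δ (≼-trans t≼s s≼a))))))
      (0≼-+ (0≼-* (0≼-* 0≼2 (0≼-* 0≼A 0≼a)) (Δ a≼M)) (0≼-* (0≼-+ (0≼-* (Δ 1≼a) 0≼a) (Δ 1≼a)) (Δ 2a≼A))))
    (solve 5 (λ a A s t M → let X = (a :* a :- (A :- a) :* s) :+ (s :- t) :* (A :- a) in
        (A :* X :+ a :* (X :+ a :* (a :- t)))
        :+ ((con (+ 2) :* (A :* a)) :* (M :- a) :+ ((a :- con (+ 1)) :* a :+ (a :- con (+ 1))) :* (A :- con (+ 2) :* a))
        := (con (+ 2) :* (A :* M) :+ con (+ 2)) :* a :- ((A :* A) :* t :+ A :* con (+ 1)))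
      refl a A s t M)
    where
    open Solver
    0≼a : 0# ≼ a
    0≼a = 1≼⇒0≼ 1≼a
    a≼A : a ≼ A
    a≼A = x≼y⇐y-x≈z _ (0≼-+ (Δ 2a≼A) 0≼a)
      (solve 2 (λ a A → (A :- con (+ 2) :* a) :+ a := A :- a) refl a A)
    0≼A : 0# ≼ A
    0≼A = ≼-trans 0≼a a≼A
    0≼X : 0# ≼ (a * a - (A - a) * s) + (s - t) * (A - a)
    0≼X = 0≼-+ (Δ h) (0≼-* (Δ t≼s) (Δ a≼A))

  -- Summing root-edge over the edges at a root of degree at least 3.
  root-sum : ∀ {A K δ M} → natural 1 ≼ A → natural 3 ≼ δ →
    (A * A) * K + A * δ ≼ (natural 2 * (A * M) + natural 2) * A →
    A * K + natural 1 ≼ natural 2 * (A * M)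
  root-sum {A} {K} {δ} {M} 1≼A 3≼δ h = *-cancelʳ-≼ 1≼A (x≼y⇐y-x≈z _
    (0≼-+ (Δ h) (0≼-* (1≼⇒0≼ 1≼A) (Δ 3≼δ)))
    (solve 4 (λ A K δ M → ((con (+ 2) :* (A :* M) :+ con (+ 2)) :* A :- ((A :* A) :* K :+ A :* δ)) :+ A :* (δ :- con (+ 3))
       := (con (+ 2) :* (A :* M)) :* A :- (A :* K :+ con (+ 1)) :* A) refl A K δ M))
    where open Solver

  -- Division by 2A turns the 1 into an excess of 1/(2A); `A ≼ N` replaces it by one that is
  -- independent of the weight.
  spread : ∀ {A K M N ε} → natural 1 ≼ A → 0# ≼ ε → A ≼ N → natural 2 * N * ε ≼ natural 1 →
    A * (natural 2 * K) + natural 1 ≼ natural 2 * (A * M) → K + ε ≼ M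
  spread {A} {K} {M} {N} {ε} 1≼A 0≼ε A≼N 2Nε≼1 h = *-cancelʳ-≼ 1≼2A (x≼y⇐y-x≈z _
    (0≼-+ (Δ h) (0≼-+ (Δ 2Nε≼1) (0≼-* (0≼-* 0≼2 0≼ε) (Δ A≼N))))
    (solve 5 (λ A K M N ε → (con (+ 2) :* (A :* M) :- (A :* (con (+ 2) :* K) :+ con (+ 1)))
         :+ ((con (+ 1) :- con (+ 2) :* N :* ε) :+ (con (+ 2) :* ε) :* (N :- A))
       := M :* (con (+ 2) :* A) :- (K :+ ε) :* (con (+ 2) :* A)) refl A K M N ε))
    where
    open Solver
    1≼2A : natural 1 ≼ natural 2 * A
    1≼2A = x≼y⇐y-x≈z _ (0≼-+ (Δ 1≼A) (1≼⇒0≼ 1≼A))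
      (solve 1 (λ A → (A :- con (+ 1)) :+ A := con (+ 2) :* A :- con (+ 1)) refl A)

-- Branch vertices and the heaviest edge

module NonNegativelyCurvedWeight (F : StablyOrderedRing) where
  open StablyOrderedRing F
  open OrderedRingProperties F
  open EdgeInequalities F

  module _ {n} (G : Graph n) (u : Fin n → Fin n → Carrier)
    (u≁ : ∀ {x y} → ¬ Graph._∼_ G x y → u x y ≈ 0#)
    (1≼u : ∀ {x y} → Graph._∼_ G x y → natural 1 ≼ u x y)
    (u-sym : ∀ {x y} → Graph._∼_ G x y → u x y ≼ u y x)
    (curvature : ∀ {x y} → Graph._∼_ G x y →
      (sum (u x) - u x y) * (sum (u y) - u y x) ≼ u x y * u x y)
    where
    open Graph G
    open Branches G

    d : Fin n → Carrier
    d x = sum (u x)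

    0≼u : ∀ x y → 0# ≼ u x y
    0≼u x y with x ∼? y
    ... | yes x∼y = 1≼⇒0≼ (1≼u x∼y)
    ... | no  x≁y = ≼-reflexive (sym (u≁ x≁y))

    u≼d : ∀ x y → u x y ≼ d x
    u≼d x = term≼sum (u x) (0≼u x)

    adj : Fin n → Fin n → ℕ
    adj x v = indicator (x ∼? v)

    adj-yes : ∀ {x v} → x ∼ v → adj x v ≡ 1
    adj-yes {x} {v} = indicator-yes (x ∼? v)

    adj≼u : ∀ x v → natural (adj x v) ≼ u x v
    adj≼u x v with x ∼? v
    ... | yes x∼v = 1≼u x∼v
    ... | no  x≁v = ≼-reflexive (trans integer-0 (sym (u≁ x≁v)))

    branch?≤1 : ∀ x → branch? x ℕ.≤ 1
    branch?≤1 x = indicator≤1 (3 ℕ.≤? degree x)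

    branch?*3≤ : ∀ x → branch? x ℕ.* 3 ℕ.≤ branch? x ℕ.* degree x
    branch?*3≤ x = indicator-*-mono (3 ℕ.≤? degree x) id

    -- At a branch vertex x, every edge exceeds the load of its subtree by 1; the at least two
    -- edges leading away from the root then pay the 2 that the vertex x itself is counted for.
    edge-load : ∀ x v → natural (branch? x ℕ.* adj x v) ≼ u x v
    edge-load x v = ≼-trans (natural-mono (subst (branch? x ℕ.* adj x v ℕ.≤_) (ℕ.*-identityˡ (adj x v))
      (ℕ.*-monoˡ-≤ (adj x v) (branch?≤1 x)))) (adj≼u x v)

    branch-edge : ∀ {x v} → x ∼ v → branch? x ℕ.* adj x v ≡ branch? x
    branch-edge {x} x∼v = ≡.trans (≡.cong (branch? x ℕ.*_) (adj-yes x∼v)) (ℕ.*-identityʳ (branch? x))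

    branch-load : ∀ x → natural (branch? x) * natural 3 ≼ sum (λ v → natural (branch? x ℕ.* adj x v))
    branch-load x = ≼-trans (≼-reflexive (sym (natural-* (branch? x) 3)))
      (≼-trans (natural-mono (branch?*3≤ x)) (≼-reflexive (sym (trans (sum-natural (λ v → branch? x ℕ.* adj x v))
        (reflexive (≡.cong natural (≡.trans (≡.sym (*-distribˡ-∑ℕ (branch? x) (adj x)))
          (≡.cong (branch? x ℕ.*_) (≡.sym (degree-sum x))))))))))

    -- A branch vertex carries at least three units of load, one on each edge, and the two named
    -- edges account for two of them.
    other-edges : ∀ {x y v} → x ∼ y → x ∼ v → ¬ y ≡ v → natural (branch? x) ≼ (d x - u x y) - u x v
    other-edges {x} {y} {v} x∼y x∼v y≢v = x≼y⇐y-x≈z _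
      (0≼-+ (Δ (sum-gap₂ (edge-load x) y≢v)) (Δ (branch-load x)))
      (trans (+-congʳ (+-congˡ (-‿cong (+-cong (+-congˡ (-‿cong (load x∼y))) (+-congˡ (-‿cong (load x∼v)))))))
        (solve 5 (λ d s y v e → ((d :- s) :- ((y :- e) :+ (v :- e))) :+ (s :- e :* con (+ 3)) := ((d :- y) :- v) :- e)
          refl (d x) (sum (λ v → natural (branch? x ℕ.* adj x v))) (u x y) (u x v) (natural (branch? x))))
      where
      open Solver
      load : ∀ {v} → x ∼ v → natural (branch? x ℕ.* adj x v) ≈ natural (branch? x)
      load x∼v = reflexive (≡.cong natural (branch-edge x∼v))

    child-yes : ∀ {x y v} → x ∼ v → ¬ v ≡ y → child x y v ≡ 1
    child-yes {x} {y} {v} x∼v v≢y = indicator-yes ((x ∼? v) ×-dec ¬? (v ≟ᶠ y)) (x∼v , v≢y)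

    child-≁ : ∀ {x y v} → ¬ x ∼ v → child x y v ≡ 0
    child-≁ {x} {y} {v} x≁v = indicator-no ((x ∼? v) ×-dec ¬? (v ≟ᶠ y)) (x≁v ∘ proj₁)

    child-self : ∀ x y → child x y y ≡ 0
    child-self x y = indicator-no ((x ∼? y) ×-dec ¬? (y ≟ᶠ y)) (λ p → proj₂ p ≡.refl)

    behind≼ : ∀ k {x y} → x ∼ y → d x - u x y ≼ u x y →
      natural (2 ℕ.* behind k x y) ≼ d x - u x y
    behind≼ zero    {x} {y} x∼y _ = ≼-trans (≼-reflexive integer-0) (Δ (u≼d x y))
    -- `sum-gap` at `y` drops the edge towards the root, which carries only the unit `e`. The loads
    -- on the other edges then total at least twice the count.
    behind≼ (suc k) {x} {y} x∼y S≼u = x≼y⇐y-x≈z _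
      (0≼-+ (Δ (sum-gap child-load y)) (Δ total-load))
      (trans (+-congʳ (+-congˡ (-‿cong (+-congˡ (-‿cong (reflexive (≡.cong natural load-y)))))))
        (solve 5 (λ d s y e b → ((d :- s) :- (y :- e)) :+ (s :- (b :+ e)) := (d :- y) :- b)
          refl (d x) (sum (natural ∘ load)) (u x y) (natural e) (natural (2 ℕ.* behind (suc k) x y))))
      where
      open Solver
      e : ℕ
      e = branch? x
      subtree load : Fin n → ℕ
      subtree v = child x y v ℕ.* behind k v x
      load v = 2 ℕ.* subtree v ℕ.+ e ℕ.* adj x v

      load-y : load y ≡ e
      load-y = ≡.trans (≡.cong (λ c → 2 ℕ.* (c ℕ.* behind k y x) ℕ.+ e ℕ.* adj x y) (child-self x y)) (branch-edge x∼y)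

      total-load : natural (2 ℕ.* behind (suc k) x y) + natural e ≼ sum (natural ∘ load)
      total-load = ≼-respˡ (natural-+ (2 ℕ.* behind (suc k) x y) e)
        (≼-respʳ (sym (sum-natural load)) (natural-mono (begin
          2 ℕ.* (e ℕ.+ ∑ℕ subtree) ℕ.+ e
            ≡⟨ ℕs.solve 2 (λ e s → ℕs.con 2 ℕs.:* (e ℕs.:+ s) ℕs.:+ e ℕs.:= ℕs.con 2 ℕs.:* s ℕs.:+ e ℕs.:* ℕs.con 3) ≡.refl e (∑ℕ subtree) ⟩
          2 ℕ.* ∑ℕ subtree ℕ.+ e ℕ.* 3
            ≤⟨ ℕ.+-monoʳ-≤ (2 ℕ.* ∑ℕ subtree) (branch?*3≤ x) ⟩
          2 ℕ.* ∑ℕ subtree ℕ.+ e ℕ.* degree x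
            ≡⟨ ≡.cong₂ ℕ._+_ (*-distribˡ-∑ℕ 2 subtree) (≡.trans (≡.cong (e ℕ.*_) (degree-sum x)) (*-distribˡ-∑ℕ e (adj x))) ⟩
          ∑ℕ (λ v → 2 ℕ.* subtree v) ℕ.+ ∑ℕ (λ v → e ℕ.* adj x v)
            ≡⟨ ∑ℕ-distrib-+ (λ v → 2 ℕ.* subtree v) (λ v → e ℕ.* adj x v) ⟨
          ∑ℕ load ∎)))
        where
        open ℕ.≤-Reasoning
        module ℕs = ℕ-Solver

      other-child : ∀ v → x ∼ v → ¬ v ≡ y → natural (2 ℕ.* behind k v x ℕ.+ e) ≼ u x v
      other-child v x∼v v≢y = bound (behind k v x) e (branch?≤1 x) (behind≼ k (∼-sym x∼v) s≼u′) c≽e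
        where
        b c s : Carrier
        b = u x v
        c = (d x - u x y) - u x v
        s = d v - u v x
        c≽e : natural e ≼ c
        c≽e = other-edges x∼y x∼v (v≢y ∘ ≡.sym)
        0≼c : 0# ≼ c
        0≼c = ≼-trans (0≼natural e) c≽e
        0≼s : 0# ≼ s
        0≼s = Δ (u≼d v x)
        s[b+2c]≼b² : s * (b + natural 2 * c) ≼ b * b
        s[b+2c]≼b² = x≼y⇐y-x≈z _ (0≼-+ (Δ (curvature x∼v)) (0≼-* 0≼s (Δ S≼u)))
          (solve 4 (λ d y b s → (b :* b :- (d :- b) :* s) :+ s :* (y :- (d :- y))
            := b :* b :- s :* (b :+ con (+ 2) :* ((d :- y) :- b))) refl (d x) (u x y) b s)
        s≼u′ : s ≼ u v x
        s≼u′ = ≼-trans (below-edge (1≼u x∼v) 0≼c 0≼s s[b+2c]≼b²) (u-sym x∼v)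
        bound : ∀ N e → e ℕ.≤ 1 → natural (2 ℕ.* N) ≼ s → natural e ≼ c → natural (2 ℕ.* N ℕ.+ e) ≼ b
        bound N zero e≤1 2N≼s _ = ≼-respˡ (reflexive (≡.cong natural (≡.sym (ℕ.+-identityʳ (2 ℕ.* N)))))
          (≼-trans 2N≼s (below-edge (1≼u x∼v) 0≼c 0≼s s[b+2c]≼b²))
        -- Without branch vertices in the subtree, the unit is covered by the least weight 1.
        -- Otherwise b ≥ s ≥ 2N ≥ 2 supplies the first hypothesis of `below-branch-edge`.
        bound zero    (suc zero) _ _ _ = 1≼u x∼v
        bound (suc N) (suc zero) _ 2N≼s 1≼c = ≼-respˡ (sym (natural-+ (2 ℕ.* suc N) 1))
          (below-branch-edge 2≼b 1≼c 2N≼s s[b+2c]≼b²)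
          where
          2≼b : natural 2 ≼ b
          2≼b = ≼-trans (natural-mono (ℕ.*-monoʳ-≤ 2 (s≤s z≤n)))
            (≼-trans 2N≼s (below-edge (1≼u x∼v) 0≼c 0≼s s[b+2c]≼b²))
        bound N (suc (suc e)) (s≤s ()) _ _

      child-load : ∀ v → natural (load v) ≼ u x v
      child-load v = go (x ∼? v) (v ≟ᶠ y)
        where
        load-at : ∀ {c a} → child x y v ≡ c → adj x v ≡ a → natural (2 ℕ.* (c ℕ.* behind k v x) ℕ.+ e ℕ.* a) ≈ natural (load v)
        load-at ≡.refl ≡.refl = refl
        go : Dec (x ∼ v) → Dec (v ≡ y) → natural (load v) ≼ u x v
        go (no x≁v) _ = ≼-respˡ (load-at (child-≁ x≁v) (indicator-no (x ∼? v) x≁v))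
          (≼-trans (≼-reflexive (trans (reflexive (≡.cong natural (ℕ.*-zeroʳ e))) integer-0)) (0≼u x v))
        go (yes x∼v) (yes ≡.refl) = ≼-respˡ (load-at (child-self x y) ≡.refl) (edge-load x y)
        go (yes x∼v) (no v≢y) = ≼-respˡ (load-at (child-yes x∼v v≢y) (adj-yes x∼v))
          (subst (λ m → natural m ≼ u x v)
            (≡.cong₂ (λ a b → 2 ℕ.* a ℕ.+ b) (≡.sym (ℕ.*-identityˡ (behind k v x))) (≡.sym (ℕ.*-identityʳ e)))
            (other-child v x∼v v≢y))

    degree≤n : ∀ x → degree x ℕ.≤ n
    degree≤n x = ℕ.≤-trans (length-filter (x ∼?_) (allFin n)) (ℕ.≤-reflexive (length-tabulate id))

    degree≼d : ∀ x → natural (degree x) ≼ d x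
    degree≼d x = ≼-respˡ (trans (sum-natural (adj x)) (reflexive (≡.cong natural (≡.sym (degree-sum x)))))
      (sum-mono (adj≼u x))

    d≼degree* : ∀ {M} x → (∀ y → u x y ≼ M) → d x ≼ M * natural (degree x)
    d≼degree* {M} x u≼M = ≼-respʳ
      (trans (sym (*-distribˡ-sum M (natural ∘ adj x)))
        (*-congˡ (trans (sum-natural (adj x)) (reflexive (≡.cong natural (≡.sym (degree-sum x)))))))
      (sum-mono λ v → bound v (x ∼? v))
      where
      bound : ∀ v → Dec (x ∼ v) → u x v ≼ M * natural (adj x v)
      bound v (yes x∼v) = ≼-respʳ (trans (sym (*-identityʳ M)) (*-congˡ (trans (sym integer-1) (reflexive (≡.cong natural (≡.sym (adj-yes x∼v))))))) (u≼M v)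
      bound v (no x≁v) = ≼-respʳ (trans (sym (zeroʳ M)) (*-congˡ (trans (sym integer-0) (reflexive (≡.cong natural (≡.sym (indicator-no (x ∼? v) x≁v)))))))
        (≼-reflexive (u≁ x≁v))

    -- Since every edge at `y` weighs at most half of `d y`, each subtree at `y` satisfies the
    -- hypothesis of `behind≼`. So `root-edge` applies with twice the count of the subtree as `t`.
    root-bound : ∀ k y {M} → (∀ z → u y z ≼ M) → (∀ {z} → y ∼ z → natural 2 * u y z ≼ d y) → 3 ℕ.≤ degree y →
      d y * natural (2 ℕ.* ∑ℕ (λ z → child y y z ℕ.* behind k z y)) + natural 1 ≼ natural 2 * (d y * M)
    root-bound k y {M} u≼M 2u≼d 3≤deg = root-sum 1≼A (natural-mono 3≤deg)
      (≼-respˡ (trans (sum-linear (A * A) A (λ z → natural (2 ℕ.* subtree z)) (natural ∘ adj y))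
          (+-cong
            (*-congˡ (trans (sum-natural (λ z → 2 ℕ.* subtree z)) (reflexive (≡.cong natural (≡.sym (*-distribˡ-∑ℕ 2 subtree))))))
            (*-congˡ (trans (sum-natural (adj y)) (reflexive (≡.cong natural (≡.sym (degree-sum y))))))))
        (≼-respʳ (sym (*-distribˡ-sum (natural 2 * (A * M) + natural 2) (u y)))
          (sum-mono (λ z → edge z (y ∼? z)))))
      where
      A : Carrier
      A = d y
      1≼A : natural 1 ≼ A
      1≼A = ≼-trans (natural-mono (ℕ.≤-trans (s≤s z≤n) 3≤deg)) (degree≼d y)
      subtree : Fin n → ℕ
      subtree z = child y y z ℕ.* behind k z y
      subtree-at : ∀ z {c a} → child y y z ≡ c → adj y z ≡ a →
        (A * A) * natural (2 ℕ.* (c ℕ.* behind k z y)) + A * natural a ≈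
        (A * A) * natural (2 ℕ.* subtree z) + A * natural (adj y z)
      subtree-at z ≡.refl ≡.refl = refl
      edge : ∀ z → Dec (y ∼ z) → (A * A) * natural (2 ℕ.* subtree z) + A * natural (adj y z) ≼ (natural 2 * (A * M) + natural 2) * u y z
      edge z (no y≁z) = ≼-reflexive (begin
        (A * A) * natural (2 ℕ.* subtree z) + A * natural (adj y z)
          ≈⟨ subtree-at z (child-≁ y≁z) (indicator-no (y ∼? z) y≁z) ⟨
        (A * A) * natural 0 + A * natural 0
          ≈⟨ +-cong (*-congˡ integer-0) (*-congˡ integer-0) ⟩
        (A * A) * 0# + A * 0#
          ≈⟨ +-cong (zeroʳ (A * A)) (zeroʳ A) ⟩
        0# + 0#
          ≈⟨ +-identityˡ 0# ⟩
        0#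
          ≈⟨ zeroʳ _ ⟨
        (natural 2 * (A * M) + natural 2) * 0#
          ≈⟨ *-congˡ (u≁ y≁z) ⟨
        (natural 2 * (A * M) + natural 2) * u y z ∎)
        where open import Relation.Binary.Reasoning.Setoid setoid
      edge z (yes y∼z) = ≼-respˡ (trans (+-congʳ (*-congˡ (reflexive (≡.cong (λ b → natural (2 ℕ.* b)) (≡.sym (ℕ.*-identityˡ (behind k z y)))))))
          (subtree-at z (child-yes y∼z z≢y) (adj-yes y∼z)))
        (root-edge (1≼u y∼z) (2u≼d y∼z)
          (behind≼ k (∼-sym y∼z) (≼-trans s≼a (u-sym y∼z))) s≼a (u≼M z) (curvature y∼z))
        where
        z≢y : ¬ z ≡ y
        z≢y ≡.refl = ∼-irrefl y y∼z
        s≼a : d z - u z y ≼ u y z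
        s≼a = below-root-edge (1≼u y∼z) (Δ (u≼d z y)) (2u≼d y∼z) (curvature y∼z)

    module _ {M ε : Carrier} {B : ℕ} (u≼M : ∀ x y → u x y ≼ M)
      (0≼ε : 0# ≼ ε) (ε≼1 : ε ≼ natural 1) (2nnε≼1 : natural 2 * natural (n ℕ.* n) * ε ≼ natural 1)
      (B≤n : B ℕ.≤ n)
      where

      B≼M⇒ : natural B ≼ M → natural B + ε ≼ M + natural 1
      B≼M⇒ B≼M = +-mono-≼ B≼M ε≼1

      -- `root-bound` omits `y` itself, which accounts for the 1 added to M. The case B ≤ M is
      -- immediate; otherwise M ≤ B ≤ n bounds `d y` by n², as `spread` requires.
      vertex-root : ∀ k {x y} → B ℕ.≤ behind (suc k) y y → y ∼ x → M ≼ u y x → ¬ (d y - u y x ≼ M) →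
        natural B + ε ≼ M + natural 1
      vertex-root k {x} {y} B≤ y∼x M≼u s⋠M = ≼-stable λ contra → contra
        (≼-trans (+-mono-≼ (natural-mono (ℕ.≤-trans B≤ (ℕ.+-monoˡ-≤ K (branch?≤1 y)))) ≼-refl)
          (≼-respˡ (sym (trans (+-congʳ (natural-+ 1 K)) (+-assoc _ _ _)))
            (≼-respʳ (+-comm _ _) (+-mono-≼ ≼-refl (K+ε≼M (≼-total _ _ (contra ∘ B≼M⇒)))))))
        where
        open Solver
        K : ℕ
        K = ∑ℕ (λ z → child y y z ℕ.* behind k z y)
        2M≼d : natural 2 * M ≼ d y
        2M≼d = x≼y⇐y-x≈z _ (0≼-+ (Δ (≼-total _ _ s⋠M)) (Δ M≼u))
          (solve 3 (λ d a m → (d :- a :- m) :+ (a :- m) := d :- con (+ 2) :* m) refl (d y) (u y x) M)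
        2u≼d : ∀ {z} → y ∼ z → natural 2 * u y z ≼ d y
        2u≼d {z} y∼z = x≼y⇐y-x≈z _ (0≼-+ (Δ 2M≼d) (0≼-* (0≼natural 2) (Δ (u≼M y z))))
          (solve 3 (λ d a m → (d :- con (+ 2) :* m) :+ con (+ 2) :* (m :- a) := d :- con (+ 2) :* a) refl (d y) (u y z) M)
        0≼M : 0# ≼ M
        0≼M = ≼-trans (0≼u y x) (u≼M y x)
        -- With at most two edges at `y`, removing the one of weight M would leave at most M.
        deg≰2 : ¬ (degree y ℕ.≤ 2)
        deg≰2 deg≤2 = s⋠M (x≼y⇐y-x≈z _
          (0≼-+ (Δ (d≼degree* y (u≼M y))) (0≼-+ (0≼-* 0≼M (Δ (natural-mono deg≤2))) (Δ M≼u)))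
          (solve 4 (λ d a m g → (m :* g :- d) :+ (m :* (con (+ 2) :- g) :+ (a :- m)) := m :- (d :- a)) refl (d y) (u y x) M (natural (degree y))))
        3≤deg : 3 ℕ.≤ degree y
        3≤deg = ℕ.≰⇒> deg≰2
        K+ε≼M : M ≼ natural B → natural K + ε ≼ M
        K+ε≼M M≼B = spread (≼-trans (1≼u y∼x) (u≼d y x)) 0≼ε d≼nn 2nnε≼1
          (≼-respˡ (+-congʳ (*-congˡ (natural-* 2 K))) (root-bound k y (u≼M y) 2u≼d 3≤deg))
          where
          d≼nn : d y ≼ natural (n ℕ.* n)
          d≼nn = ≼-respʳ (sym (natural-* n n)) (≼-trans (d≼degree* y (u≼M y))
            (x≼y⇐y-x≈z _ (0≼-+ (0≼-* (0≼natural n) (Δ (≼-trans M≼B (natural-mono B≤n)))) (0≼-* 0≼M (Δ (natural-mono (degree≤n y)))))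
              (solve 3 (λ n m g → n :* (n :- m) :+ m :* (n :- g) := n :* n :- m :* g) refl (natural n) M (natural (degree y)))))

      -- The comparisons of the two sides with M are undecidable. Each use of `contra` discharges
      -- the case that one side is heavier than M and passes on the opposite inequality; with both
      -- sides at most M, the two counts are added.
      branch-bound : ∀ k {x y} → (∀ v → B ℕ.≤ behind (suc k) v v) → B ℕ.≤ behind k x y ℕ.+ behind k y x →
        x ∼ y → M ≼ u x y → natural B + ε ≼ M + natural 1
      branch-bound k {x} {y} B≤root B≤edge x∼y M≼u = ≼-stable λ contra →
        contra (vertex-root k (B≤root x) x∼y M≼u λ sx≼M →
        contra (vertex-root k (B≤root y) (∼-sym x∼y) (≼-trans M≼u (u-sym x∼y)) λ sy≼M →
        contra (B≼M⇒ (B≼M sx≼M sy≼M))))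
        where
        B≼M : d x - u x y ≼ M → d y - u y x ≼ M → natural B ≼ M
        B≼M sx≼M sy≼M = *-cancelʳ-≼ (natural-mono {1} {2} (s≤s z≤n))
          (≼-trans (≼-trans (≼-reflexive (sym (natural-* B 2)))
            (natural-mono (ℕ.≤-trans (ℕ.*-monoˡ-≤ 2 B≤edge) (ℕ.≤-reflexive (double (behind k x y) (behind k y x))))))
            (≼-trans (≼-reflexive (natural-+ (2 ℕ.* behind k x y) (2 ℕ.* behind k y x)))
              (≼-trans (+-mono-≼ (≼-trans (behind≼ k x∼y (≼-trans sx≼M M≼u)) sx≼M)
                                 (≼-trans (behind≼ k (∼-sym x∼y) (≼-trans sy≼M (≼-trans M≼u (u-sym x∼y)))) sy≼M))
                (≼-reflexive (solve 1 (λ m → m :+ m := m :* con (+ 2)) refl M)))))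
          where
          open Solver
          double : ∀ a b → (a ℕ.+ b) ℕ.* 2 ≡ 2 ℕ.* a ℕ.+ 2 ℕ.* b
          double = ℕs.solve 2 (λ a b → (a ℕs.:+ b) ℕs.:* ℕs.con 2 ℕs.:= ℕs.con 2 ℕs.:* a ℕs.:+ ℕs.con 2 ℕs.:* b) ≡.refl
            where module ℕs = ℕ-Solver

-- Optimal transport

module Transport (F : StablyOrderedRing) where
  open StablyOrderedRing F
  open OrderedRingProperties F
  open import Relation.Binary.Reasoning.Setoid setoid

  sum-point : ∀ {n} (f : Vector Carrier n) i → sum (λ j → f j * natural (indicator (i ≟ᶠ j))) ≈ f i
  sum-point {suc n} f zero = begin
    f zero * natural 1 + sum (λ j → f (suc j) * natural 0)
      ≈⟨ +-cong (trans (*-congˡ integer-1) (*-identityʳ (f zero)))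
           (trans (sum-cong-≋ {n} (λ j → trans (*-congˡ integer-0) (zeroʳ (f (suc j))))) (sum-replicate-zero n)) ⟩
    f zero + 0#
      ≈⟨ +-identityʳ (f zero) ⟩
    f zero ∎
  sum-point {suc n} f (suc i) = begin
    f zero * natural 0 + sum (λ j → f (suc j) * natural (indicator (i ≟ᶠ j)))
      ≈⟨ +-cong (trans (*-congˡ integer-0) (zeroʳ (f zero))) (sum-point (f ∘ suc) i) ⟩
    0# + f (suc i)
      ≈⟨ +-identityˡ (f (suc i)) ⟩
    f (suc i) ∎

  -- The easy half of Kantorovich duality. As the potential takes values in ℕ, its mean under `ν`
  -- stands on the right instead of being subtracted.
  weak-duality : ∀ {n} {μ ν : Fin n → Carrier} {π : Fin n → Fin n → Carrier} (D : Fin n → Fin n → ℕ) (f : Fin n → ℕ) →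
    (∀ x y → 0# ≼ π x y) → (∀ x → sum (π x) ≈ μ x) → (∀ y → sum (λ x → π x y) ≈ ν y) →
    (∀ x y → f x ℕ.≤ D x y ℕ.+ f y) →
    sum (λ x → natural (f x) * μ x) ≼ sum (λ x → sum (λ y → π x y * natural (D x y))) + sum (λ y → natural (f y) * ν y)
  weak-duality {n} {μ} {ν} {π} D f 0≼π π-μ π-ν lipschitz = ≼-respˡ from-μ (≼-respʳ (sym to-ν)
    (sum-mono λ x → sum-mono λ y → pointwise x y))
    where
    from-μ : sum (λ x → sum (λ y → natural (f x) * π x y)) ≈ sum (λ x → natural (f x) * μ x)
    from-μ = sum-cong-≋ λ x → trans (sym (*-distribˡ-sum (natural (f x)) (π x))) (*-congˡ (π-μ x))
    to-ν : sum (λ x → sum (λ y → π x y * natural (D x y))) + sum (λ y → natural (f y) * ν y) ≈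
      sum (λ x → sum (λ y → π x y * natural (D x y) + natural (f y) * π x y))
    to-ν = begin
      sum (λ x → sum (λ y → π x y * natural (D x y))) + sum (λ y → natural (f y) * ν y)
        ≈⟨ +-congˡ (sum-cong-≋ λ y → trans (*-congˡ (sym (π-ν y))) (*-distribˡ-sum (natural (f y)) (λ x → π x y))) ⟩
      sum (λ x → sum (λ y → π x y * natural (D x y))) + sum (λ y → sum (λ x → natural (f y) * π x y))
        ≈⟨ +-congˡ (∑-comm (λ y x → natural (f y) * π x y)) ⟩
      sum (λ x → sum (λ y → π x y * natural (D x y))) + sum (λ x → sum (λ y → natural (f y) * π x y))
        ≈⟨ ∑-distrib-+ (λ x → sum (λ y → π x y * natural (D x y))) (λ x → sum (λ y → natural (f y) * π x y)) ⟨
      sum (λ x → sum (λ y → π x y * natural (D x y)) + sum (λ y → natural (f y) * π x y))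
        ≈⟨ sum-cong-≋ (λ x → sym (∑-distrib-+ (λ y → π x y * natural (D x y)) (λ y → natural (f y) * π x y))) ⟩
      sum (λ x → sum (λ y → π x y * natural (D x y) + natural (f y) * π x y)) ∎
    pointwise : ∀ x y → natural (f x) * π x y ≼ π x y * natural (D x y) + natural (f y) * π x y
    pointwise x y = x≼y⇐y-x≈z _ (0≼-* (0≼π x y) (Δ (≼-respʳ (natural-+ (D x y) (f y)) (natural-mono (lipschitz x y)))))
      (solve 4 (λ p a b c → p :* ((b :+ c) :- a) := (p :* b :+ c :* p) :- a :* p) refl
        (π x y) (natural (f x)) (natural (D x y)) (natural (f y)))
      where open Solver

  module _ {n} (f : Fin n → ℕ) {x y : Fin n} (a : Fin n → Carrier) where

    expectation : ∀ α c (m : Fin n → Carrier) →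
      (∀ z → m z ≈ α * natural (indicator (x ≟ᶠ z)) + c * a z) →
      sum (λ z → natural (f z) * m z) ≈ α * natural (f x) + c * sum (λ z → natural (f z) * a z)
    expectation α c m m≈ = begin
      sum (λ z → natural (f z) * m z)
        ≈⟨ sum-cong-≋ (λ z → trans (*-congˡ (m≈ z)) (expand (natural (f z)) (natural (indicator (x ≟ᶠ z))) (a z))) ⟩
      sum (λ z → α * (natural (f z) * natural (indicator (x ≟ᶠ z))) + c * (natural (f z) * a z))
        ≈⟨ sum-linear α c (λ z → natural (f z) * natural (indicator (x ≟ᶠ z))) (λ z → natural (f z) * a z) ⟩
      α * sum (λ z → natural (f z) * natural (indicator (x ≟ᶠ z))) + c * sum (λ z → natural (f z) * a z)
        ≈⟨ +-congʳ (*-congˡ (sum-point (natural ∘ f) x)) ⟩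
      α * natural (f x) + c * sum (λ z → natural (f z) * a z) ∎
      where
      open Solver
      expand : ∀ φ i a → φ * (α * i + c * a) ≈ α * (φ * i) + c * (φ * a)
      expand = solve 5 (λ α c φ i a → φ :* (α :* i :+ c :* a) := α :* (φ :* i) :+ c :* (φ :* a)) refl α c

    -- The values of `f` are prescribed after multiplication by `a`, which leaves `f` free where `a`
    -- vanishes, that is, off the neighbourhood.
    sum-on-support : ∀ p q → f y ≡ q → (∀ z → ¬ z ≡ y → natural (f z) * a z ≈ natural p * a z) →
      sum (λ z → natural (f z) * a z) ≈ natural p * sum a + (natural q - natural p) * a y
    sum-on-support p q fy≡q support = begin
      sum (λ z → natural (f z) * a z)
        ≈⟨ sum-cong-≋ (λ z → pointwise z (y ≟ᶠ z)) ⟩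
      sum (λ z → natural p * a z + (natural q - natural p) * (a z * natural (indicator (y ≟ᶠ z))))
        ≈⟨ sum-linear (natural p) (natural q - natural p) a (λ z → a z * natural (indicator (y ≟ᶠ z))) ⟩
      natural p * sum a + (natural q - natural p) * sum (λ z → a z * natural (indicator (y ≟ᶠ z)))
        ≈⟨ +-congˡ (*-congˡ (sum-point a y)) ⟩
      natural p * sum a + (natural q - natural p) * a y ∎
      where
      open Solver
      at : ∀ {z i} → indicator (y ≟ᶠ z) ≡ i →
        natural p * a z + (natural q - natural p) * (a z * natural i) ≈
        natural p * a z + (natural q - natural p) * (a z * natural (indicator (y ≟ᶠ z)))
      at ≡.refl = refl
      pointwise : ∀ z → Dec (y ≡ z) → natural (f z) * a z ≈
        natural p * a z + (natural q - natural p) * (a z * natural (indicator (y ≟ᶠ z)))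
      pointwise z (yes ≡.refl) = trans (*-congʳ (reflexive (≡.cong natural fy≡q)))
        (trans (solve 3 (λ a p q → q :* a := p :* a :+ (q :- p) :* (a :* con (+ 1))) refl (a z) (natural p) (natural q))
          (at (indicator-yes (y ≟ᶠ z) ≡.refl)))
      pointwise z (no y≢z) = trans (support z (y≢z ∘ ≡.sym))
        (trans (solve 3 (λ a p q → p :* a := p :* a :+ (q :- p) :* (a :* con (+ 0))) refl (a z) (natural p) (natural q))
          (at (indicator-no (y ≟ᶠ z) y≢z)))

  -- The difference of the means of the potential under the two measures of an edge of
  -- weight w = w′, whose ends have weighted degrees d = 1/i and d′ = 1/i′.
  dualValue : (α d d′ i i′ w w′ : Carrier) → Carrier
  dualValue α d d′ i i′ w w′ =
    (α * natural 2 + ((natural 1 - α) * i) * (natural 3 * d + (natural 1 - natural 3) * w)) -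
    (α * natural 1 + ((natural 1 - α) * i′) * (natural 0 * d′ + (natural 2 - natural 0) * w′))

  edgeCurvature : (i i′ w w′ : Carrier) → Carrier
  edgeCurvature i i′ w w′ = natural 2 * (w * i + w′ * i′ - natural 1)

  -- With S = wi + w′i′ and di = 1, the dual value is α + (1 - α)(3 - 2S). So 1 minus it is (1 - α)
  -- · 2(S - 1), and the factor 1 - α cancels against `j`.
  curvature-bound : ∀ {α d d′ i i′ w w′ v κ j} → d * i ≈ natural 1 → 0# ≼ j → (natural 1 - α) * j ≈ natural 1 →
    dualValue α d d′ i i′ w w′ ≼ v →
    κ ≈ natural 1 - v →
    κ * j ≼ edgeCurvature i i′ w w′
  curvature-bound {α} {d} {d′} {i} {i′} {w} {w′} {v} {κ} {j} di≈1 0≼j ηj≈1 l≼v κ≈ =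
    ≼-respˡ (*-congʳ (sym κ≈)) (x≼y⇐y-x≈z _ (0≼-* (Δ l≼v) 0≼j) (begin
      (v - ((α * natural 2 + ((natural 1 - α) * i) * (natural 3 * d + (natural 1 - natural 3) * w)) -
        (α * natural 1 + ((natural 1 - α) * i′) * (natural 0 * d′ + (natural 2 - natural 0) * w′)))) * j
        ≈⟨ solve 9 (λ α d d′ i i′ w w′ v j → let one = con (+ 1); two = con (+ 2); three = con (+ 3); zero = con (+ 0); η = one :- α in
            (v :- ((α :* two :+ (η :* i) :* (three :* d :+ (one :- three) :* w)) :-
              (α :* one :+ (η :* i′) :* (zero :* d′ :+ (two :- zero) :* w′)))) :* j
            := ((η :* j) :* (two :* (w :* i :+ w′ :* i′) :+ one :- three :* (d :* i)) :- (one :- v) :* j))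
            refl α d d′ i i′ w w′ v j ⟩
      ((natural 1 - α) * j) * (natural 2 * (w * i + w′ * i′) + natural 1 - natural 3 * (d * i)) - (natural 1 - v) * j
        ≈⟨ +-congʳ (*-cong ηj≈1 (+-congˡ (-‿cong (*-congˡ di≈1)))) ⟩
      natural 1 * (natural 2 * (w * i + w′ * i′) + natural 1 - natural 3 * natural 1) - (natural 1 - v) * j
        ≈⟨ solve 3 (λ a v j → let one = con (+ 1); two = con (+ 2); three = con (+ 3) in
            one :* (two :* a :+ one :- three :* one) :- (one :- v) :* j := two :* (a :- one) :- (one :- v) :* j)
            refl (w * i + w′ * i′) v j ⟩
      natural 2 * (w * i + w′ * i′ - natural 1) - (natural 1 - v) * j ∎))
    where open Solver

  -- Multiplied by dd′, the inequality w/d + w/d′ ≥ 1 reads dd′ ≤ w(d + d′), which is (d - w)(d′ -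
  -- w) ≤ w². The factor `j` rescales the weights.
  curvature-product : ∀ {d d′ i i′ w w′} j → d * i ≈ natural 1 → d′ * i′ ≈ natural 1 → 0# ≼ d → 0# ≼ d′ →
    0# ≼ edgeCurvature i i′ w w′ → w′ ≈ w → 0# ≼ j →
    (d * j - w * j) * (d′ * j - w′ * j) ≼ (w * j) * (w * j)
  curvature-product {d} {d′} {i} {i′} {w} {w′} j di≈1 d′i′≈1 0≼d 0≼d′ 0≼E w′≈w 0≼j =
    ≼-respʳ (*-congˡ (*-congʳ w′≈w)) (*-cancelʳ-≼ (natural-mono {1} {2} (s≤s z≤n))
      (x≼y⇐y-x≈z _ (0≼-* (0≼-* 0≼j 0≼j) (0≼-* (0≼-* 0≼d 0≼d′) 0≼E)) (begin
        (j * j) * ((d * d′) * (natural 2 * (w * i + w′ * i′ - natural 1)))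
          ≈⟨ solve 7 (λ d d′ i i′ w w′ j → (j :* j) :* ((d :* d′) :* (con (+ 2) :* (w :* i :+ w′ :* i′ :- con (+ 1))))
               := (j :* j) :* (con (+ 2) :* (w :* d′ :* (d :* i) :+ w′ :* d :* (d′ :* i′) :- d :* d′))) refl d d′ i i′ w w′ j ⟩
        (j * j) * (natural 2 * (w * d′ * (d * i) + w′ * d * (d′ * i′) - d * d′))
          ≈⟨ *-congˡ (*-congˡ (+-congʳ (+-cong (*-congˡ di≈1) (*-congˡ d′i′≈1)))) ⟩
        (j * j) * (natural 2 * (w * d′ * natural 1 + w′ * d * natural 1 - d * d′))
          ≈⟨ solve 5 (λ d d′ w w′ j → (j :* j) :* (con (+ 2) :* (w :* d′ :* con (+ 1) :+ w′ :* d :* con (+ 1) :- d :* d′))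
               := ((w :* j) :* (w′ :* j)) :* con (+ 2) :- ((d :* j :- w :* j) :* (d′ :* j :- w′ :* j)) :* con (+ 2)) refl d d′ w w′ j ⟩
        ((w * j) * (w′ * j)) * natural 2 - ((d * j - w * j) * (d′ * j - w′ * j)) * natural 2 ∎)))
    where open Solver

  -- One formula for the three cases of `measure`, so that means become linear combinations of sums:
  -- `k` indicates the centre, `i` is the reciprocal of its weighted degree, and `a` is the incident
  -- weight, which is zero off the edges.
  lazyMass : (α i : Carrier) (k : ℕ) (a : Carrier) → Carrier
  lazyMass α i k a = α * natural k + ((natural 1 - α) * i) * a

  lazyMass-self : ∀ {α i a} → a ≈ 0# → α ≈ lazyMass α i 1 a
  lazyMass-self {α} {i} {a} a≈0 = sym (begin
    α * natural 1 + ((natural 1 - α) * i) * a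
      ≈⟨ +-cong (trans (*-congˡ integer-1) (*-identityʳ α)) (trans (*-congˡ a≈0) (zeroʳ _)) ⟩
    α + 0#
      ≈⟨ +-identityʳ α ⟩
    α ∎)

  lazyMass-edge : ∀ {α i i′ b w a} → i ≈ i′ → b ≈ natural 1 - α → w ≈ a → (b * w) * i ≈ lazyMass α i′ 0 a
  lazyMass-edge {α} {i} {i′} {b} {w} {a} i≈i′ b≈ w≈a = trans (*-cong (*-cong b≈ w≈a) i≈i′)
    (solve 3 (λ α i w → ((con (+ 1) :- α) :* w) :* i := α :* con (+ 0) :+ ((con (+ 1) :- α) :* i) :* w) refl α i′ a)
    where open Solver

  lazyMass-null : ∀ {α i a} → a ≈ 0# → 0# ≈ lazyMass α i 0 a
  lazyMass-null {α} {i} {a} a≈0 = sym (begin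
    α * natural 0 + ((natural 1 - α) * i) * a
      ≈⟨ +-cong (trans (*-congˡ integer-0) (zeroʳ α)) (trans (*-congˡ a≈0) (zeroʳ _)) ⟩
    0# + 0#
      ≈⟨ +-identityʳ 0# ⟩
    0# ∎)

  module _ {n} (D : Fin n → Fin n → ℕ) (f : Fin n → ℕ) (lipschitz : ∀ a b → f a ℕ.≤ D a b ℕ.+ f b)
    {x y : Fin n} (fx≡2 : f x ≡ 2) (fy≡1 : f y ≡ 1) (a a′ : Fin n → Carrier)
    (f-near-x : ∀ z → ¬ z ≡ y → natural (f z) * a z ≈ natural 3 * a z)
    (f-near-y : ∀ z → ¬ z ≡ x → natural (f z) * a′ z ≈ natural 0 * a′ z)
    {α i i′ : Carrier} {μ ν : Fin n → Carrier}
    (μ≈ : ∀ z → μ z ≈ lazyMass α i (indicator (x ≟ᶠ z)) (a z))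
    (ν≈ : ∀ z → ν z ≈ lazyMass α i′ (indicator (y ≟ᶠ z)) (a′ z))
    where

    dualValue≼cost : ∀ π → (∀ u v → 0# ≼ π u v) →
      (∀ u → sum (π u) ≈ μ u) → (∀ v → sum (λ u → π u v) ≈ ν v) →
      dualValue α (sum a) (sum a′) i i′ (a y) (a′ x) ≼ sum (λ u → sum (λ v → π u v * natural (D u v)))
    dualValue≼cost π 0≼π π-μ π-ν = x≼y⇐y-x≈z _
      (Δ (≼-respˡ mean-μ (≼-respʳ (+-congˡ mean-ν) (weak-duality {μ = μ} {ν} {π} D f 0≼π π-μ π-ν lipschitz))))
      (solve 3 (λ a b c → (c :+ b) :- a := c :- (a :- b)) refl mean₁ mean₂ (sum (λ u → sum (λ v → π u v * natural (D u v)))))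
      where
      open Solver
      mean₁ mean₂ : Carrier
      mean₁ = α * natural 2 + ((natural 1 - α) * i) * (natural 3 * sum a + (natural 1 - natural 3) * a y)
      mean₂ = α * natural 1 + ((natural 1 - α) * i′) * (natural 0 * sum a′ + (natural 2 - natural 0) * a′ x)
      mean-μ : sum (λ z → natural (f z) * μ z) ≈ mean₁
      mean-μ = trans (expectation f {x} {y} a α ((natural 1 - α) * i) μ μ≈)
        (+-cong (*-congˡ (reflexive (≡.cong natural fx≡2)))
          (*-congˡ (sum-on-support f {x} {y} a 3 1 fy≡1 f-near-x)))
      mean-ν : sum (λ z → natural (f z) * ν z) ≈ mean₂
      mean-ν = trans (expectation f {y} {x} a′ α ((natural 1 - α) * i′) ν ν≈)
        (+-cong (*-congˡ (reflexive (≡.cong natural fy≡1)))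
          (*-congˡ (sum-on-support f {y} {x} a′ 0 2 fx≡2 f-near-y)))

-- Distances in a tree

module TreeDistance {n} (T : Tree n) where
  open Tree T
  open Distance connectedGraph

  -- A path from `a` to `b` with at least three vertices inside the ball of radius `k` around `r`,
  -- to be closed up to a cycle. `linked` is in continuation form: whatever may follow `b` may
  -- follow the path.
  record Detour (r a b : Fin n) (k : ℕ) : Set where
    field
      rest   : List (Fin n)
      unique : Unique (a ∷ rest)
      below  : All (λ v → dist v r ℕ.≤ k) (a ∷ rest)
      long   : 2 ℕ.≤ length rest
      linked : ∀ {vs} → Linked _∼_ (b ∷ vs) → Linked _∼_ (a ∷ rest ++ vs)

  -- Both ends descend towards `r` level by level until they meet, at `r` at the latest. The inner
  -- part stays on lower levels, which keeps the new ends distinct from it.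
  detour : ∀ {r} k {a b} → dist a r ≡ k → dist b r ≡ k → a ≢ b → Detour r a b k
  detour zero    ha hb a≢b = ⊥-elim (a≢b (≡.trans (dist≡0⇒≡ ha) (≡.sym (dist≡0⇒≡ hb))))
  detour {r} (suc k) {a} {b} ha hb a≢b with closer ha | closer hb
  ... | a′ , a∼a′ , ha′ | b′ , b∼b′ , hb′ with a′ ≟ᶠ b′
  ...   | yes ≡.refl = record
    { rest   = a′ ∷ b ∷ []
    ; unique = ((λ a≡a′ → ℕ.1+n≢n (≡.trans (≡.sym ha) (≡.trans (≡.cong (λ v → dist v r) a≡a′) ha′))) ∷ a≢b ∷ []) ∷
               ((λ a′≡b → ℕ.1+n≢n (≡.trans (≡.sym hb) (≡.trans (≡.cong (λ v → dist v r) (≡.sym a′≡b)) ha′))) ∷ []) ∷ [] ∷ []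
    ; below  = ℕ.≤-reflexive ha ∷ ℕ.≤-trans (ℕ.≤-reflexive ha′) (ℕ.n≤1+n k) ∷ ℕ.≤-reflexive hb ∷ []
    ; long   = ℕ.≤-refl
    ; linked = λ bvs → a∼a′ ∷ ∼-sym b∼b′ ∷ bvs
    }
  ...   | no a′≢b′ = record
    { rest   = (a′ ∷ D.rest) ∷ʳ b
    ; unique = All.∷ʳ⁺ (away ha) a≢b ∷ AllPairs.++⁺ D.unique ([] ∷ []) (All.map (λ b≢v → (b≢v ∘ ≡.sym) ∷ []) (away hb))
    ; below  = ℕ.≤-reflexive ha ∷ All.∷ʳ⁺ (All.map ℕ.m≤n⇒m≤1+n D.below) (ℕ.≤-reflexive hb)
    ; long   = subst (2 ℕ.≤_) (≡.sym (≡.trans (length-++ (a′ ∷ D.rest)) (ℕ.+-comm _ 1))) (s≤s (s≤s z≤n))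
    ; linked = λ {vs} bvs → subst (λ l → Linked _∼_ (a ∷ l)) (≡.sym (++-assoc (a′ ∷ D.rest) (b ∷ []) vs))
                 (a∼a′ ∷ D.linked (∼-sym b∼b′ ∷ bvs))
    }
    where
    module D = Detour (detour k ha′ hb′ a′≢b′)
    away : ∀ {v} → dist v r ≡ suc k → All (v ≢_) (a′ ∷ D.rest)
    away hv = All.map (λ {u} hu v≡u → ℕ.<⇒≱ (ℕ.≤-reflexive (≡.sym hv)) (subst (λ v → dist v r ℕ.≤ k) (≡.sym v≡u) hu)) D.below

  -- A detour between adjacent vertices of the same level would be closed to a cycle by their edge.
  dist-adjacent-≢ : ∀ {x y} r → x ∼ y → dist x r ≢ dist y r
  dist-adjacent-≢ {x} {y} r x∼y eq = acyclic record
    { start    = x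
    ; rest     = D.rest
    ; distinct = D.unique
    ; linked   = D.linked (∼-sym x∼y ∷ [-])
    ; length≥3 = s≤s D.long
    }
    where
    module D = Detour (detour (dist y r) eq ≡.refl λ x≡y → ∼-irrefl y (subst (_∼ y) x≡y x∼y))

  -- Two different steps from `v` towards `r` would be joined by a detour on lower levels, and `v`
  -- would close it to a cycle.
  closer-unique : ∀ {r v a b k} → dist v r ≡ suc k → v ∼ a → v ∼ b → dist a r ≡ k → dist b r ≡ k → a ≡ b
  closer-unique {r} {v} {a} {b} {k} hv v∼a v∼b ha hb with a ≟ᶠ b
  ... | yes a≡b = a≡b
  ... | no  a≢b = ⊥-elim (acyclic record
    { start    = v
    ; rest     = a ∷ D.rest
    ; distinct = All.map (λ {u} hu v≡u → ℕ.<⇒≱ (ℕ.≤-reflexive (≡.sym hv)) (subst (λ v → dist v r ℕ.≤ k) (≡.sym v≡u) hu)) D.below ∷ D.unique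
    ; linked   = v∼a ∷ D.linked (∼-sym v∼b ∷ [-])
    ; length≥3 = s≤s (ℕ.≤-trans D.long (ℕ.n≤1+n _))
    })
    where module D = Detour (detour k ha hb a≢b)

  dist-sym : ∀ x y → dist x y ≡ dist y x
  dist-sym x y = ℕ.≤-antisym (dist-minimal x y (reverse (dist-walk y x))) (dist-minimal y x (reverse (dist-walk x y)))
    where
    extend : ∀ {k x y z} → Walk k x y → y ∼ z → Walk (suc k) x z
    extend {zero}  ≡.refl y∼z = _ , y∼z , ≡.refl
    extend {suc k} (v , x∼v , walk) y∼z = v , x∼v , extend walk y∼z
    reverse : ∀ {k x y} → Walk k x y → Walk k y x
    reverse {zero}  ≡.refl = ≡.refl
    reverse {suc k} (v , x∼v , walk) = extend (reverse walk) (∼-sym x∼v)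

  -- An edge with one end closer to x and the other closer to y is the edge xy:
  -- otherwise the first step from b towards y and the step to a would both lead
  -- from b towards x.
  separating-edge : ∀ {x y a b} → x ∼ y → a ∼ b → dist a x ℕ.< dist a y → dist b y ℕ.< dist b x →
    a ≡ x × b ≡ y
  separating-edge {x} {y} {a} {b} x∼y a∼b ax<ay by<bx = go (dist a x) ≡.refl
    where
    by≤ax : dist b y ℕ.≤ dist a x
    by≤ax = ℕ.≤-pred (ℕ.≤-trans by<bx (dist-step x (∼-sym a∼b)))
    ax≤by : dist a x ℕ.≤ dist b y
    ax≤by = ℕ.≤-pred (ℕ.≤-trans ax<ay (dist-step y a∼b))
    ax≡by : dist a x ≡ dist b y
    ax≡by = ℕ.≤-antisym ax≤by by≤ax
    bx≡1+ax : dist b x ≡ suc (dist a x)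
    bx≡1+ax = ℕ.≤-antisym (dist-step x (∼-sym a∼b)) (subst (λ k → suc k ℕ.≤ dist b x) (≡.sym ax≡by) by<bx)
    go : ∀ k → dist a x ≡ k → a ≡ x × b ≡ y
    go zero    eq = dist≡0⇒≡ eq , dist≡0⇒≡ (≡.trans (≡.sym ax≡by) eq)
    go (suc k) eq with closer {b} {y} {k} (≡.trans (≡.sym ax≡by) eq)
    ... | c , b∼c , cy≡k = ⊥-elim (ℕ.<⇒≱ ax<ay
      (ℕ.≤-trans (ℕ.≤-reflexive (≡.trans (≡.cong (λ v → dist v y) a≡c) cy≡k)) (ℕ.≤-trans (ℕ.n≤1+n k) (ℕ.≤-reflexive (≡.sym eq)))))
      where
      cx≤1+k : dist c x ℕ.≤ suc k
      cx≤1+k = ℕ.≤-trans (ℕ.≤-reflexive (dist-sym c x)) (ℕ.≤-trans (dist-step c x∼y)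
        (s≤s (ℕ.≤-trans (ℕ.≤-reflexive (dist-sym y c)) (ℕ.≤-reflexive cy≡k))))
      bx≡2+k : dist b x ≡ suc (suc k)
      bx≡2+k = ≡.trans bx≡1+ax (≡.cong suc eq)
      1+k≤cx : suc k ℕ.≤ dist c x
      1+k≤cx = ℕ.≤-pred (ℕ.≤-trans (ℕ.≤-reflexive (≡.sym bx≡2+k)) (dist-step x b∼c))
      a≡c : a ≡ c
      a≡c = closer-unique bx≡2+k (∼-sym a∼b) b∼c eq (ℕ.≤-antisym cx≤1+k 1+k≤cx)

  module Potential {x y} (x∼y : x ∼ y) where

    -- The signed distance to y across the edge xy, shifted by 1 and clamped to [0, 3].
    potential : Fin n → ℕ
    potential v with dist v x ℕ.<? dist v y
    ... | yes _ = 3 ℕ.∸ indicator (v ≟ᶠ x)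
    ... | no  _ = indicator (v ≟ᶠ y)

    potential-near : ∀ {v} → dist v x ℕ.< dist v y → potential v ≡ 3 ℕ.∸ indicator (v ≟ᶠ x)
    potential-near {v} vx<vy with dist v x ℕ.<? dist v y
    ... | yes _     = ≡.refl
    ... | no  vx≮vy = ⊥-elim (vx≮vy vx<vy)

    potential-far : ∀ {v} → ¬ dist v x ℕ.< dist v y → potential v ≡ indicator (v ≟ᶠ y)
    potential-far {v} vx≮vy with dist v x ℕ.<? dist v y
    ... | yes vx<vy = ⊥-elim (vx≮vy vx<vy)
    ... | no  _     = ≡.refl

    dist≡1 : ∀ {u v} → u ∼ v → dist u v ≡ 1
    dist≡1 {u} {v} u∼v = ℕ.≤-antisym (dist-minimal u v (v , u∼v , ≡.refl))
      (ℕ.n≢0⇒n>0 λ eq → ∼-irrefl v (subst (_∼ v) (dist≡0⇒≡ eq) u∼v))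

    potential-x : potential x ≡ 2
    potential-x = ≡.trans (potential-near {x} xx<xy) (≡.cong (3 ℕ.∸_) (indicator-yes (x ≟ᶠ x) ≡.refl))
      where
      xx<xy : dist x x ℕ.< dist x y
      xx<xy = ℕ.≤-reflexive (≡.trans (≡.cong suc (dist-refl x)) (≡.sym (dist≡1 x∼y)))

    potential-y : potential y ≡ 1
    potential-y = ≡.trans (potential-far {y} (λ yx<yy → ℕ.n≮0 (subst (dist y x ℕ.<_) (dist-refl y) yx<yy)))
      (indicator-yes (y ≟ᶠ y) ≡.refl)

    potential-x∼ : ∀ {v} → x ∼ v → v ≢ y → potential v ≡ 3
    potential-x∼ {v} x∼v v≢y = ≡.trans (potential-near {v} (ℕ.≤∧≢⇒< vx≤vy λ eq → dist-adjacent-≢ v x∼y (≡.trans (dist-sym x v) (≡.trans eq (dist-sym v y)))))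
      (≡.cong (3 ℕ.∸_) (indicator-no (v ≟ᶠ x) λ v≡x → ∼-irrefl x (subst (x ∼_) v≡x x∼v)))
      where
      vx≤vy : dist v x ℕ.≤ dist v y
      vx≤vy = ℕ.≤-trans (ℕ.≤-reflexive (dist≡1 (∼-sym x∼v))) (ℕ.n≢0⇒n>0 (v≢y ∘ dist≡0⇒≡))

    potential-y∼ : ∀ {v} → y ∼ v → v ≢ x → potential v ≡ 0
    potential-y∼ {v} y∼v v≢x = ≡.trans (potential-far {v} (ℕ.≤⇒≯ vy≤vx))
      (indicator-no (v ≟ᶠ y) λ v≡y → ∼-irrefl y (subst (y ∼_) v≡y y∼v))
      where
      vy≤vx : dist v y ℕ.≤ dist v x
      vy≤vx = ℕ.≤-trans (ℕ.≤-reflexive (dist≡1 (∼-sym y∼v))) (ℕ.n≢0⇒n>0 (v≢x ∘ dist≡0⇒≡))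

    -- The values are 2 and 3 on the side of x, and 0 and 1 on the side of y. Only an edge leading
    -- from the first side to the second could drop by more than 1, and by `separating-edge` it is
    -- xy itself.
    potential-step : ∀ {a b} → a ∼ b → potential a ℕ.≤ suc (potential b)
    potential-step {a} {b} a∼b = go (dist a x ℕ.<? dist a y) (dist b x ℕ.<? dist b y)
      where
      go : Dec (dist a x ℕ.< dist a y) → Dec (dist b x ℕ.< dist b y) → potential a ℕ.≤ suc (potential b)
      go (no a-far) _ = ℕ.≤-trans (ℕ.≤-reflexive (potential-far {a} a-far)) (ℕ.≤-trans (indicator≤1 (a ≟ᶠ y)) (s≤s z≤n))
      go (yes a-near) (yes b-near) = ℕ.≤-trans (ℕ.≤-reflexive (potential-near {a} a-near))
        (ℕ.≤-trans (ℕ.m∸n≤m 3 (indicator (a ≟ᶠ x)))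
          (s≤s (ℕ.≤-trans (ℕ.∸-monoʳ-≤ 3 (indicator≤1 (b ≟ᶠ x))) (ℕ.≤-reflexive (≡.sym (potential-near {b} b-near))))))
      go (yes a-near) (no b-far) with separating-edge x∼y a∼b a-near
        (ℕ.≤∧≢⇒< (ℕ.≮⇒≥ b-far) λ eq → dist-adjacent-≢ b x∼y (≡.trans (dist-sym x b) (≡.trans (≡.sym eq) (dist-sym b y))))
      ... | ≡.refl , ≡.refl = ℕ.≤-reflexive (≡.trans potential-x (≡.cong suc (≡.sym potential-y)))

    potential-lipschitz : ∀ a b → potential a ℕ.≤ dist a b ℕ.+ potential b
    potential-lipschitz a b = along (dist-walk a b)
      where
      along : ∀ {k a} → Walk k a b → potential a ℕ.≤ k ℕ.+ potential b
      along {zero}  ≡.refl = ℕ.≤-refl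
      along {suc k} (c , a∼c , walk) = ℕ.≤-trans (potential-step a∼c) (s≤s (along walk))

-- The ordered field of real numbers

open import Defs

-- The normal form of i/1, on which the operations of ℚ can be computed for a variable `i`; the 0 is
-- the denominator minus one.
integerℚ : ℤ → ℚ
integerℚ i = ℚ.mkℚ i 0 (Coprimality.sym (Coprimality.1-coprimeTo ℤ.∣ i ∣))

abstract
  /1≡integerℚ : ∀ i → i ℚ./ 1 ≡ integerℚ i
  /1≡integerℚ i = ℚ.fromℚᵘ-toℚᵘ (integerℚ i)

  /1-+ : ∀ i j → (i ℤ.+ j) ℚ./ 1 ≡ (i ℚ./ 1) ℚ.+ (j ℚ./ 1)
  /1-+ i j = ≡.sym (≡.trans (≡.cong₂ ℚ._+_ (/1≡integerℚ i) (/1≡integerℚ j))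
    (≡.cong (ℚ._/ 1) (≡.cong₂ ℤ._+_ (ℤ.*-identityʳ i) (ℤ.*-identityʳ j))))

  /1-* : ∀ i j → (i ℤ.* j) ℚ./ 1 ≡ (i ℚ./ 1) ℚ.* (j ℚ./ 1)
  /1-* i j = ≡.sym (≡.cong₂ ℚ._*_ (/1≡integerℚ i) (/1≡integerℚ j))

  /1-neg : ∀ i → (ℤ.- i) ℚ./ 1 ≡ ℚ.- (i ℚ./ 1)
  /1-neg i = ≡.trans (/1≡integerℚ (ℤ.- i)) (≡.trans (neg i) (≡.cong ℚ.-_ (≡.sym (/1≡integerℚ i))))
    where
    neg : ∀ i → integerℚ (ℤ.- i) ≡ ℚ.- integerℚ i
    neg (+ 0)        = ≡.refl
    neg (+ (ℕ.suc n)) = ≡.refl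
    neg (ℤ.-[1+ n ]) = ≡.refl
 

/1-morphism : CommutativeRing.rawRing ℤ.+-*-commutativeRing -Raw-AlmostCommutative⟶ fromCommutativeRing ℚ.+-*-commutativeRing
/1-morphism = record
  { ⟦_⟧    = ℚ._/ 1
  ; +-homo = /1-+
  ; *-homo = /1-*
  ; -‿homo = /1-neg
  ; 0-homo = ≡.refl
  ; 1-homo = ≡.refl
  }

/1-≟ : ∀ i j → Maybe (i ℚ./ 1 ≡ j ℚ./ 1)
/1-≟ i j = Maybe.map (≡.cong (ℚ._/ 1)) (dec⇒maybe (i ℤ.≟ j))

module ℚ-Solver = RingSolver (CommutativeRing.rawRing ℤ.+-*-commutativeRing)
  (fromCommutativeRing ℚ.+-*-commutativeRing) /1-morphism /1-≟

-- Arithmetic and order of Cauchy sequences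

Eventually : (ℕ → Set) → Set
Eventually P = ∃[ N ] ∀ n → N ℕ.≤ n → P n

ev-map : ∀ {P Q : ℕ → Set} → (∀ n → P n → Q n) → Eventually P → Eventually Q
ev-map f (N , h) = N , λ n N≤n → f n (h n N≤n)

ev-map₂ : ∀ {P Q R : ℕ → Set} → (∀ n → P n → Q n → R n) →
  Eventually P → Eventually Q → Eventually R
ev-map₂ f (M , g) (N , h) = M ℕ.⊔ N , λ n p →
  f n (g n (ℕ.m⊔n≤o⇒m≤o M N p)) (h n (ℕ.m⊔n≤o⇒n≤o M N p))

ev-const : ∀ {P : Set} → Eventually (λ _ → P) → P
ev-const (N , h) = h N ℕ.≤-refl

ℚ-0<½* : ∀ {p} → 0ℚ ℚ.< p → 0ℚ ℚ.< ½ ℚ.* p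
ℚ-0<½* {p} 0<p = subst (ℚ._< ½ ℚ.* p) (ℚ.*-zeroʳ ½) (ℚ.*-monoʳ-<-pos ½ 0<p)

ℚ-0<* : ∀ {p q} → 0ℚ ℚ.< p → 0ℚ ℚ.< q → 0ℚ ℚ.< p ℚ.* q
ℚ-0<* {p} {q} 0<p 0<q = ℚ.positive⁻¹ (p ℚ.* q) {{ℚ.pos*pos⇒pos p {{ℚ.positive 0<p}} q {{ℚ.positive 0<q}}}}

0<recip : ∀ {p} → 0ℚ ℚ.< p → 0ℚ ℚ.< recip p
0<recip {p} 0<p = ℚ.*-cancelˡ-<-nonNeg p {{ℚ.nonNegative (ℚ.<⇒≤ 0<p)}}
  (≡.subst₂ ℚ._<_ (≡.sym (ℚ.*-zeroʳ p)) (≡.sym (*-recip p 0<p)) (ℚ.positive⁻¹ 1ℚ))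

½+½ : ∀ p → ½ ℚ.* p ℚ.+ ½ ℚ.* p ≡ p
½+½ p = ≡.trans (≡.sym (ℚ.*-distribʳ-+ p ½ ½)) (ℚ.*-identityˡ p)

∣-∣-sym : ∀ p q → ℚ.∣ p ℚ.- q ∣ ≡ ℚ.∣ q ℚ.- p ∣
∣-∣-sym p q = ≡.trans (≡.sym (ℚ.∣-p∣≡∣p∣ (p ℚ.- q))) (≡.cong ℚ.∣_∣ (ℚ-Solver.solve 2 (λ p q → :- (p :- q) := q :- p) ≡.refl p q))
  where open ℚ-Solver

p≤∣p∣ : ∀ p → p ℚ.≤ ℚ.∣ p ∣
p≤∣p∣ p with ℚ.≤-total 0ℚ p
... | inj₁ 0≤p = ℚ.≤-reflexive (≡.sym (ℚ.0≤p⇒∣p∣≡p 0≤p))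
... | inj₂ p≤0 = ℚ.≤-trans p≤0 (ℚ.0≤∣p∣ p)

ptw : ∀ {x y} → (∀ n → seq x n ≡ seq y n) → x ≈ y
ptw {x} {y} eq ε 0<ε = 0 , λ n _ →
  subst (λ q → ℚ.∣ seq x n ℚ.- q ∣ ℚ.< ε) (eq n)
    (subst (ℚ._< ε) (≡.cong ℚ.∣_∣ (≡.sym (ℚ.+-inverseʳ (seq x n)))) 0<ε)

abstract
  ≈-refl : ∀ {x} → x ≈ x
  ≈-refl {x} = ptw {x} {x} (λ _ → ≡.refl)

  ≈-sym : ∀ {x y} → x ≈ y → y ≈ x
  ≈-sym {x} {y} x≈y ε 0<ε =
    ev-map (λ n → subst (ℚ._< ε) (∣-∣-sym (seq x n) (seq y n))) (x≈y ε 0<ε)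

  ∣+∣<ε : ∀ {p q ε} → ℚ.∣ p ∣ ℚ.< ½ ℚ.* ε → ℚ.∣ q ∣ ℚ.< ½ ℚ.* ε → ℚ.∣ p ℚ.+ q ∣ ℚ.< ε
  ∣+∣<ε {p} {q} {ε} hp hq = ℚ.≤-<-trans (ℚ.∣p+q∣≤∣p∣+∣q∣ p q)
    (subst (ℚ.∣ p ∣ ℚ.+ ℚ.∣ q ∣ ℚ.<_) (½+½ ε) (ℚ.+-mono-< hp hq))

  ≈-trans : ∀ {x y z} → x ≈ y → y ≈ z → x ≈ z
  ≈-trans {x} {y} {z} x≈y y≈z ε 0<ε = ev-map₂
    (λ n h₁ h₂ → subst (λ q → ℚ.∣ q ∣ ℚ.< ε) (telescope (seq x n) (seq y n) (seq z n)) (∣+∣<ε h₁ h₂))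
    (x≈y _ (ℚ-0<½* 0<ε)) (y≈z _ (ℚ-0<½* 0<ε))
    where
    open ℚ-Solver
    telescope : ∀ p q r → (p ℚ.- q) ℚ.+ (q ℚ.- r) ≡ p ℚ.- r
    telescope = solve 3 (λ p q r → (p :- q) :+ (q :- r) := p :- r) ≡.refl

  +-cong : ∀ {x y u v} → x ≈ y → u ≈ v → x + u ≈ y + v
  +-cong {x} {y} {u} {v} x≈y u≈v ε 0<ε = ev-map₂
    (λ n h₁ h₂ → subst (λ q → ℚ.∣ q ∣ ℚ.< ε) (rearrange (seq x n) (seq y n) (seq u n) (seq v n)) (∣+∣<ε h₁ h₂))
    (x≈y _ (ℚ-0<½* 0<ε)) (u≈v _ (ℚ-0<½* 0<ε))
    where
    open ℚ-Solver
    rearrange : ∀ p q r s → (p ℚ.- q) ℚ.+ (r ℚ.- s) ≡ (p ℚ.+ r) ℚ.- (q ℚ.+ s)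
    rearrange = solve 4 (λ p q r s → (p :- q) :+ (r :- s) := (p :+ r) :- (q :+ s)) ≡.refl

  -‿cong : ∀ {x y} → x ≈ y → - x ≈ - y
  -‿cong {x} {y} x≈y ε 0<ε = ev-map
    (λ n → subst (ℚ._< ε) (≡.trans (≡.sym (ℚ.∣-p∣≡∣p∣ (seq x n ℚ.- seq y n)))
                                (≡.cong ℚ.∣_∣ (rearrange (seq x n) (seq y n)))))
    (x≈y ε 0<ε)
    where
    open ℚ-Solver
    rearrange : ∀ p q → ℚ.- (p ℚ.- q) ≡ ℚ.- p ℚ.- ℚ.- q
    rearrange = solve 2 (λ p q → :- (p :- q) := :- p :- :- q) ≡.refl

  bounded : ∀ x → ∃[ K ] 0ℚ ℚ.< K × Eventually (λ n → ℚ.∣ seq x n ∣ ℚ.≤ K)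
  bounded x with cauchy x 1ℚ (ℚ.positive⁻¹ 1ℚ)
  ... | N , h =
    1ℚ ℚ.+ ℚ.∣ a ∣ ,
    ℚ.<-≤-trans (ℚ.positive⁻¹ 1ℚ)
      (subst (ℚ._≤ 1ℚ ℚ.+ ℚ.∣ a ∣) (ℚ.+-identityʳ 1ℚ) (ℚ.+-monoʳ-≤ 1ℚ (ℚ.0≤∣p∣ a))) ,
    N , λ n N≤n → ℚ.≤-trans
      (subst (λ q → ℚ.∣ q ∣ ℚ.≤ ℚ.∣ seq x n ℚ.- a ∣ ℚ.+ ℚ.∣ a ∣) (cancel (seq x n) a)
        (ℚ.∣p+q∣≤∣p∣+∣q∣ (seq x n ℚ.- a) a))
      (ℚ.+-monoˡ-≤ ℚ.∣ a ∣ (ℚ.<⇒≤ (h n N N≤n ℕ.≤-refl)))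
    where
    a : ℚ
    a = seq x N
    open ℚ-Solver
    cancel : ∀ p q → (p ℚ.- q) ℚ.+ q ≡ p
    cancel = solve 2 (λ p q → (p :- q) :+ q := p) ≡.refl

  *-congˡ : ∀ x {y z} → y ≈ z → x * y ≈ x * z
  *-congˡ x {y} {z} y≈z ε 0<ε =
    let K , 0<K , xK = bounded x
        0<η = ℚ-0<* 0<ε (0<recip 0<K)
    in ev-map₂ (λ n → ∣*-*∣<ε (seq x n) (seq y n) (seq z n) 0<K) xK (y≈z (ε ℚ.* recip K) 0<η)
    where
    open ℚ-Solver using (solve; _:*_; _:-_; _:=_)
    swap : ∀ k e r → k ℚ.* (e ℚ.* r) ≡ e ℚ.* (k ℚ.* r)
    swap = solve 3 (λ k e r → k :* (e :* r) := e :* (k :* r)) ≡.refl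
    factor : ∀ a b c → a ℚ.* b ℚ.- a ℚ.* c ≡ a ℚ.* (b ℚ.- c)
    factor = solve 3 (λ a b c → a :* b :- a :* c := a :* (b :- c)) ≡.refl
    ∣*-*∣<ε : ∀ a b c {K} → 0ℚ ℚ.< K → ℚ.∣ a ∣ ℚ.≤ K → ℚ.∣ b ℚ.- c ∣ ℚ.< ε ℚ.* recip K →
      ℚ.∣ a ℚ.* b ℚ.- a ℚ.* c ∣ ℚ.< ε
    ∣*-*∣<ε a b c {K} 0<K a≤K b-c<η = begin-strict
      ℚ.∣ a ℚ.* b ℚ.- a ℚ.* c ∣
        ≡⟨ ≡.cong ℚ.∣_∣ (factor a b c) ⟩
      ℚ.∣ a ℚ.* (b ℚ.- c) ∣
        ≡⟨ ℚ.∣p*q∣≡∣p∣*∣q∣ a (b ℚ.- c) ⟩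
      ℚ.∣ a ∣ ℚ.* ℚ.∣ b ℚ.- c ∣
        ≤⟨ ℚ.*-monoʳ-≤-nonNeg ℚ.∣ b ℚ.- c ∣ {{ℚ.∣-∣-nonNeg (b ℚ.- c)}} a≤K ⟩
      K ℚ.* ℚ.∣ b ℚ.- c ∣
        <⟨ ℚ.*-monoʳ-<-pos K {{ℚ.positive 0<K}} b-c<η ⟩
      K ℚ.* (ε ℚ.* recip K)
        ≡⟨ swap K ε (recip K) ⟩
      ε ℚ.* (K ℚ.* recip K)
        ≡⟨ ≡.cong (ε ℚ.*_) (*-recip K 0<K) ⟩
      ε ℚ.* 1ℚ
        ≡⟨ ℚ.*-identityʳ ε ⟩
      ε ∎
      where open ℚ.≤-Reasoning

  *-comm : ∀ x y → x * y ≈ y * x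
  *-comm x y = ptw {x * y} {y * x} (λ n → ℚ.*-comm (seq x n) (seq y n))

  *-cong : ∀ {x y u v} → x ≈ y → u ≈ v → x * u ≈ y * v
  *-cong {x} {y} {u} {v} x≈y u≈v =
    ≈-trans {x * u} {x * v} {y * v} (*-congˡ x {u} {v} u≈v)
      (≈-trans {x * v} {v * x} {y * v} (*-comm x v)
        (≈-trans {v * x} {v * y} {y * v} (*-congˡ v {x} {y} x≈y) (*-comm v y)))

  +-assoc : ∀ x y z → (x + y) + z ≈ x + (y + z)
  +-assoc x y z = ptw {(x + y) + z} {x + (y + z)} (λ n → ℚ.+-assoc (seq x n) (seq y n) (seq z n))

  +-comm : ∀ x y → x + y ≈ y + x
  +-comm x y = ptw {x + y} {y + x} (λ n → ℚ.+-comm (seq x n) (seq y n))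

  +-identityˡ : ∀ x → 0ℝ + x ≈ x
  +-identityˡ x = ptw {0ℝ + x} {x} (λ n → ℚ.+-identityˡ (seq x n))

  +-identityʳ : ∀ x → x + 0ℝ ≈ x
  +-identityʳ x = ptw {x + 0ℝ} {x} (λ n → ℚ.+-identityʳ (seq x n))

  -‿inverseˡ : ∀ x → - x + x ≈ 0ℝ
  -‿inverseˡ x = ptw { - x + x} {0ℝ} (λ n → ℚ.+-inverseˡ (seq x n))

  -‿inverseʳ : ∀ x → x - x ≈ 0ℝ
  -‿inverseʳ x = ptw {x - x} {0ℝ} (λ n → ℚ.+-inverseʳ (seq x n))

  *-assoc : ∀ x y z → (x * y) * z ≈ x * (y * z)
  *-assoc x y z = ptw {(x * y) * z} {x * (y * z)} (λ n → ℚ.*-assoc (seq x n) (seq y n) (seq z n))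

  *-identityˡ : ∀ x → 1ℝ * x ≈ x
  *-identityˡ x = ptw {1ℝ * x} {x} (λ n → ℚ.*-identityˡ (seq x n))

  *-identityʳ : ∀ x → x * 1ℝ ≈ x
  *-identityʳ x = ptw {x * 1ℝ} {x} (λ n → ℚ.*-identityʳ (seq x n))

  distribˡ : ∀ x y z → x * (y + z) ≈ x * y + x * z
  distribˡ x y z = ptw {x * (y + z)} {x * y + x * z} (λ n → ℚ.*-distribˡ-+ (seq x n) (seq y n) (seq z n))

  distribʳ : ∀ x y z → (y + z) * x ≈ y * x + z * x
  distribʳ x y z = ptw {(y + z) * x} {y * x + z * x} (λ n → ℚ.*-distribʳ-+ (seq x n) (seq y n) (seq z n))

q+p-p : ∀ p q → q ℚ.+ (p ℚ.- q) ≡ p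
q+p-p = solve 2 (λ p q → q :+ (p :- q) := p) ≡.refl
  where open ℚ-Solver

∣-∣<⇒< : ∀ p q {ε} → ℚ.∣ p ℚ.- q ∣ ℚ.< ε → p ℚ.< q ℚ.+ ε
∣-∣<⇒< p q {ε} h = subst (ℚ._< q ℚ.+ ε) (q+p-p p q) (ℚ.+-monoʳ-< q (ℚ.≤-<-trans (p≤∣p∣ (p ℚ.- q)) h))

+-cancelʳ-≤ : ∀ p q r → p ℚ.+ r ℚ.≤ q ℚ.+ r → p ℚ.≤ q
+-cancelʳ-≤ p q r h = ≡.subst₂ ℚ._≤_ (lem p r) (lem q r) (ℚ.+-monoˡ-≤ (ℚ.- r) h)
  where
  open ℚ-Solver
  lem : ∀ p r → (p ℚ.+ r) ℚ.- r ≡ p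
  lem = solve 2 (λ p r → (p :+ r) :- r := p) ≡.refl

0<⇒bounded-away : ∀ x → 0ℝ < x → ∃[ ε ] 0ℚ ℚ.< ε × Eventually (λ n → ε ℚ.≤ seq x n)
0<⇒bounded-away x (ε , 0<ε , ev) =
  ε , 0<ε , ev-map (λ n → subst (ℚ._≤ seq x n) (ℚ.+-identityˡ ε)) ev

bounded-away⇒0< : ∀ x ε → 0ℚ ℚ.< ε → Eventually (λ n → ε ℚ.≤ seq x n) → 0ℝ < x
bounded-away⇒0< x ε 0<ε ev =
  ε , 0<ε , ev-map (λ n → subst (ℚ._≤ seq x n) (≡.sym (ℚ.+-identityˡ ε))) ev

abstract
  0<y-x⇒x<y : ∀ x y → 0ℝ < y - x → x < y
  0<y-x⇒x<y x y 0<y-x =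
    let ε , 0<ε , ev = 0<⇒bounded-away (y - x) 0<y-x
    in ε , 0<ε , ev-map (λ n h →
      subst (seq x n ℚ.+ ε ℚ.≤_) (q+p-p (seq y n) (seq x n)) (ℚ.+-monoʳ-≤ (seq x n) h)) ev

  0<-resp-≈ : ∀ {x y} → x ≈ y → 0ℝ < x → 0ℝ < y
  0<-resp-≈ {x} {y} x≈y 0<x =
    let ε , 0<ε , ev = 0<⇒bounded-away x 0<x
        δ = ½ ℚ.* ε
        0<δ = ℚ-0<½* 0<ε
    in bounded-away⇒0< y δ 0<δ (ev-map₂
      (λ n h₁ h₂ → +-cancelʳ-≤ δ (seq y n) δ (subst (ℚ._≤ seq y n ℚ.+ δ) (≡.sym (½+½ ε))
        (ℚ.≤-trans h₁ (ℚ.<⇒≤ (∣-∣<⇒< (seq x n) (seq y n) h₂)))))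
      ev (x≈y δ 0<δ))

  0<-+ : ∀ {x y} → 0ℝ < x → 0ℝ < y → 0ℝ < x + y
  0<-+ {x} {y} 0<x 0<y =
    let ε , 0<ε , ev₁ = 0<⇒bounded-away x 0<x
        δ , 0<δ , ev₂ = 0<⇒bounded-away y 0<y
    in bounded-away⇒0< (x + y) (ε ℚ.+ δ)
      (subst (ℚ._< ε ℚ.+ δ) (ℚ.+-identityˡ 0ℚ) (ℚ.+-mono-< 0<ε 0<δ))
      (ev-map₂ (λ n → ℚ.+-mono-≤) ev₁ ev₂)

  0<-* : ∀ {x y} → 0ℝ < x → 0ℝ < y → 0ℝ < x * y
  0<-* {x} {y} 0<x 0<y =
    let ε , 0<ε , ev₁ = 0<⇒bounded-away x 0<x
        δ , 0<δ , ev₂ = 0<⇒bounded-away y 0<y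
    in bounded-away⇒0< (x * y) (ε ℚ.* δ) (ℚ-0<* 0<ε 0<δ) (ev-map₂
      (λ n h₁ h₂ → ℚ.≤-trans
        (ℚ.*-monoˡ-≤-nonNeg ε {{ℚ.nonNegative (ℚ.<⇒≤ 0<ε)}} h₂)
        (ℚ.*-monoʳ-≤-nonNeg (seq y n) {{ℚ.nonNegative (ℚ.≤-trans (ℚ.<⇒≤ 0<δ) h₂)}} h₁))
      ev₁ ev₂)

  0≮0 : ¬ 0ℝ < 0ℝ
  0≮0 0<0 = let ε , 0<ε , ev = 0<⇒bounded-away 0ℝ 0<0 in ℚ.<-irrefl ≡.refl (ℚ.<-≤-trans 0<ε (ev-const ev))

  0<-asym : ∀ {x} → 0ℝ < x → ¬ 0ℝ < - x
  0<-asym {x} 0<x 0<-x = 0≮0 (0<-resp-≈ {x - x} {0ℝ} (-‿inverseʳ x) (0<-+ {x} { - x} 0<x 0<-x))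

  -- A tail stays within ε/4 of its first member. Were that member at least ε/2, the tail would be
  -- bounded below by ε/4 and `x` would be positive. The case distinction is on a rational, hence
  -- decidable.
  ≮0⇒eventually< : ∀ x → ¬ 0ℝ < x → ∀ ε → 0ℚ ℚ.< ε → Eventually (λ n → seq x n ℚ.< ε)
  ≮0⇒eventually< x x≮0 ε 0<ε =
    let δ = ½ ℚ.* (½ ℚ.* ε)
        0<δ = ℚ-0<½* (ℚ-0<½* 0<ε)
        N , h = cauchy x δ 0<δ
        xN<xn+δ = λ n N≤n → ∣-∣<⇒< (seq x N) (seq x n) (h N n ℕ.≤-refl N≤n)
        xn<xN+δ = λ n N≤n → ∣-∣<⇒< (seq x n) (seq x N) (h n N N≤n ℕ.≤-refl)
    in case ℚ.≤-total (½ ℚ.* ε) (seq x N) of λ where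
      (inj₁ ½ε≤xN) → ⊥-elim (x≮0 (bounded-away⇒0< x δ 0<δ (N , λ n N≤n → +-cancelʳ-≤ δ (seq x n) δ
        (subst (ℚ._≤ seq x n ℚ.+ δ) (≡.sym (½+½ (½ ℚ.* ε))) (ℚ.≤-trans ½ε≤xN (ℚ.<⇒≤ (xN<xn+δ n N≤n)))))))
      (inj₂ xN≤½ε) → N , λ n N≤n → ℚ.<-≤-trans (xn<xN+δ n N≤n)
        (ℚ.≤-trans (ℚ.+-mono-≤ xN≤½ε
          (subst (½ ℚ.* (½ ℚ.* ε) ℚ.≤_) (½+½ (½ ℚ.* ε))
            (subst (ℚ._≤ ½ ℚ.* (½ ℚ.* ε) ℚ.+ ½ ℚ.* (½ ℚ.* ε)) (ℚ.+-identityʳ (½ ℚ.* (½ ℚ.* ε)))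
              (ℚ.+-monoʳ-≤ (½ ℚ.* (½ ℚ.* ε)) (ℚ.<⇒≤ 0<δ)))))
          (ℚ.≤-reflexive (½+½ ε)))

  ≮0∧≮0⇒≈0 : ∀ x → ¬ 0ℝ < x → ¬ 0ℝ < - x → x ≈ 0ℝ
  ≮0∧≮0⇒≈0 x x≮ -x≮ ε 0<ε = ev-map₂ (λ n h₁ h₂ → bound (seq x n) h₁ h₂)
    (≮0⇒eventually< x x≮ ε 0<ε) (≮0⇒eventually< (- x) -x≮ ε 0<ε)
    where
    bound : ∀ p → p ℚ.< ε → ℚ.- p ℚ.< ε → ℚ.∣ p ℚ.- 0ℚ ∣ ℚ.< ε
    bound p p<ε -p<ε = subst (λ q → ℚ.∣ q ∣ ℚ.< ε) (≡.sym (ℚ.+-identityʳ p)) (case ℚ.≤-total 0ℚ p of λ where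
      (inj₁ 0≤p) → subst (ℚ._< ε) (≡.sym (ℚ.0≤p⇒∣p∣≡p 0≤p)) p<ε
      (inj₂ p≤0) → subst (ℚ._< ε) (≡.trans (≡.sym (ℚ.0≤p⇒∣p∣≡p (ℚ.neg-antimono-≤ p≤0))) (ℚ.∣-p∣≡∣p∣ p)) -p<ε)

abstract
  x<0⇒0<-x : ∀ {x} → x < 0ℝ → 0ℝ < - x
  x<0⇒0<-x {x} x<0 = 0<-resp-≈ {0ℝ - x} { - x} (+-identityˡ (- x)) (x<y⇒0<y-x x 0ℝ x<0)

  0<-x⇒x<0 : ∀ {x} → 0ℝ < - x → x < 0ℝ
  0<-x⇒x<0 {x} 0<-x = 0<y-x⇒x<y x 0ℝ
    (0<-resp-≈ { - x} {0ℝ - x} (≈-sym {0ℝ - x} { - x} (+-identityˡ (- x))) 0<-x)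

  -- As `_≤_` is a negation, this doubly negated dichotomy is enough for the proofs about sums and
  -- products.
  0≤⇒0<⊎≈0 : ∀ {x} → 0ℝ ≤ x → ¬ ¬ (0ℝ < x ⊎ x ≈ 0ℝ)
  0≤⇒0<⊎≈0 {x} 0≤x k = k (inj₂ (≮0∧≮0⇒≈0 x (k ∘ inj₁) (0≤x ∘ 0<-x⇒x<0 {x})))

  0<⇒0≤ : ∀ {x} → 0ℝ < x → 0ℝ ≤ x
  0<⇒0≤ {x} 0<x x<0 = 0<-asym {x} 0<x (x<0⇒0<-x {x} x<0)

  ≤-total : ∀ x y → ¬ x ≤ y → y ≤ x
  ≤-total x y x≰y x<y = x≰y λ y<x → 0<-asym {y - x} (x<y⇒0<y-x x y x<y)
    (0<-resp-≈ {x - y} { - (y - x)} (ptw {x - y} { - (y - x)} (λ n → swap (seq x n) (seq y n))) (x<y⇒0<y-x y x y<x))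
    where
    open ℚ-Solver
    swap : ∀ p q → p ℚ.- q ≡ ℚ.- (q ℚ.- p)
    swap = solve 2 (λ p q → p :- q := :- (q :- p)) ≡.refl

  0≤-resp-≈ : ∀ {x y} → x ≈ y → 0ℝ ≤ x → 0ℝ ≤ y
  0≤-resp-≈ {x} {y} x≈y 0≤x y<0 = 0≤x (0<-x⇒x<0 {x}
    (0<-resp-≈ { - y} { - x} (-‿cong {y} {x} (≈-sym {x} {y} x≈y)) (x<0⇒0<-x {y} y<0)))

  private
    x-y≈ : ∀ x y → - (y - x) ≈ x - y
    x-y≈ x y = ptw { - (y - x)} {x - y} (λ n → swap (seq x n) (seq y n))
      where
      open ℚ-Solver
      swap : ∀ p q → ℚ.- (q ℚ.- p) ≡ p ℚ.- q
      swap = solve 2 (λ p q → :- (q :- p) := p :- q) ≡.refl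

  x≤y⇒0≤y-x : ∀ {x y} → x ≤ y → 0ℝ ≤ y - x
  x≤y⇒0≤y-x {x} {y} x≤y y-x<0 = x≤y (0<y-x⇒x<y y x
    (0<-resp-≈ { - (y - x)} {x - y} (x-y≈ x y) (x<0⇒0<-x {y - x} y-x<0)))

  0≤y-x⇒x≤y : ∀ {x y} → 0ℝ ≤ y - x → x ≤ y
  0≤y-x⇒x≤y {x} {y} 0≤y-x y<x = 0≤y-x (0<-x⇒x<0 {y - x}
    (0<-resp-≈ {x - y} { - (y - x)} (≈-sym { - (y - x)} {x - y} (x-y≈ x y)) (x<y⇒0<y-x y x y<x)))

  0≤-+ : ∀ {x y} → 0ℝ ≤ x → 0ℝ ≤ y → 0ℝ ≤ x + y
  0≤-+ {x} {y} 0≤x 0≤y x+y<0 = 0≤⇒0<⊎≈0 {x} 0≤x (λ where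
    (inj₁ 0<x) → 0≤y (0<-x⇒x<0 {y} (0<-resp-≈ { - (x + y) + x} { - y}
      (ptw { - (x + y) + x} { - y} (λ n → cancel (seq x n) (seq y n))) (0<-+ { - (x + y)} {x} 0<-[x+y] 0<x)))
    (inj₂ x≈0) → 0≤y (0<-x⇒x<0 {y} (0<-resp-≈ { - (x + y)} { - y}
      (-‿cong {x + y} {y} (≈-trans {x + y} {0ℝ + y} {y} (+-cong {x} {0ℝ} {y} {y} x≈0 (≈-refl {y})) (+-identityˡ y)))
      0<-[x+y])))
    where
    open ℚ-Solver
    0<-[x+y] : 0ℝ < - (x + y)
    0<-[x+y] = x<0⇒0<-x {x + y} x+y<0
    cancel : ∀ p q → ℚ.- (p ℚ.+ q) ℚ.+ p ≡ ℚ.- q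
    cancel = solve 2 (λ p q → :- (p :+ q) :+ p := :- q) ≡.refl

  0≤-* : ∀ {x y} → 0ℝ ≤ x → 0ℝ ≤ y → 0ℝ ≤ x * y
  0≤-* {x} {y} 0≤x 0≤y xy<0 = 0≤⇒0<⊎≈0 {x} 0≤x (λ where
    (inj₂ x≈0) → absurd (≈-trans {x * y} {0ℝ * y} {0ℝ} (*-cong {x} {0ℝ} {y} {y} x≈0 (≈-refl {y}))
      (ptw {0ℝ * y} {0ℝ} (λ n → ℚ.*-zeroˡ (seq y n))))
    (inj₁ 0<x) → 0≤⇒0<⊎≈0 {y} 0≤y λ where
      (inj₂ y≈0) → absurd (≈-trans {x * y} {x * 0ℝ} {0ℝ} (*-congˡ x {y} {0ℝ} y≈0)
        (ptw {x * 0ℝ} {0ℝ} (λ n → ℚ.*-zeroʳ (seq x n))))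
      (inj₁ 0<y) → 0<-asym {x * y} (0<-* {x} {y} 0<x 0<y) 0<-xy)
    where
    0<-xy : 0ℝ < - (x * y)
    0<-xy = x<0⇒0<-x {x * y} xy<0
    absurd : ¬ x * y ≈ 0ℝ
    absurd xy≈0 = 0≮0 (0<-resp-≈ { - (x * y)} {0ℝ} (≈-trans { - (x * y)} { - 0ℝ} {0ℝ}
      (-‿cong {x * y} {0ℝ} xy≈0) (ptw { - 0ℝ} {0ℝ} (λ _ → ≡.refl))) 0<-xy)

  0<1 : 0ℝ < 1ℝ
  0<1 = bounded-away⇒0< 1ℝ 1ℚ (ℚ.positive⁻¹ 1ℚ) (0 , λ _ _ → ℚ.≤-refl)

  0≤-cancel : ∀ {x p} → 1ℝ ≤ p → 0ℝ ≤ x * p → 0ℝ ≤ x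
  0≤-cancel {x} {p} 1≤p 0≤xp x<0 = 0≤⇒0<⊎≈0 {p - 1ℝ} (x≤y⇒0≤y-x {1ℝ} {p} 1≤p) (λ where
    (inj₁ 0<p-1) → absurd (0<-resp-≈ {1ℝ + (p - 1ℝ)} {p}
      (ptw {1ℝ + (p - 1ℝ)} {p} (λ n → q+p-p (seq p n) 1ℚ)) (0<-+ {1ℝ} {p - 1ℝ} 0<1 0<p-1))
    (inj₂ p-1≈0) → absurd (0<-resp-≈ {1ℝ} {p} (≈-trans {1ℝ} {1ℝ + (p - 1ℝ)} {p}
      (≈-trans {1ℝ} {1ℝ + 0ℝ} {1ℝ + (p - 1ℝ)} (≈-sym {1ℝ + 0ℝ} {1ℝ} (+-identityʳ 1ℝ))
        (+-cong {1ℝ} {1ℝ} {0ℝ} {p - 1ℝ} (≈-refl {1ℝ}) (≈-sym {p - 1ℝ} {0ℝ} p-1≈0)))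
      (ptw {1ℝ + (p - 1ℝ)} {p} (λ n → q+p-p (seq p n) 1ℚ))) 0<1))
    where
    absurd : ¬ 0ℝ < p
    absurd 0<p = 0≤xp (0<-x⇒x<0 {x * p} (0<-resp-≈ { - x * p} { - (x * p)}
      (ptw { - x * p} { - (x * p)} (λ n → ≡.sym (ℚ.neg-distribˡ-* (seq x n) (seq p n))))
      (0<-* { - x} {p} (x<0⇒0<-x {x} x<0) 0<p)))

-- Unlike _≈_ and _≤_, these do not unfold, so that real numbers can be inferred from them.
infix 4 _≃_ _≦_

record _≃_ (x y : ℝ) : Set where
  constructor ⟪_⟫
  field ≃⇒≈ : x ≈ y

record _≦_ (x y : ℝ) : Set where
  constructor ⟪_⟫
  field ≦⇒≤ : x ≤ y

open _≃_ public
open _≦_ public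

ℝ-commutativeRing : CommutativeRing 0ℓ 0ℓ
ℝ-commutativeRing = record
  { Carrier = ℝ
  ; _≈_ = _≃_
  ; _+_ = _+_
  ; _*_ = _*_
  ; -_ = -_
  ; 0# = 0ℝ
  ; 1# = 1ℝ
  ; isCommutativeRing = record
    { isRing = record
      { +-isAbelianGroup = record
        { isGroup = record
          { isMonoid = record
            { isSemigroup = record
              { isMagma = record
                { isEquivalence = record
                  { refl  = λ {x} → ⟪ ≈-refl {x} ⟫
                  ; sym   = λ {x} {y} p → ⟪ ≈-sym {x} {y} (≃⇒≈ p) ⟫
                  ; trans = λ {x} {y} {z} p q → ⟪ ≈-trans {x} {y} {z} (≃⇒≈ p) (≃⇒≈ q) ⟫
                  }
                ; ∙-cong = λ {x} {y} {u} {v} p q → ⟪ +-cong {x} {y} {u} {v} (≃⇒≈ p) (≃⇒≈ q) ⟫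
                }
              ; assoc = λ x y z → ⟪ +-assoc x y z ⟫
              }
            ; identity = (λ x → ⟪ +-identityˡ x ⟫) , (λ x → ⟪ +-identityʳ x ⟫)
            }
          ; inverse = (λ x → ⟪ -‿inverseˡ x ⟫) , (λ x → ⟪ -‿inverseʳ x ⟫)
          ; ⁻¹-cong = λ {x} {y} p → ⟪ -‿cong {x} {y} (≃⇒≈ p) ⟫
          }
        ; comm = λ x y → ⟪ +-comm x y ⟫
        }
      ; *-cong = λ {x} {y} {u} {v} p q → ⟪ *-cong {x} {y} {u} {v} (≃⇒≈ p) (≃⇒≈ q) ⟫
      ; *-assoc = λ x y z → ⟪ *-assoc x y z ⟫
      ; *-identity = (λ x → ⟪ *-identityˡ x ⟫) , (λ x → ⟪ *-identityʳ x ⟫)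
      ; distrib = (λ x y z → ⟪ distribˡ x y z ⟫) , (λ x y z → ⟪ distribʳ x y z ⟫)
      }
    ; *-comm = λ x y → ⟪ *-comm x y ⟫
    }
  }

ℝ-stablyOrderedRing : StablyOrderedRing
ℝ-stablyOrderedRing = record
  { commutativeRing = ℝ-commutativeRing
  ; _≼_ = _≦_
  ; ≼-stable = λ ¬¬x≤y → ⟪ (λ y<x → ¬¬x≤y λ x≤y → ≦⇒≤ x≤y y<x) ⟫
  ; ≼-total = λ x y x≰y → ⟪ ≤-total x y (λ x≤y → x≰y ⟪ x≤y ⟫) ⟫
  ; 0≼-resp-≈ = λ {x} {y} x≈y 0≤x → ⟪ 0≤-resp-≈ {x} {y} (≃⇒≈ x≈y) (≦⇒≤ 0≤x) ⟫
  ; x≼y⇒0≼y-x = λ {x} {y} x≤y → ⟪ x≤y⇒0≤y-x {x} {y} (≦⇒≤ x≤y) ⟫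
  ; 0≼y-x⇒x≼y = λ {x} {y} 0≤y-x → ⟪ 0≤y-x⇒x≤y {x} {y} (≦⇒≤ 0≤y-x) ⟫
  ; 0≼-+ = λ {x} {y} 0≤x 0≤y → ⟪ 0≤-+ {x} {y} (≦⇒≤ 0≤x) (≦⇒≤ 0≤y) ⟫
  ; 0≼-* = λ {x} {y} 0≤x 0≤y → ⟪ 0≤-* {x} {y} (≦⇒≤ 0≤x) (≦⇒≤ 0≤y) ⟫
  ; 0≼-cancel = λ {x} {p} 1≤p 0≤xp → ⟪ 0≤-cancel {x} {p} (≦⇒≤ 1≤p) (≦⇒≤ 0≤xp) ⟫
  ; 0≼1 = ⟪ 0<⇒0≤ {1ℝ} 0<1 ⟫
  ; integer = fromℤ
  ; integer-+ = λ i j → ⟪ ptw {fromℤ (i ℤ.+ j)} {fromℤ i + fromℤ j} (λ _ → /1-+ i j) ⟫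
  ; integer-* = λ i j → ⟪ ptw {fromℤ (i ℤ.* j)} {fromℤ i * fromℤ j} (λ _ → /1-* i j) ⟫
  ; integer-neg = λ i → ⟪ ptw {fromℤ (ℤ.- i)} { - fromℤ i} (λ _ → /1-neg i) ⟫
  ; integer-0 = ⟪ ≈-refl {0ℝ} ⟫
  ; integer-1 = ⟪ ≈-refl {1ℝ} ⟫
  }

abstract
  *-inverse : ∀ x 0<x → x * inverse x 0<x ≃ 1ℝ
  *-inverse x 0<x = ⟪ (λ ε 0<ε →
    let δ , 0<δ , ev = 0<⇒bounded-away x 0<x
    in ev-map (λ n δ≤xn → subst (ℚ._< ε)
         (≡.cong ℚ.∣_∣ (≡.sym (≡.trans (≡.cong (ℚ._- 1ℚ) (*-recip (seq x n) (ℚ.<-≤-trans 0<δ δ≤xn))) (ℚ.+-inverseʳ 1ℚ)))) 0<ε) ev) ⟫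

  inverse-unique : ∀ x p q → inverse x p ≃ inverse x q
  inverse-unique x p q = ⟪ ptw {inverse x p} {inverse x q} (λ _ → ≡.refl) ⟫

  0≤inverse : ∀ x 0<x → 0ℝ ≦ inverse x 0<x
  0≤inverse x 0<x = ⟪ (λ x⁻¹<0 →
    let δ , 0<δ , ev₁ = 0<⇒bounded-away x 0<x
        ε , 0<ε , ev₂ = 0<⇒bounded-away (- inverse x 0<x) (x<0⇒0<-x {inverse x 0<x} x⁻¹<0)
    in ev-const (ev-map₂ (λ n δ≤xn ε≤ → ℚ.<-asym (ℚ.neg-antimono-< (0<recip (ℚ.<-≤-trans 0<δ δ≤xn)))
         (ℚ.<-≤-trans 0<ε ε≤)) ev₁ ev₂)) ⟫

module ℝʳ = StablyOrderedRing ℝ-stablyOrderedRing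
open OrderedRingProperties ℝ-stablyOrderedRing
open Transport ℝ-stablyOrderedRing
open EdgeInequalities ℝ-stablyOrderedRing using (1≼⇒0≼)
open NonNegativelyCurvedWeight ℝ-stablyOrderedRing using (branch-bound)

1⋠0 : ¬ natural 1 ≦ 0ℝ
1⋠0 1≤0 = ≦⇒≤ 1≤0 0<1

-- The limit α → 1

fromℚ-mono : ∀ {p q} → p ℚ.≤ q → fromℚ p ≤ fromℚ q
fromℚ-mono {p} {q} p≤q (ε , 0<ε , N , h) = ℚ.<-irrefl ≡.refl (ℚ.<-≤-trans
  (subst (ℚ._< q ℚ.+ ε) (ℚ.+-identityʳ q) (ℚ.+-monoʳ-< q 0<ε)) (ℚ.≤-trans (h N ℕ.≤-refl) p≤q))

near-one : ∀ δ → 0ℝ < δ → ∃[ α ] 0ℝ ≤ α × α < 1ℝ × 1ℝ - δ < α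
near-one δ 0<δ =
  let d , 0<d , ev = 0<⇒bounded-away δ 0<δ
      -- The minimum with 1 keeps α = 1 - η non-negative, and taking half of it makes 1 - δ < α
      -- strict.
      m = d ℚ.⊓ 1ℚ
      0<m = [ (λ eq → subst (0ℚ ℚ.<_) (≡.sym eq) 0<d) , (λ eq → subst (0ℚ ℚ.<_) (≡.sym eq) (ℚ.positive⁻¹ 1ℚ)) ]′ (ℚ.⊓-sel d 1ℚ)
      η = ½ ℚ.* m
      0<η = ℚ-0<½* 0<m
      m-η≡η = halve m
      η≤m = subst (ℚ._≤ m) (ℚ.+-identityʳ η) (subst (η ℚ.+ 0ℚ ℚ.≤_) (½+½ m) (ℚ.+-monoʳ-≤ η (ℚ.<⇒≤ 0<η)))
      0≤1-η = subst (ℚ._≤ 1ℚ ℚ.- η) (ℚ.+-inverseʳ η) (ℚ.+-monoˡ-≤ (ℚ.- η) (ℚ.≤-trans η≤m (ℚ.p⊓q≤q d 1ℚ)))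
  in fromℚ (1ℚ ℚ.- η) , fromℚ-mono 0≤1-η ,
     (η , 0<η , 0 , λ _ _ → ℚ.≤-reflexive (cancel 1ℚ η)) ,
     (η , 0<η , ev-map (λ n d≤δn → subst (1ℚ ℚ.- seq δ n ℚ.+ η ℚ.≤_) (m-η≡η)
       (ℚ.+-monoˡ-≤ η (ℚ.+-monoʳ-≤ 1ℚ (ℚ.neg-antimono-≤ (ℚ.≤-trans (ℚ.p⊓q≤p d 1ℚ) d≤δn))))) ev)
  where
  open ℚ-Solver
  cancel : ∀ p q → (p ℚ.- q) ℚ.+ q ≡ p
  cancel = solve 2 (λ p q → (p :- q) :+ q := p) ≡.refl
  halve : ∀ m → (1ℚ ℚ.- m) ℚ.+ ½ ℚ.* m ≡ 1ℚ ℚ.- ½ ℚ.* m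
  halve m = subst (λ k → (1ℚ ℚ.- k) ℚ.+ ½ ℚ.* m ≡ 1ℚ ℚ.- ½ ℚ.* m) (½+½ m) (rearrange 1ℚ (½ ℚ.* m))
    where
    rearrange : ∀ p h → (p ℚ.- (h ℚ.+ h)) ℚ.+ h ≡ p ℚ.- h
    rearrange = solve 2 (λ p h → (p :- (h :+ h)) :+ h := p :- h) ≡.refl

-- `L - - E` is the lower bound L - ε in the definition of the limit for the tolerance ε = -E.
squeeze : ∀ {L E q} → 0ℝ ≤ L → q ≦ E → ¬ L - - E < q
squeeze {L} {E} {q} 0≤L q≤E L+E<q = ≦⇒≤ 0≤-gap (0<-x⇒x<0 { - gap} (0<-resp-≈ {gap} { - - gap}
    (≃⇒≈ (solve 1 (λ g → g := :- (:- g)) ℝʳ.refl gap)) (x<y⇒0<y-x (L - - E) q L+E<q)))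
  where
  open Solver
  gap : ℝ
  gap = q - (L - - E)
  0≤-gap : 0ℝ ≦ - gap
  0≤-gap = ℝʳ.0≼-resp-≈ (solve 3 (λ l e q → (e :- q) :+ l := :- (q :- (l :- :- e))) ℝʳ.refl L E q)
    (ℝʳ.0≼-+ (Δ q≤E) ⟪ 0≤L ⟫)

-- Curvature and distortion of weighted trees

module WeightedTree {n} (T : Tree n) (W : Weight (Tree.connectedGraph T)) where
  open Tree T
  open Weight W
  open TreeDistance T

  private
    inc : Fin n → Fin n → ℝ
    inc = incident connectedGraph W
    d : Fin n → ℝ
    d = weightedDegree connectedGraph W

  incident-∼ : ∀ {x y} → x ∼ y → inc x y ≡ w x y
  incident-∼ {x} {y} x∼y with x ∼? y
  ... | yes _   = ≡.refl
  ... | no  x≁y = ⊥-elim (x≁y x∼y)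

  incident-≁ : ∀ {x y} → ¬ x ∼ y → inc x y ≡ 0ℝ
  incident-≁ {x} {y} x≁y with x ∼? y
  ... | yes x∼y = ⊥-elim (x≁y x∼y)
  ... | no  _   = ≡.refl

  -- The decisions inside `measure` become arguments, so that they can be split together with the
  -- indicator in `lazyMass`.
  measureCase : ℝ → ∀ x z → Dec (x ≡ z) → Dec (x ∼ z) → ℝ
  measureCase α x z (yes _) _         = α
  measureCase α x z (no _)  (yes x∼z) = (((1ℝ - α) * w x z) ÷ d x) (weightedDegree-pos connectedGraph W x∼z)
  measureCase α x z (no _)  (no _)    = 0ℝ

  measure≡ : ∀ α x z → measure connectedGraph W α x z ≡ measureCase α x z (x ≟ᶠ z) (x ∼? z)
  measure≡ α x z with x ≟ᶠ z | x ∼? z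
  ... | yes _ | _     = ≡.refl
  ... | no  _ | yes _ = ≡.refl
  ... | no  _ | no  _ = ≡.refl

  module _ {x} (0<d : 0ℝ < d x) where

    measure≃ : ∀ α z → measure connectedGraph W α x z ≃ lazyMass α (inverse (d x) 0<d) (indicator (x ≟ᶠ z)) (inc x z)
    measure≃ α z = ℝʳ.trans (ℝʳ.reflexive (measure≡ α x z)) (cases (x ≟ᶠ z) (x ∼? z))
      where
      cases : (x≟z : Dec (x ≡ z)) (x∼?z : Dec (x ∼ z)) →
        measureCase α x z x≟z x∼?z ≃ lazyMass α (inverse (d x) 0<d) (indicator x≟z) (inc x z)
      cases (yes ≡.refl) _         = lazyMass-self (ℝʳ.reflexive (incident-≁ (∼-irrefl x)))
      cases (no _)     (yes x∼z) = lazyMass-edge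
        (inverse-unique (d x) (weightedDegree-pos connectedGraph W x∼z) 0<d) ℝʳ.refl
        (ℝʳ.reflexive (≡.sym (incident-∼ x∼z)))
      cases (no _)     (no x≁z)  = lazyMass-null (ℝʳ.reflexive (incident-≁ x≁z))

  module _ {x y} (x∼y : x ∼ y) where
    open Potential x∼y

    1/dx 1/dy : ℝ
    1/dx = inverse (d x) (weightedDegree-pos connectedGraph W x∼y)
    1/dy = inverse (d y) (weightedDegree-pos connectedGraph W (∼-sym x∼y))

    curvatureValue : ℝ
    curvatureValue = edgeCurvature 1/dx 1/dy (inc x y) (inc y x)

    potential-incident : ∀ u v {k} c → (u ∼ v → potential v ≡ k) → c ≡ k → natural (potential v) * inc u v ≃ natural c * inc u v
    potential-incident u v c pot ≡.refl = cases (u ∼? v)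
      where
      cases : Dec (u ∼ v) → natural (potential v) * inc u v ≃ natural c * inc u v
      cases (yes u∼v) = ℝʳ.reflexive (≡.cong (λ k → natural k * inc u v) (pot u∼v))
      cases (no u≁v)  = ℝʳ.trans (vanish (natural (potential v))) (ℝʳ.sym (vanish (natural c)))
        where
        vanish : ∀ a → a * inc u v ≃ 0ℝ
        vanish a = ℝʳ.trans (ℝʳ.*-congˡ (ℝʳ.reflexive (incident-≁ u≁v))) (ℝʳ.zeroʳ a)

    module _ (α : ℝ) where

      private
        μ ν : Fin n → ℝ
        μ = measure connectedGraph W α x
        ν = measure connectedGraph W α y

      transport-bound : ℝ
      transport-bound = dualValue α (d x) (d y) 1/dx 1/dy (inc x y) (inc y x)

      transport-bound≤cost : ∀ π → IsCoupling connectedGraph μ ν π → transport-bound ≦ cost connectedGraph π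
      transport-bound≤cost π coupling = dualValue≼cost dist potential potential-lipschitz {x} {y} potential-x potential-y
        (inc x) (inc y)
        (λ z z≢y → potential-incident x z 3 (λ x∼z → potential-x∼ x∼z z≢y) ≡.refl)
        (λ z z≢x → potential-incident y z 0 (λ y∼z → potential-y∼ y∼z z≢x) ≡.refl)
        {α} {1/dx} {1/dy} {μ} {ν}
        (measure≃ (weightedDegree-pos connectedGraph W x∼y) α)
        (measure≃ (weightedDegree-pos connectedGraph W (∼-sym x∼y)) α)
        π (λ u v → ⟪ nonNeg u v ⟫) (λ u → ⟪ marginalˡ u ⟫) (λ v → ⟪ marginalʳ v ⟫)
        where open IsCoupling coupling

      transport-bound≤W₁ : ∀ v → IsW₁ connectedGraph μ ν v → transport-bound ≦ v
      transport-bound≤W₁ v (_ , greatest) = ⟪ greatest transport-bound below ⟫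
        where
        below : ∀ c → ∃[ π ] IsCoupling connectedGraph μ ν π × c ≈ cost connectedGraph π → transport-bound ≤ c
        below c (π , coupling , c≈) = ≦⇒≤ {transport-bound} {c}
          (≼-respʳ {cost connectedGraph π} {c} {transport-bound} (ℝʳ.sym {c} {cost connectedGraph π} ⟪ c≈ ⟫)
            (transport-bound≤cost π coupling))

      κ/[1-α]≤ : ∀ κ (α<1 : α < 1ℝ) → IsCurvature connectedGraph W α x y κ →
        (κ ÷ (1ℝ - α)) (x<y⇒0<y-x α 1ℝ α<1) ≦ curvatureValue
      κ/[1-α]≤ κ α<1 (v , w₁ , κ≈) =
        curvature-bound {α} {d x} {d y} {1/dx} {1/dy} {inc x y} {inc y x} {v} {κ} {inverse (1ℝ - α) 0<1-α}
          (*-inverse (d x) (weightedDegree-pos connectedGraph W x∼y))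
          (0≤inverse (1ℝ - α) 0<1-α) (*-inverse (1ℝ - α) 0<1-α)
          (transport-bound≤W₁ v w₁) ⟪ κ≈ ⟫
        where
        0<1-α : 0ℝ < 1ℝ - α
        0<1-α = x<y⇒0<y-x α 1ℝ α<1

    curvatureValue-nonNeg : ∀ {κ} → IsLLYCurvature connectedGraph W x y κ → 0ℝ ≤ κ → 0ℝ ≦ curvatureValue
    curvatureValue-nonNeg {κ} lly 0≤κ = ⟪ negative ⟫
      where
      negative : ¬ curvatureValue < 0ℝ
      negative E<0 =
        -- A negative bound E would make -E an admissible tolerance, and any α close enough to 1
        -- then gives a contradiction.
        let δ , 0<δ , near = lly (- curvatureValue) (x<0⇒0<-x {curvatureValue} E<0)
            α , 0≤α , α<1 , 1-δ<α = near-one δ 0<δ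
            κ′ , isCurvature , lower , _ = near α 0≤α α<1 1-δ<α
        in squeeze {κ} {curvatureValue} 0≤κ (κ/[1-α]≤ α κ′ α<1 isCurvature) lower

  branchNumber : ℕ
  branchNumber = length branchVertices

  branchNumber≤n : branchNumber ℕ.≤ n
  branchNumber≤n = ℕ.≤-trans (length-filter (λ v → 3 ℕ.≤? degree v) (allFin n)) (ℕ.≤-reflexive (length-tabulate id))

  distortion-bound : ∀ {ε i s} → 0ℝ ≦ ε → ε ≦ natural 1 → natural 2 * natural (n ℕ.* n) * ε ≦ natural 1 →
    Admissible connectedGraph W → (∃[ x ] ∃[ y ] x ∼ y) →
    (∀ r → EdgeValue connectedGraph W r → i ≤ r) → (∀ r → EdgeValue connectedGraph W r → r ≤ s) → (0<i : 0ℝ < i) →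
    natural branchNumber + ε ≦ (s ÷ i) 0<i + natural 1
  distortion-bound {ε} {i} {s} 0≤ε ε≤1 2nnε≤1 admissible (x₀ , y₀ , x₀∼y₀) i≤w w≤s 0<i =
    ℝʳ.≼-stable λ contra → ¬¬-maximum (uncurry u) (x₀ , y₀) (cartesianProduct (allFin n) (allFin n)) λ where
      ((x , y) , _ , maximal) → contra (bound x y (λ a b → maximal (there (∈-cartesianProduct⁺ (∈-allFin a) (∈-allFin b))))
        (maximal (here ≡.refl)))
    where
    j : ℝ
    j = inverse i 0<i
    u : Fin n → Fin n → ℝ
    u x y = inc x y * j
    u≁ : ∀ {x y} → ¬ x ∼ y → u x y ≃ 0ℝ
    u≁ x≁y = ℝʳ.trans (ℝʳ.*-congʳ (ℝʳ.reflexive (incident-≁ x≁y))) (ℝʳ.zeroˡ j)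
    value : ∀ {x y} → x ∼ y → EdgeValue connectedGraph W (inc x y)
    value {x} {y} x∼y = x , y , x∼y , ≃⇒≈ (ℝʳ.reflexive (incident-∼ x∼y))
    inc-sym : ∀ {x y} → x ∼ y → inc x y ≃ inc y x
    inc-sym x∼y = ℝʳ.trans (ℝʳ.reflexive (incident-∼ x∼y))
      (ℝʳ.trans ⟪ w-sym x∼y ⟫ (ℝʳ.reflexive (≡.sym (incident-∼ (∼-sym x∼y)))))
    1≤u : ∀ {x y} → x ∼ y → natural 1 ≦ u x y
    1≤u {x} {y} x∼y = ≼-respˡ (*-inverse i 0<i) (*-monoʳ-≼ (0≤inverse i 0<i) ⟪ i≤w (inc x y) (value x∼y) ⟫)
    u-sym : ∀ {x y} → x ∼ y → u x y ≦ u y x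
    u-sym x∼y = ≼-reflexive (ℝʳ.*-congʳ (inc-sym x∼y))
    0≤d : ∀ {x y} → x ∼ y → 0ℝ ≦ d x
    0≤d {x} x∼y = ⟪ 0<⇒0≤ {d x} (weightedDegree-pos connectedGraph W x∼y) ⟫
    curved : ∀ {x y} → x ∼ y → (sum (u x) - u x y) * (sum (u y) - u y x) ≦ u x y * u x y
    curved {x} {y} x∼y = ≼-respˡ
      (ℝʳ.*-cong (ℝʳ.+-congʳ (*-distribʳ-sum j (inc x))) (ℝʳ.+-congʳ (*-distribʳ-sum j (inc y))))
      (curvature-product {d x} {d y} {1/dx x∼y} {1/dy x∼y} {inc x y} {inc y x} j
        (*-inverse (d x) _) (*-inverse (d y) _) (0≤d x∼y) (0≤d (∼-sym x∼y))
        (let κ , lly , 0≤κ = admissible x y x∼y in curvatureValue-nonNeg x∼y {κ} lly 0≤κ)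
        (ℝʳ.sym (inc-sym x∼y)) (0≤inverse i 0<i))
    branch≡ : branchNumber ≡ Distance.branchCount connectedGraph
    branch≡ = length-filter-tabulate (λ v → 3 ℕ.≤? degree v) id
    bound : ∀ x y → (∀ a b → u a b ≦ u x y) → u x₀ y₀ ≦ u x y → natural branchNumber + ε ≦ s * j + natural 1
    bound x y maximal u₀≤u = go (x ∼? y)
      where
      go : Dec (x ∼ y) → natural branchNumber + ε ≦ s * j + natural 1
      -- `u` vanishes off the edges, while the maximum is at least `u x₀ y₀` and hence at least 1.
      -- So a maximal pair is an edge.
      go (no x≁y)  = ⊥-elim (1⋠0 (≼-trans (1≤u x₀∼y₀) (≼-respʳ (u≁ x≁y) u₀≤u)))
      go (yes x∼y) = ≼-trans
        (branch-bound graph u u≁ 1≤u u-sym curved {u x y} {ε} {branchNumber} maximal 0≤ε ε≤1 2nnε≤1 branchNumber≤n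
          radius
          (λ v → subst (ℕ._≤ behind (suc radius) v v) (≡.sym branch≡) (branchCount≤rooted v))
          (subst (ℕ._≤ behind radius x y ℕ.+ behind radius y x) (≡.sym branch≡) (branchCount≤edge x y))
          x∼y ≼-refl)
        (+-mono-≼ (*-monoʳ-≼ (0≤inverse i 0<i) ⟪ w≤s (inc x y) (value x∼y) ⟫) ≼-refl)
        where
        open Distance connectedGraph
        open Branches graph using (behind)

-- From distortions to the ceiling

0<natural : ∀ k → .{{ℕ.NonZero k}} → 0ℝ < natural k
0<natural (suc zero)    = 0<1
0<natural (suc (suc k)) = 0<-resp-≈ {natural 1 + natural (suc k)} {natural (suc (suc k))}
  (≃⇒≈ (ℝʳ.sym (natural-+ 1 (suc k)))) (0<-+ {natural 1} {natural (suc k)} 0<1 (0<natural (suc k)))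

-- ε = 1 / (2n²), where n² bounds the weighted degree of the root in spread.
gap : ∀ n → .{{ℕ.NonZero n}} → ∃[ ε ] 0ℝ ≦ ε × ε ≦ natural 1 × natural 2 * natural (n ℕ.* n) * ε ≦ natural 1 × ¬ ε ≦ 0ℝ
gap n@(suc n-1) = ε , 0≤ε , ε≤1 , ≼-reflexive pε≈1 , λ ε≤0 → 1⋠0 (≼-respˡ pε≈1
    (≼-trans (≼-reflexive (ℝʳ.*-comm _ ε)) (≼-respʳ (ℝʳ.zeroˡ p) (*-monoʳ-≼ 0≤p ε≤0))))
  where
  p : ℝ
  p = natural 2 * natural (n ℕ.* n)
  0<p : 0ℝ < p
  0<p = 0<-* {natural 2} {natural (n ℕ.* n)} (0<natural 2) (0<natural (n ℕ.* n))
  0≤p : 0ℝ ≦ p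
  0≤p = ⟪ 0<⇒0≤ {p} 0<p ⟫
  ε : ℝ
  ε = inverse p 0<p
  0≤ε : 0ℝ ≦ ε
  0≤ε = 0≤inverse p 0<p
  pε≈1 : p * ε ≃ natural 1
  pε≈1 = *-inverse p 0<p
  1≤p : natural 1 ≦ p
  1≤p = ≼-trans (natural-mono {1} {2 ℕ.* (n ℕ.* n)} (s≤s z≤n)) (≼-reflexive (natural-* 2 (n ℕ.* n)))
  ε≤1 : ε ≦ natural 1
  ε≤1 = ≼-respʳ pε≈1 (≼-trans (≼-reflexive (ℝʳ.sym (ℝʳ.*-identityˡ ε))) (*-monoʳ-≼ 0≤ε 1≤p))

-- If m < b, integrality gives m + 1 ≤ b, and the hypothesis then forces ε ≤ 0.
ceiling-bound : ∀ {b ε m} → ¬ ε ≦ 0ℝ → natural b + ε ≦ fromℤ m + natural 1 → + b ℤ.≤ m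
ceiling-bound {b} {ε} {m} ε≰0 b+ε≤m+1 = ℤ.≮⇒≥ λ m<b → ε≰0 (x≼y⇐y-x≈z _
  (ℝʳ.0≼-+ (Δ b+ε≤m+1) (Δ (≼-trans (≼-reflexive (ℝʳ.sym (ℝʳ.integer-+ (+ 1) m))) (integer-mono (ℤ.i<j⇒suc[i]≤j m<b)))))
  (solve 3 (λ b ε m → ((m :+ con (+ 1)) :- (b :+ ε)) :+ (b :- (con (+ 1) :+ m)) := con (+ 0) :- ε) ℝʳ.refl (natural b) ε (fromℤ m)))
  where open Solver

theorem1p5 : ∀ {n : ℕ} (T : Tree n) (DN : ℝ ⁺) (c : ℤ ⁺) →
    IsDN (Tree.connectedGraph T) DN → IsCeiling DN c →
    [ + length (Tree.branchVertices T) ] ℤ⁺.≤⁺ c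
theorem1p5 T DN c isDN infinite = _ ℤ⁺.≤⊤⁺
theorem1p5 {n} T _ _ isDN (finite {r} {m} r≤m _) = ℤ⁺.[ bound isDN ]
  where
  open Tree T
  B : ℕ
  B = length branchVertices
  instance
    n≢0 : ℕ.NonZero n
    n≢0 = nonEmpty
  ε : ℝ
  ε = proj₁ (gap n)
  0≤ε : 0ℝ ≦ ε
  0≤ε = proj₁ (proj₂ (gap n))
  ε≤1 : ε ≦ natural 1
  ε≤1 = proj₁ (proj₂ (proj₂ (gap n)))
  2nnε≤1 : natural 2 * natural (n ℕ.* n) * ε ≦ natural 1
  2nnε≤1 = proj₁ (proj₂ (proj₂ (proj₂ (gap n))))
  ε≰0 : ¬ ε ≦ 0ℝ
  ε≰0 = proj₂ (proj₂ (proj₂ (proj₂ (gap n))))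
  lower : ℝ
  lower = natural B + ε - natural 1
  lower≤ : ∀ {x} → natural B + ε ≦ x + natural 1 → lower ≦ x
  lower≤ {x} h = x≼y⇐y-x≈z _ (Δ h)
    (solve 3 (λ b ε x → (x :+ con (+ 1)) :- (b :+ ε) := x :- (b :+ ε :- con (+ 1))) ℝʳ.refl (natural B) ε x)
    where open Solver
  lower≤⁻¹ : ∀ {x} → lower ≦ x → natural B + ε ≦ x + natural 1
  lower≤⁻¹ {x} h = x≼y⇐y-x≈z _ (Δ h)
    (solve 3 (λ b ε x → x :- (b :+ ε :- con (+ 1)) := (x :+ con (+ 1)) :- (b :+ ε)) ℝʳ.refl (natural B) ε x)
    where open Solver

  lower≤distortion : (∃[ x ] ∃[ y ] x ∼ y) → ∀ d →
    ∃[ W ] Admissible connectedGraph W × IsDistortion connectedGraph W d → [ lower ] ℝ⁺.≤⁺ d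
  lower≤distortion edge _ (W , admissible , finite {s} {i} {r} (w≤s , _) (i≤w , _) 0<i r≈) =
    ℝ⁺.[ ≦⇒≤ {lower} {r} (≼-respʳ (ℝʳ.sym {r} {(s ÷ i) 0<i} ⟪ r≈ ⟫)
      (lower≤ (WeightedTree.distortion-bound T W {ε} {i} {s} 0≤ε ε≤1 2nnε≤1 admissible edge i≤w w≤s 0<i))) ]
  lower≤distortion _ _ (_ , _ , unbounded _) = _ ℝ⁺.≤⊤⁺
  lower≤distortion _ _ (_ , _ , vanishing _) = _ ℝ⁺.≤⊤⁺

  bound : IsDN connectedGraph [ r ] → + B ℤ.≤ m
  -- A single vertex gives B ≤ 1, which the conventional value 1 covers.
  bound (K₁ n≡1 r≈1) = ceiling-bound ε≰0 (+-mono-≼ (≼-trans (natural-mono B≤1) (≼-trans (≼-reflexive (ℝʳ.sym {r} {1ℝ} ⟪ r≈1 ⟫)) (⟪_⟫ {r} {fromℤ m} r≤m))) ε≤1)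
    where
    B≤1 : B ℕ.≤ 1
    B≤1 = ℕ.≤-trans (length-filter (λ v → 3 ℕ.≤? degree v) (allFin n)) (ℕ.≤-reflexive (≡.trans (length-tabulate id) n≡1))
  bound (hasEdge edge (_ , greatest)) = ceiling-bound ε≰0 (lower≤⁻¹ (≼-trans
    (⟪_⟫ {lower} {r} (ℝ⁺.[≤]-injective (greatest [ lower ] (lower≤distortion edge)))) (⟪_⟫ {r} {fromℤ m} r≤m)))
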